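{- Let $R$ be a finite local Frobenius ring which is not a field and has odd characteristic, with a fixed primitive additive character $\psi$, and let $\tau$ be a non-primitive multiplicative character of $R$. Then $$\sum_{a\in R^\times}|K_\tau(a)|^4=3\,|R^\times|\,|R|^2.$$
   Context: All rings are finite and commutative with identity; $R^\times$ is the unit group; $M$ is the maximal ideal. An additive character $(R,+)\to\mathbb{C}^*$ is primitive if the only ideal on which it is identically $1$ is $(0)$; $R$ is Frobenius if such a character exists. A multiplicative character is a homomorphism $R^\times\to\mathbb{C}^*$; its conductor is $R$ if it is trivial, and otherwise the largest ideal $I\subseteq M$ such that it is identically $1$ on $1+I$; it is primitive if its conductor is $(0)$. $K_\tau(a)=\sum_{u\in R^\times}\tau(u)\psi(u+au^{ -1})$. Odd characteristic means $R/M$ has odd characteristic. -}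

module Defs where

open import Algebra.Bundles using (AbelianGroup; CommutativeMonoid; CommutativeRing; Group)
open import Algebra.Morphism.Structures using (module GroupMorphisms)
import Algebra.Properties.Semiring.Exp as SemiringExp
import Algebra.Properties.Semiring.Mult as SemiringMult
import Algebra.Properties.CommutativeMonoid.Sum as FiniteSum
import Algebra.Properties.Ring as RingProperties
import Algebra.Solver.Ring.NaturalCoefficients.Default as SemiringSolver
open import Data.Empty using (⊥-elim)
open import Data.Fin using (Fin; zero; suc)
open import Data.Fin.Properties using (any?)
open import Data.Integer as ℤ using (+_)
import Data.Integer.Properties as ℤ
open import Data.Nat as ℕ using (ℕ; zero; suc)
open import Data.Nat.Divisibility using (_∣_)
import Data.Nat.Properties as ℕ
open import Data.Product using (Σ; Σ-syntax; ∃; ∃-syntax; _×_; _,_; proj₁; proj₂)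
open import Data.Rational as ℚ using (ℚ; mkℚ; 0ℚ; 1ℚ; ½; ∣_∣)
import Data.Rational.Properties as ℚ
import Data.Rational.Unnormalised as ℚᵘ
import Data.Rational.Unnormalised.Properties as ℚᵘ
open import Data.Rational.Solver using (module +-*-Solver)
open import Data.Sum using (inj₁; inj₂)
open import Data.Unit using (⊤; tt)
open import Function using (_∘_; case_of_; _⇔_; Inverse; mk⇔)
open import Level using (Level; _⊔_; Lift; lift; 0ℓ) renaming (suc to lsuc)
open import Relation.Binary using (Setoid)
import Relation.Binary.Construct.On as On
open import Relation.Binary.PropositionalEquality as ≡ using (_≡_; refl; cong; cong₂; subst; subst₂)
open import Relation.Nullary using (¬_; Dec; yes; no)
open import Relation.Nullary.Decidable using (map′)
open import Relation.Unary using (Decidable; Pred)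

private
  variable
    a b c ℓ : Level

------------------------------------------------------------------------
-- Finite setoids

Finite : Setoid a ℓ → Set (a ⊔ ℓ)
Finite S = Σ[ n ∈ ℕ ] Inverse (≡.setoid (Fin n)) S

card : {S : Setoid a ℓ} → Finite S → ℕ
card = proj₁

∑ : (A : CommutativeMonoid b c) {S : Setoid a ℓ} → Finite S →
    (Setoid.Carrier S → CommutativeMonoid.Carrier A) → CommutativeMonoid.Carrier A
∑ A (n , enum) f = FiniteSum.sum A (f ∘ Inverse.to enum)

private
  decSubset : ∀ {n} (P : Pred (Fin n) ℓ) → Decidable P →
              Finite (On.setoid (≡.setoid (Fin n)) (proj₁ {B = P}))
  decSubset {n = zero} P P? = 0 , record
    { to        = λ ()
    ; from      = λ { (() , _) }
    ; to-cong   = λ { {()} }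
    ; from-cong = λ { {() , _} }
    ; inverse   = (λ { {() , _} }) , (λ { {()} })
    }
  decSubset {n = suc n} P P? with P? zero | decSubset (P ∘ suc) (P? ∘ suc)
  ... | no ¬p | m , e = m , record
    { to        = to
    ; from      = from
    ; to-cong   = λ { refl → refl }
    ; from-cong = λ {x} {y} → from-cong {x} {y}
    ; inverse   = (λ {x} {y} → invˡ {x} {y}) , (λ {x} {y} → invʳ {x} {y})
    }
    where
    module E = Inverse e
    to : Fin m → Σ (Fin (suc n)) P
    to i = suc (proj₁ (E.to i)) , proj₂ (E.to i)
    from : Σ (Fin (suc n)) P → Fin m
    from (zero  , p) = ⊥-elim (¬p p)
    from (suc i , p) = E.from (i , p)
    from-cong : ∀ {x y} → proj₁ x ≡ proj₁ y → from x ≡ from y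
    from-cong {zero  , p} {_ , q} _    = ⊥-elim (¬p p)
    from-cong {suc i , p} {_ , q} refl = E.from-cong refl
    invˡ : ∀ {x y} → y ≡ from x → proj₁ (to y) ≡ proj₁ x
    invˡ {zero  , p} _  = ⊥-elim (¬p p)
    invˡ {suc i , p} eq = cong suc (proj₁ E.inverse {i , p} eq)
    invʳ : ∀ {x y} → proj₁ y ≡ proj₁ (to x) → from y ≡ x
    invʳ {y = zero  , p} _    = ⊥-elim (¬p p)
    invʳ {y = suc i , p} refl = proj₂ E.inverse {y = i , p} refl
  ... | yes p₀ | m , e = suc m , record
    { to        = to
    ; from      = from
    ; to-cong   = λ { refl → refl }
    ; from-cong = λ {x} {y} → from-cong {x} {y}
    ; inverse   = (λ {x} {y} → invˡ {x} {y}) , (λ {x} {y} → invʳ {x} {y})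
    }
    where
    module E = Inverse e
    to : Fin (suc m) → Σ (Fin (suc n)) P
    to zero    = zero , p₀
    to (suc i) = suc (proj₁ (E.to i)) , proj₂ (E.to i)
    from : Σ (Fin (suc n)) P → Fin (suc m)
    from (zero  , p) = zero
    from (suc i , p) = suc (E.from (i , p))
    from-cong : ∀ {x y} → proj₁ x ≡ proj₁ y → from x ≡ from y
    from-cong {zero  , p} {_ , q} refl = refl
    from-cong {suc i , p} {_ , q} refl = cong suc (E.from-cong refl)
    invˡ : ∀ {x y} → y ≡ from x → proj₁ (to y) ≡ proj₁ x
    invˡ {zero  , p} refl = refl
    invˡ {suc i , p} refl = cong suc (proj₁ E.inverse {i , p} refl)
    invʳ : ∀ {x y} → proj₁ y ≡ proj₁ (to x) → from y ≡ x
    invʳ {zero}  {zero  , p} _    = refl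
    invʳ {suc x} {suc i , p} eq   = cong suc (proj₂ E.inverse {x} {i , p} (unsuc eq))
      where
      unsuc : ∀ {k} {i j : Fin k} → Fin.suc i ≡ suc j → i ≡ j
      unsuc refl = refl
    invʳ {zero}  {suc i , p} ()
    invʳ {suc x} {zero  , p} ()

------------------------------------------------------------------------
-- Units

module _ (R : CommutativeRing c ℓ) where
  open CommutativeRing R
  open import Relation.Binary.Reasoning.Setoid setoid

  record Unit : Set (c ⊔ ℓ) where
    constructor unit
    field
      val     : Carrier
      inv     : Carrier
      val*inv : val * inv ≈ 1#

  open Unit

  open import Algebra.Properties.CommutativeSemigroup *-commutativeSemigroup using (interchange)

  unitGroup : AbelianGroup (c ⊔ ℓ) ℓ
  unitGroup = record
    { Carrier = Unit
    ; _≈_     = λ u v → val u ≈ val v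
    ; _∙_     = λ u v → unit (val u * val v) (inv u * inv v) (mul u v)
    ; ε       = unit 1# 1# (*-identityˡ 1#)
    ; _⁻¹     = λ u → unit (inv u) (val u) (trans (*-comm _ _) (val*inv u))
    ; isAbelianGroup = record
      { isGroup = record
        { isMonoid = record
          { isSemigroup = record
            { isMagma = record
              { isEquivalence = On.isEquivalence val isEquivalence
              ; ∙-cong        = *-cong
              }
            ; assoc = λ u v w → *-assoc (val u) (val v) (val w)
            }
          ; identity = (λ u → *-identityˡ (val u)) , (λ u → *-identityʳ (val u))
          }
        ; inverse = (λ u → trans (*-comm _ _) (val*inv u)) , val*inv
        ; ⁻¹-cong = λ {u} {v} → inv-cong u v
        }
      ; comm = λ u v → *-comm (val u) (val v)
      }
    }
    where
    mul : ∀ u v → (val u * val v) * (inv u * inv v) ≈ 1#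
    mul u v = begin
      (val u * val v) * (inv u * inv v) ≈⟨ interchange _ _ _ _ ⟩
      (val u * inv u) * (val v * inv v) ≈⟨ *-cong (val*inv u) (val*inv v) ⟩
      1# * 1#                           ≈⟨ *-identityˡ 1# ⟩
      1#                                ∎
    inv-cong : ∀ u v → val u ≈ val v → inv u ≈ inv v
    inv-cong u v eq = begin
      inv u                   ≈⟨ *-identityʳ _ ⟨
      inv u * 1#              ≈⟨ *-congˡ (val*inv v) ⟨
      inv u * (val v * inv v) ≈⟨ *-assoc _ _ _ ⟨
      (inv u * val v) * inv v ≈⟨ *-congʳ (*-congˡ eq) ⟨
      (inv u * val u) * inv v ≈⟨ *-congʳ (trans (*-comm _ _) (val*inv u)) ⟩
      1# * inv v              ≈⟨ *-identityˡ _ ⟩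
      inv v                   ∎

  unitsFinite : Finite setoid → Finite (AbelianGroup.setoid unitGroup)
  unitsFinite (n , e) = m , record
    { to        = to′
    ; from      = from′
    ; to-cong   = λ { ≡.refl → CommutativeRing.refl R }
    ; from-cong = λ eq → S.from-cong (E.from-cong eq)
    ; inverse   = (λ {u} eq → invˡ u eq) , (λ {i} {u} eq → invʳ i u eq)
    }
    where
    module E = Inverse e
    IsUnit : Pred (Fin n) ℓ
    IsUnit i = ∃[ j ] E.to i * E.to j ≈ 1#
    _≟_ : ∀ x y → Dec (x ≈ y)
    x ≟ y = map′
      (λ eq → trans (sym (E.inverseˡ ≡.refl)) (trans (E.to-cong eq) (E.inverseˡ ≡.refl)))
      E.from-cong
      (E.from x Data.Fin.Properties.≟ E.from y)
    isUnit? : Decidable IsUnit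
    isUnit? i = any? (λ j → (E.to i * E.to j) ≟ 1#)
    subset = decSubset IsUnit isUnit?
    m = proj₁ subset
    module S = Inverse (proj₂ subset)
    to′ : Fin m → Unit
    to′ i = unit (E.to (proj₁ (S.to i))) (E.to (proj₁ (proj₂ (S.to i)))) (proj₂ (proj₂ (S.to i)))
    index : (u : Unit) → Σ (Fin n) IsUnit
    index u = E.from (val u) , E.from (inv u) ,
      trans (*-cong (E.inverseˡ ≡.refl) (E.inverseˡ ≡.refl)) (val*inv u)
    from′ : Unit → Fin m
    from′ u = S.from (index u)
    invˡ : ∀ u {i} → i ≡ from′ u → val (to′ i) ≈ val u
    invˡ u eq = trans (E.to-cong (S.inverseˡ {index u} eq)) (E.inverseˡ ≡.refl)
    invʳ : ∀ i u → val u ≈ val (to′ i) → from′ u ≡ i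
    invʳ i u eq = S.inverseʳ (E.inverseʳ eq)

IsField : CommutativeRing c ℓ → Set (c ⊔ ℓ)
IsField R = ¬ (1# ≈ 0#) × (∀ x → ¬ (x ≈ 0#) → ∃[ y ] x * y ≈ 1#)
  where open CommutativeRing R

-- As usual, p = 0 is allowed: the condition then says that n · 1 = 0 only for n = 0.
HasCharacteristic : CommutativeRing c ℓ → ℕ → Set ℓ
HasCharacteristic R p = ∀ n → (n · 1# ≈ 0#) ⇔ (p ∣ n)
  where
  open CommutativeRing R
  open SemiringMult semiring using () renaming (_×_ to _·_)

OddCharacteristic : CommutativeRing c ℓ → Set ℓ
OddCharacteristic R = ∃[ p ] HasCharacteristic R p × ¬ (2 ∣ p)

------------------------------------------------------------------------
-- Ideals

record Ideal (R : CommutativeRing c ℓ) : Set (lsuc (c ⊔ ℓ)) where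
  open CommutativeRing R
  infix 4 _∈I
  field
    _∈I  : Pred Carrier (c ⊔ ℓ)
    resp : ∀ {x y} → x ≈ y → x ∈I → y ∈I
    0∈   : 0# ∈I
    +∈   : ∀ {x y} → x ∈I → y ∈I → x + y ∈I
    *∈   : ∀ r {x} → x ∈I → r * x ∈I

module _ {R : CommutativeRing c ℓ} where
  open CommutativeRing R
  infix 4 _∈_ _⊆_ _≐_

  _∈_ : Carrier → Ideal R → Set (c ⊔ ℓ)
  x ∈ I = Ideal._∈I I x

  _⊆_ : Ideal R → Ideal R → Set (c ⊔ ℓ)
  I ⊆ J = ∀ {x} → x ∈ I → x ∈ J

  _≐_ : Ideal R → Ideal R → Set (c ⊔ ℓ)
  I ≐ J = (I ⊆ J) × (J ⊆ I)

  IsProper : Ideal R → Set (c ⊔ ℓ)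
  IsProper I = ¬ (1# ∈ I)

  -- Phrased as "every proper J ⊇ I is I" rather than "every J ⊇ I is I or R": ideals here
  -- are arbitrary predicates, and the latter would decide arbitrary propositions.
  IsMaximal : Ideal R → Set (lsuc (c ⊔ ℓ))
  IsMaximal I = IsProper I × (∀ J → I ⊆ J → IsProper J → J ⊆ I)

module _ (R : CommutativeRing c ℓ) where
  open CommutativeRing R

  zeroIdeal : Ideal R
  zeroIdeal = record
    { _∈I  = λ x → Lift c (x ≈ 0#)
    ; resp = λ { x≈y (lift x≈0) → lift (trans (sym x≈y) x≈0) }
    ; 0∈   = lift (CommutativeRing.refl R)
    ; +∈   = λ { (lift x≈0) (lift y≈0) → lift (trans (+-cong x≈0 y≈0) (+-identityˡ 0#)) }
    ; *∈   = λ { r (lift x≈0) → lift (trans (*-congˡ x≈0) (zeroʳ r)) }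
    }

  unitIdeal : Ideal R
  unitIdeal = record
    { _∈I = λ _ → Lift (c ⊔ ℓ) ⊤ ; resp = λ _ _ → _ ; 0∈ = _ ; +∈ = λ _ _ → _ ; *∈ = λ _ _ → _ }

  record IsLocal : Set (lsuc (c ⊔ ℓ)) where
    field
      maximalIdeal : Ideal R
      isMaximal    : IsMaximal maximalIdeal
      unique       : ∀ N → IsMaximal N → N ≐ maximalIdeal

module _ (R : CommutativeRing c ℓ) (I : Ideal R) where
  open CommutativeRing R
  open Ideal I
  open RingProperties ring using (-‿distribˡ-*; -1*x≈-x; -‿distribʳ-*)
  open import Algebra.Properties.AbelianGroup +-abelianGroup using (⁻¹-∙-comm; ⁻¹-involutive)
  open import Algebra.Properties.CommutativeSemigroup +-commutativeSemigroup using (interchange)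
  open import Relation.Binary.Reasoning.Setoid setoid

  private
    -∈ : ∀ {x} → x ∈I → - x ∈I
    -∈ x∈ = resp (-1*x≈-x _) (*∈ (- 1#) x∈)

    ≈⇒∈ : ∀ {x y} → x ≈ y → x - y ∈I
    ≈⇒∈ {x} {y} x≈y = resp (sym (trans (+-congʳ x≈y) (-‿inverseʳ y))) 0∈

    swap : ∀ x y → - (x - y) ≈ y - x
    swap x y = begin
      - (x - y)     ≈⟨ ⁻¹-∙-comm x (- y) ⟨
      - x + - (- y) ≈⟨ +-congˡ (⁻¹-involutive y) ⟩
      - x + y       ≈⟨ +-comm _ _ ⟩
      y - x         ∎

    telescope : ∀ x y z → (x - y) + (y - z) ≈ x - z
    telescope x y z = begin
      (x - y) + (y - z)   ≈⟨ +-assoc _ _ _ ⟩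
      x + (- y + (y - z)) ≈⟨ +-congˡ (+-assoc _ _ _) ⟨
      x + ((- y + y) - z) ≈⟨ +-congˡ (+-congʳ (-‿inverseˡ y)) ⟩
      x + (0# - z)        ≈⟨ +-congˡ (+-identityˡ _) ⟩
      x - z               ∎

    trans∈ : ∀ {x y z} → x - y ∈I → y - z ∈I → x - z ∈I
    trans∈ p q = resp (telescope _ _ _) (+∈ p q)

    +-cong∈ : ∀ {x y u v} → x - y ∈I → u - v ∈I → (x + u) - (y + v) ∈I
    +-cong∈ {x} {y} {u} {v} p q =
      resp (trans (interchange _ _ _ _) (+-congˡ (⁻¹-∙-comm y v))) (+∈ p q)

    *-congˡ∈ : ∀ x {u v} → u - v ∈I → x * u - x * v ∈I
    *-congˡ∈ x {u} {v} q = resp (trans (distribˡ x u (- v)) (+-congˡ (sym (-‿distribʳ-* x v)))) (*∈ x q)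

    *-cong∈ : ∀ {x y u v} → x - y ∈I → u - v ∈I → x * u - y * v ∈I
    *-cong∈ {x} {y} {u} {v} p q = trans∈ (*-congˡ∈ x q)
      (trans∈ (≈⇒∈ (*-comm x v)) (trans∈ (*-congˡ∈ v p) (≈⇒∈ (*-comm v y))))

    -‿cong∈ : ∀ {x y} → x - y ∈I → - x - - y ∈I
    -‿cong∈ {x} {y} p = resp (sym (⁻¹-∙-comm x (- y))) (-∈ p)

  _/_ : CommutativeRing c (c ⊔ ℓ)
  _/_ = record
    { Carrier = Carrier
    ; _≈_ = λ x y → x - y ∈I
    ; _+_ = _+_ ; _*_ = _*_ ; -_ = -_ ; 0# = 0# ; 1# = 1#
    ; isCommutativeRing = record
      { isRing = record
        { +-isAbelianGroup = record
          { isGroup = record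
            { isMonoid = record
              { isSemigroup = record
                { isMagma = record
                  { isEquivalence = record
                    { refl  = ≈⇒∈ (CommutativeRing.refl R)
                    ; sym   = λ p → resp (swap _ _) (-∈ p)
                    ; trans = trans∈
                    }
                  ; ∙-cong = +-cong∈
                  }
                ; assoc = λ x y z → ≈⇒∈ (+-assoc x y z)
                }
              ; identity = (λ x → ≈⇒∈ (+-identityˡ x)) , (λ x → ≈⇒∈ (+-identityʳ x))
              }
            ; inverse = (λ x → ≈⇒∈ (-‿inverseˡ x)) , (λ x → ≈⇒∈ (-‿inverseʳ x))
            ; ⁻¹-cong = -‿cong∈
            }
          ; comm = λ x y → ≈⇒∈ (+-comm x y)
          }
        ; *-cong     = *-cong∈
        ; *-assoc    = λ x y z → ≈⇒∈ (*-assoc x y z)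
        ; *-identity = (λ x → ≈⇒∈ (*-identityˡ x)) , (λ x → ≈⇒∈ (*-identityʳ x))
        ; distrib    = (λ x y z → ≈⇒∈ (distribˡ x y z)) , (λ x y z → ≈⇒∈ (distribʳ x y z))
        }
      ; *-comm = λ x y → ≈⇒∈ (*-comm x y)
      }
    }

------------------------------------------------------------------------
-- The ring R[i] = R[x] / (x² + 1)

module AdjoinI (R : CommutativeRing c ℓ) where
  open CommutativeRing R

  infix 5 _+i_

  record Element : Set c where
    constructor _+i_
    field
      re im : Carrier

  open Element

  R[i] : CommutativeRing c ℓ
  R[i] = record
    { Carrier = Element
    ; _≈_ = λ z w → (re z ≈ re w) × (im z ≈ im w)
    ; _+_ = λ z w → re z + re w +i im z + im w
    ; _*_ = λ z w → re z * re w - im z * im w +i re z * im w + im z * re w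
    ; -_  = λ z → - re z +i - im z
    ; 0#  = 0# +i 0#
    ; 1#  = 1# +i 0#
    ; isCommutativeRing = record
      { isRing = record
        { +-isAbelianGroup = record
          { isGroup = record
            { isMonoid = record
              { isSemigroup = record
                { isMagma = record
                  { isEquivalence = record
                    { refl  = ≈-refl , ≈-refl
                    ; sym   = λ (p , q) → sym p , sym q
                    ; trans = λ (p , q) (p′ , q′) → trans p p′ , trans q q′
                    }
                  ; ∙-cong = λ (p , q) (p′ , q′) → +-cong p p′ , +-cong q q′
                  }
                ; assoc = λ z w v → +-assoc (re z) (re w) (re v) , +-assoc (im z) (im w) (im v)
                }
              ; identity = (λ z → +-identityˡ (re z) , +-identityˡ (im z))
                         , (λ z → +-identityʳ (re z) , +-identityʳ (im z))
              }
            ; inverse = (λ z → -‿inverseˡ (re z) , -‿inverseˡ (im z))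
                      , (λ z → -‿inverseʳ (re z) , -‿inverseʳ (im z))
            ; ⁻¹-cong = λ (p , q) → -‿cong p , -‿cong q
            }
          ; comm = λ z w → +-comm (re z) (re w) , +-comm (im z) (im w)
          }
        ; *-cong = λ (p , q) (p′ , q′) →
            +-cong (*-cong p p′) (-‿cong (*-cong q q′)) , +-cong (*-cong p q′) (*-cong q p′)
        ; *-assoc = λ z w v → *-assoc-re (re z) (im z) (re w) (im w) (re v) (im v)
                            , *-assoc-im (re z) (im z) (re w) (im w) (re v) (im v)
        ; *-identity = (λ z → *-identityˡ-re (re z) (im z) , *-identityˡ-im (re z) (im z))
                     , (λ z → *-identityʳ-re (re z) (im z) , *-identityʳ-im (re z) (im z))
        ; distrib = (λ z w v → distribˡ-re (re z) (im z) (re w) (im w) (re v) (im v)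
                             , distribˡ-im (re z) (im z) (re w) (im w) (re v) (im v))
                  , (λ z w v → distribʳ-re (re z) (im z) (re w) (im w) (re v) (im v)
                             , distribʳ-im (re z) (im z) (re w) (im w) (re v) (im v))
        }
      ; *-comm = λ z w → *-comm-re (re z) (im z) (re w) (im w) , *-comm-im (re z) (im z) (re w) (im w)
      }
    }
    where
    open SemiringSolver commutativeSemiring using (solve; _:=_; _:+_; _:*_)
    open RingProperties ring using (-1*x≈-x; -0#≈0#)
    ≈-refl : ∀ {x} → x ≈ x
    ≈-refl = CommutativeRing.refl R

    -- Treating n as a variable leaves only semiring identities to the solver.
    n : Carrier
    n = - 1#

    sub : ∀ x y → x - y ≈ x + n * y
    sub x y = +-congˡ (sym (-1*x≈-x y))

    *-assoc-re : ∀ a b c d e f →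
      (a * c - b * d) * e - (a * d + b * c) * f ≈ a * (c * e - d * f) - b * (c * f + d * e)
    *-assoc-re a b c d e f = trans (trans (sub _ _) (+-congʳ (*-congʳ (sub _ _))))
      (trans (solve 7 (λ a b c d e f n →
        ((((a :* c) :+ (n :* (b :* d))) :* e) :+ (n :* (((a :* d) :+ (b :* c)) :* f)))
        := ((a :* ((c :* e) :+ (n :* (d :* f)))) :+ (n :* (b :* ((c :* f) :+ (d :* e)))))) ≈-refl a b c d e f n)
      (sym (trans (sub _ _) (+-congʳ (*-congˡ (sub _ _))))))

    *-assoc-im : ∀ a b c d e f →
      (a * c - b * d) * f + (a * d + b * c) * e ≈ a * (c * f + d * e) + b * (c * e - d * f)
    *-assoc-im a b c d e f = trans (+-congʳ (*-congʳ (sub _ _)))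
      (trans (solve 7 (λ a b c d e f n →
        ((((a :* c) :+ (n :* (b :* d))) :* f) :+ (((a :* d) :+ (b :* c)) :* e))
        := ((a :* ((c :* f) :+ (d :* e))) :+ (b :* ((c :* e) :+ (n :* (d :* f)))))) ≈-refl a b c d e f n)
      (sym (+-congˡ (*-congˡ (sub _ _)))))

    minus0 : ∀ {x y} → y ≈ 0# → x - y ≈ x
    minus0 {x} y≈0 = trans (+-congˡ (trans (-‿cong y≈0) -0#≈0#)) (+-identityʳ x)

    *-identityˡ-re : ∀ a b → 1# * a - 0# * b ≈ a
    *-identityˡ-re a b = trans (minus0 (zeroˡ b)) (*-identityˡ a)

    *-identityˡ-im : ∀ a b → 1# * b + 0# * a ≈ b
    *-identityˡ-im a b = trans (+-cong (*-identityˡ b) (zeroˡ a)) (+-identityʳ b)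

    *-identityʳ-re : ∀ a b → a * 1# - b * 0# ≈ a
    *-identityʳ-re a b = trans (minus0 (zeroʳ b)) (*-identityʳ a)

    *-identityʳ-im : ∀ a b → a * 0# + b * 1# ≈ b
    *-identityʳ-im a b = trans (+-cong (zeroʳ a) (*-identityʳ b)) (+-identityˡ b)

    distribˡ-re : ∀ a b c d e f →
      a * (c + e) - b * (d + f) ≈ (a * c - b * d) + (a * e - b * f)
    distribˡ-re a b c d e f = trans (sub _ _)
      (trans (solve 7 (λ a b c d e f n →
        ((a :* (c :+ e)) :+ (n :* (b :* (d :+ f))))
        := (((a :* c) :+ (n :* (b :* d))) :+ ((a :* e) :+ (n :* (b :* f))))) ≈-refl a b c d e f n)
      (sym (+-cong (sub _ _) (sub _ _))))

    distribˡ-im : ∀ a b c d e f →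
      a * (d + f) + b * (c + e) ≈ (a * d + b * c) + (a * f + b * e)
    distribˡ-im = solve 6 (λ a b c d e f →
      ((a :* (d :+ f)) :+ (b :* (c :+ e)))
      := (((a :* d) :+ (b :* c)) :+ ((a :* f) :+ (b :* e)))) ≈-refl

    *-comm-re : ∀ a b c d → a * c - b * d ≈ c * a - d * b
    *-comm-re a b c d = +-cong (*-comm a c) (-‿cong (*-comm b d))

    *-comm-im : ∀ a b c d → a * d + b * c ≈ c * b + d * a
    *-comm-im a b c d = trans (+-comm _ _) (+-cong (*-comm b c) (*-comm a d))

    distribʳ-re : ∀ a b c d e f →
      (c + e) * a - (d + f) * b ≈ (c * a - d * b) + (e * a - f * b)
    distribʳ-re a b c d e f = trans (*-comm-re (c + e) (d + f) a b)
      (trans (distribˡ-re a b c d e f) (+-cong (*-comm-re a b c d) (*-comm-re a b e f)))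

    distribʳ-im : ∀ a b c d e f →
      (c + e) * b + (d + f) * a ≈ (c * b + d * a) + (e * b + f * a)
    distribʳ-im a b c d e f = solve 6 (λ a b c d e f →
      (((c :+ e) :* b) :+ ((d :+ f) :* a))
      := (((c :* b) :+ (d :* a)) :+ ((e :* b) :+ (f :* a)))) ≈-refl a b c d e f

------------------------------------------------------------------------
-- Real numbers, as Cauchy sequences of rationals

open +-*-Solver using (solve; _:+_; _:*_; _:-_; :-_; con; _:=_)

½+½ : ∀ p → p ℚ.* ½ ℚ.+ p ℚ.* ½ ≡ p
½+½ = solve 1 (λ p → p :* con ½ :+ p :* con ½ := p) refl

*-pos : ∀ {p q} → 0ℚ ℚ.< p → 0ℚ ℚ.< q → 0ℚ ℚ.< p ℚ.* q
*-pos {p} {q} 0<p 0<q = subst (ℚ._< p ℚ.* q) (ℚ.*-zeroˡ q)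
  (ℚ.*-monoˡ-<-pos q {{ℚ.positive 0<q}} 0<p)

half-pos : ∀ {p} → 0ℚ ℚ.< p → 0ℚ ℚ.< p ℚ.* ½
half-pos 0<p = *-pos 0<p (ℚ.positive⁻¹ ½)

*-mono-≤ : ∀ {p q r s} → 0ℚ ℚ.≤ r → 0ℚ ℚ.≤ q → p ℚ.≤ q → r ℚ.≤ s → p ℚ.* r ℚ.≤ q ℚ.* s
*-mono-≤ {q = q} {r} 0≤r 0≤q p≤q r≤s = ℚ.≤-trans
  (ℚ.*-monoʳ-≤-nonNeg r {{ℚ.nonNegative 0≤r}} p≤q)
  (ℚ.*-monoˡ-≤-nonNeg q {{ℚ.nonNegative 0≤q}} r≤s)

dist-triangle : ∀ x y z {ε δ} → ∣ x ℚ.- y ∣ ℚ.≤ ε → ∣ y ℚ.- z ∣ ℚ.≤ δ →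
                ∣ x ℚ.- z ∣ ℚ.≤ ε ℚ.+ δ
dist-triangle x y z p q = subst (λ t → ∣ t ∣ ℚ.≤ _)
  (solve 3 (λ x y z → (x :- y) :+ (y :- z) := x :- z) refl x y z)
  (ℚ.≤-trans (ℚ.∣p+q∣≤∣p∣+∣q∣ (x ℚ.- y) (y ℚ.- z)) (ℚ.+-mono-≤ p q))

dist-sym : ∀ x y → ∣ x ℚ.- y ∣ ≡ ∣ y ℚ.- x ∣
dist-sym x y = ≡.trans (≡.sym (ℚ.∣-p∣≡∣p∣ (x ℚ.- y)))
  (cong ∣_∣ (solve 2 (λ x y → :- (x :- y) := y :- x) refl x y))

dist-+ : ∀ x y u v {ε δ} → ∣ x ℚ.- y ∣ ℚ.≤ ε → ∣ u ℚ.- v ∣ ℚ.≤ δ →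
         ∣ (x ℚ.+ u) ℚ.- (y ℚ.+ v) ∣ ℚ.≤ ε ℚ.+ δ
dist-+ x y u v p q = subst (λ t → ∣ t ∣ ℚ.≤ _)
  (solve 4 (λ x y u v → (x :- y) :+ (u :- v) := (x :+ u) :- (y :+ v)) refl x y u v)
  (ℚ.≤-trans (ℚ.∣p+q∣≤∣p∣+∣q∣ (x ℚ.- y) (u ℚ.- v)) (ℚ.+-mono-≤ p q))

dist-neg : ∀ x y → ∣ ℚ.- x ℚ.- ℚ.- y ∣ ≡ ∣ x ℚ.- y ∣
dist-neg x y = ≡.trans
  (cong ∣_∣ (solve 2 (λ x y → :- x :- :- y := :- (x :- y)) refl x y)) (ℚ.∣-p∣≡∣p∣ (x ℚ.- y))

dist-* : ∀ x y u v {A B δ} → ∣ x ∣ ℚ.≤ A → ∣ v ∣ ℚ.≤ B → 0ℚ ℚ.≤ A → 0ℚ ℚ.≤ B →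
         ∣ x ℚ.- y ∣ ℚ.≤ δ → ∣ u ℚ.- v ∣ ℚ.≤ δ →
         ∣ x ℚ.* u ℚ.- y ℚ.* v ∣ ℚ.≤ A ℚ.* δ ℚ.+ B ℚ.* δ
dist-* x y u v {A} {B} {δ} x≤A v≤B 0≤A 0≤B p q = begin
  ∣ x ℚ.* u ℚ.- y ℚ.* v ∣                        ≡⟨ cong ∣_∣ split ⟩
  ∣ x ℚ.* (u ℚ.- v) ℚ.+ v ℚ.* (x ℚ.- y) ∣        ≤⟨ ℚ.∣p+q∣≤∣p∣+∣q∣ (x ℚ.* (u ℚ.- v)) (v ℚ.* (x ℚ.- y)) ⟩
  ∣ x ℚ.* (u ℚ.- v) ∣ ℚ.+ ∣ v ℚ.* (x ℚ.- y) ∣    ≡⟨ cong₂ ℚ._+_ (ℚ.∣p*q∣≡∣p∣*∣q∣ x _) (ℚ.∣p*q∣≡∣p∣*∣q∣ v _) ⟩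
  ∣ x ∣ ℚ.* ∣ u ℚ.- v ∣ ℚ.+ ∣ v ∣ ℚ.* ∣ x ℚ.- y ∣ ≤⟨ ℚ.+-mono-≤ (*-mono-≤ (ℚ.0≤∣p∣ (u ℚ.- v)) 0≤A x≤A q)
                                                                (*-mono-≤ (ℚ.0≤∣p∣ (x ℚ.- y)) 0≤B v≤B p) ⟩
  A ℚ.* δ ℚ.+ B ℚ.* δ                            ∎
  where
  open ℚ.≤-Reasoning
  split = solve 4 (λ x y u v → x :* u :- y :* v := x :* (u :- v) :+ v :* (x :- y)) refl x y u v

scale : ∀ A B {ε} → 0ℚ ℚ.≤ A → 0ℚ ℚ.< B → 0ℚ ℚ.< ε →
        ∃[ δ ] 0ℚ ℚ.< δ × A ℚ.* δ ℚ.+ B ℚ.* δ ≡ ε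
scale A B {ε} 0≤A 0<B 0<ε = r ℚ.* ε , *-pos (ℚ.positive⁻¹ r {{ℚ.1/pos⇒pos C}}) 0<ε , eq
  where
  C = A ℚ.+ B
  instance
    C-pos : ℚ.Positive C
    C-pos = ℚ.positive (subst (ℚ._< C) (ℚ.+-identityˡ 0ℚ) (ℚ.+-mono-≤-< 0≤A 0<B))
    C-nonZero : ℚ.NonZero C
    C-nonZero = ℚ.pos⇒nonZero C
  r = ℚ.1/ C
  eq : A ℚ.* (r ℚ.* ε) ℚ.+ B ℚ.* (r ℚ.* ε) ≡ ε
  eq = ≡.trans (solve 4 (λ A B r e → A :* (r :* e) :+ B :* (r :* e) := ((A :+ B) :* r) :* e) refl A B r ε)
    (≡.trans (cong (ℚ._* ε) (ℚ.*-inverseʳ C)) (ℚ.*-identityˡ ε))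

record Real : Set where
  constructor real
  field
    seq    : ℕ → ℚ
    cauchy : ∀ ε → 0ℚ ℚ.< ε → ∃[ N ] ∀ m n → N ℕ.≤ m → N ℕ.≤ n → ∣ seq m ℚ.- seq n ∣ ℚ.≤ ε

open Real

infix 4 _≃_

_≃_ : Real → Real → Set
x ≃ y = ∀ ε → 0ℚ ℚ.< ε → ∃[ N ] ∀ n → N ℕ.≤ n → ∣ seq x n ℚ.- seq y n ∣ ℚ.≤ ε

const : ℚ → Real
const q = real (λ _ → q) λ ε 0<ε → 0 , λ _ _ _ _ →
  ℚ.≤-trans (ℚ.≤-reflexive (cong ∣_∣ (ℚ.+-inverseʳ q))) (ℚ.<⇒≤ 0<ε)

eventuallyBounded : ∀ x → ∃[ B ] 0ℚ ℚ.< B × ∃[ N ] ∀ n → N ℕ.≤ n → ∣ seq x n ∣ ℚ.≤ B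
eventuallyBounded x = 1ℚ ℚ.+ ∣ seq x N ∣ ,
  subst (ℚ._< 1ℚ ℚ.+ ∣ seq x N ∣) (ℚ.+-identityˡ 0ℚ)
    (ℚ.+-mono-<-≤ (ℚ.positive⁻¹ 1ℚ) (ℚ.0≤∣p∣ (seq x N))) ,
  N , λ n N≤n → subst (λ t → ∣ t ∣ ℚ.≤ 1ℚ ℚ.+ ∣ seq x N ∣)
    (solve 2 (λ x y → (x :- y) :+ y := x) refl (seq x n) (seq x N))
    (ℚ.≤-trans (ℚ.∣p+q∣≤∣p∣+∣q∣ (seq x n ℚ.- seq x N) (seq x N))
      (ℚ.+-monoˡ-≤ ∣ seq x N ∣ (proj₂ tail n N N≤n ℕ.≤-refl)))
  where
  tail = cauchy x 1ℚ (ℚ.positive⁻¹ 1ℚ)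
  N = proj₁ tail

⊔₁ : ∀ {m n k} → m ℕ.⊔ n ℕ.≤ k → m ℕ.≤ k
⊔₁ {m} {n} = ℕ.m⊔n≤o⇒m≤o m n

⊔₂ : ∀ {m n k} → m ℕ.⊔ n ℕ.≤ k → n ℕ.≤ k
⊔₂ {m} {n} = ℕ.m⊔n≤o⇒n≤o m n

⊔₄ : ∀ k l m n {i} → (k ℕ.⊔ l) ℕ.⊔ (m ℕ.⊔ n) ℕ.≤ i → (k ℕ.≤ i × l ℕ.≤ i) × (m ℕ.≤ i × n ℕ.≤ i)
⊔₄ k l m n le = (⊔₁ le′ , ⊔₂ {k} le′) , (⊔₁ le″ , ⊔₂ {m} le″)
  where
  le′ = ⊔₁ {k ℕ.⊔ l} {m ℕ.⊔ n} le
  le″ = ⊔₂ {k ℕ.⊔ l} {m ℕ.⊔ n} le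

pointwise : ∀ {x y} → (∀ n → seq x n ≡ seq y n) → x ≃ y
pointwise {x} {y} eq ε 0<ε = 0 , λ n _ → ℚ.≤-trans
  (ℚ.≤-reflexive (cong ∣_∣ (≡.trans (cong (ℚ._- seq y n) (eq n)) (ℚ.+-inverseʳ (seq y n)))))
  (ℚ.<⇒≤ 0<ε)

≃-sym : ∀ {x y} → x ≃ y → y ≃ x
≃-sym {x} {y} p ε 0<ε with p ε 0<ε
... | N , h = N , λ n N≤n → subst (ℚ._≤ ε) (dist-sym (seq x n) (seq y n)) (h n N≤n)

≃-trans : ∀ {x y z} → x ≃ y → y ≃ z → x ≃ z
≃-trans {x} {y} {z} p q ε 0<ε with p (ε ℚ.* ½) (half-pos 0<ε) | q (ε ℚ.* ½) (half-pos 0<ε)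
... | M , f | N , g = M ℕ.⊔ N , λ n le → subst (∣ seq x n ℚ.- seq z n ∣ ℚ.≤_) (½+½ ε)
  (dist-triangle (seq x n) (seq y n) (seq z n) (f n (⊔₁ le)) (g n (⊔₂ le)))

infixl 6 _+ᵣ_
infixl 7 _*ᵣ_

_+ᵣ_ : Real → Real → Real
x +ᵣ y = real (λ n → seq x n ℚ.+ seq y n) λ ε 0<ε →
  let M , f = cauchy x (ε ℚ.* ½) (half-pos 0<ε)
      N , g = cauchy y (ε ℚ.* ½) (half-pos 0<ε)
  in M ℕ.⊔ N , λ m n le le′ → subst (_ ℚ.≤_) (½+½ ε)
    (dist-+ (seq x m) (seq x n) (seq y m) (seq y n) (f m n (⊔₁ le) (⊔₁ le′)) (g m n (⊔₂ le) (⊔₂ le′)))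

_*ᵣ_ : Real → Real → Real
x *ᵣ y = real (λ n → seq x n ℚ.* seq y n) λ ε 0<ε →
  let A , 0<A , K , a = eventuallyBounded x
      B , 0<B , L , b = eventuallyBounded y
      δ , 0<δ , eq    = scale A B (ℚ.<⇒≤ 0<A) 0<B 0<ε
      M , f = cauchy x δ 0<δ
      N , g = cauchy y δ 0<δ
  in (K ℕ.⊔ L) ℕ.⊔ (M ℕ.⊔ N) , λ m n le le′ →
    let (K≤m , L≤m) , (M≤m , N≤m) = ⊔₄ K L M N le
        (K≤n , L≤n) , (M≤n , N≤n) = ⊔₄ K L M N le′
    in subst (_ ℚ.≤_) eq
      (dist-* (seq x m) (seq x n) (seq y m) (seq y n)
        (a m K≤m) (b n L≤n) (ℚ.<⇒≤ 0<A) (ℚ.<⇒≤ 0<B) (f m n M≤m M≤n) (g m n N≤m N≤n))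

-ᵣ_ : Real → Real
-ᵣ x = real (λ n → ℚ.- seq x n) λ ε 0<ε →
  let N , f = cauchy x ε 0<ε
  in N , λ m n le le′ → subst (ℚ._≤ ε) (≡.sym (dist-neg (seq x m) (seq x n))) (f m n le le′)

+ᵣ-cong : ∀ {x y u v} → x ≃ y → u ≃ v → x +ᵣ u ≃ y +ᵣ v
+ᵣ-cong {x} {y} {u} {v} p q ε 0<ε with p (ε ℚ.* ½) (half-pos 0<ε) | q (ε ℚ.* ½) (half-pos 0<ε)
... | M , f | N , g = M ℕ.⊔ N , λ n le → subst (_ ℚ.≤_) (½+½ ε)
  (dist-+ (seq x n) (seq y n) (seq u n) (seq v n) (f n (⊔₁ le)) (g n (⊔₂ le)))

*ᵣ-cong : ∀ {x y u v} → x ≃ y → u ≃ v → x *ᵣ u ≃ y *ᵣ v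
*ᵣ-cong {x} {y} {u} {v} p q ε 0<ε =
  let A , 0<A , K , a = eventuallyBounded x
      B , 0<B , L , b = eventuallyBounded v
      δ , 0<δ , eq    = scale A B (ℚ.<⇒≤ 0<A) 0<B 0<ε
      M , f = p δ 0<δ
      N , g = q δ 0<δ
  in (K ℕ.⊔ L) ℕ.⊔ (M ℕ.⊔ N) , λ n le →
    let (K≤n , L≤n) , (M≤n , N≤n) = ⊔₄ K L M N le
    in subst (_ ℚ.≤_) eq
      (dist-* (seq x n) (seq y n) (seq u n) (seq v n)
        (a n K≤n) (b n L≤n) (ℚ.<⇒≤ 0<A) (ℚ.<⇒≤ 0<B) (f n M≤n) (g n N≤n))

-ᵣ-cong : ∀ {x y} → x ≃ y → -ᵣ x ≃ -ᵣ y
-ᵣ-cong {x} {y} p ε 0<ε with p ε 0<ε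
... | N , f = N , λ n le → subst (ℚ._≤ ε) (≡.sym (dist-neg (seq x n) (seq y n))) (f n le)

ℝ : CommutativeRing 0ℓ 0ℓ
ℝ = record
  { Carrier = Real
  ; _≈_ = _≃_
  ; _+_ = _+ᵣ_ ; _*_ = _*ᵣ_ ; -_ = -ᵣ_ ; 0# = const 0ℚ ; 1# = const 1ℚ
  ; isCommutativeRing = record
    { isRing = record
      { +-isAbelianGroup = record
        { isGroup = record
          { isMonoid = record
            { isSemigroup = record
              { isMagma = record
                { isEquivalence = record
                  { refl  = λ {x} → pointwise {x} {x} (λ _ → refl)
                  ; sym   = λ {x} {y} → ≃-sym {x} {y}
                  ; trans = λ {x} {y} {z} → ≃-trans {x} {y} {z}
                  }
                ; ∙-cong = λ {x} {y} {u} {v} → +ᵣ-cong {x} {y} {u} {v}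
                }
              ; assoc = λ x y z → pointwise {(x +ᵣ y) +ᵣ z} {x +ᵣ (y +ᵣ z)}
                  λ n → ℚ.+-assoc (seq x n) (seq y n) (seq z n)
              }
            ; identity = (λ x → pointwise {const 0ℚ +ᵣ x} {x} λ n → ℚ.+-identityˡ (seq x n))
                       , (λ x → pointwise {x +ᵣ const 0ℚ} {x} λ n → ℚ.+-identityʳ (seq x n))
            }
          ; inverse = (λ x → pointwise {(-ᵣ x) +ᵣ x} {const 0ℚ} λ n → ℚ.+-inverseˡ (seq x n))
                    , (λ x → pointwise {x +ᵣ (-ᵣ x)} {const 0ℚ} λ n → ℚ.+-inverseʳ (seq x n))
          ; ⁻¹-cong = λ {x} {y} → -ᵣ-cong {x} {y}
          }
        ; comm = λ x y → pointwise {x +ᵣ y} {y +ᵣ x} λ n → ℚ.+-comm (seq x n) (seq y n)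
        }
      ; *-cong  = λ {x} {y} {u} {v} → *ᵣ-cong {x} {y} {u} {v}
      ; *-assoc = λ x y z → pointwise {(x *ᵣ y) *ᵣ z} {x *ᵣ (y *ᵣ z)}
          λ n → ℚ.*-assoc (seq x n) (seq y n) (seq z n)
      ; *-identity = (λ x → pointwise {const 1ℚ *ᵣ x} {x} λ n → ℚ.*-identityˡ (seq x n))
                   , (λ x → pointwise {x *ᵣ const 1ℚ} {x} λ n → ℚ.*-identityʳ (seq x n))
      ; distrib = (λ x y z → pointwise {x *ᵣ (y +ᵣ z)} {(x *ᵣ y) +ᵣ (x *ᵣ z)}
                    λ n → ℚ.*-distribˡ-+ (seq x n) (seq y n) (seq z n))
                , (λ x y z → pointwise {(y +ᵣ z) *ᵣ x} {(y *ᵣ x) +ᵣ (z *ᵣ x)}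
                    λ n → ℚ.*-distribʳ-+ (seq x n) (seq y n) (seq z n))
      }
    ; *-comm = λ x y → pointwise {x *ᵣ y} {y *ᵣ x} λ n → ℚ.*-comm (seq x n) (seq y n)
    }
  }

ι : ℕ → ℚ → ℚ
ι zero    δ = 0ℚ
ι (suc k) δ = δ ℚ.+ ι k δ

ι-* : ∀ k δ → ι k δ ≡ ι k 1ℚ ℚ.* δ
ι-* zero    δ = ≡.sym (ℚ.*-zeroˡ δ)
ι-* (suc k) δ = ≡.trans (cong (δ ℚ.+_) (ι-* k δ))
  (solve 2 (λ δ t → δ :+ t :* δ := (con 1ℚ :+ t) :* δ) refl δ (ι k 1ℚ))

toℚᵘ-ι : ∀ k → ℚ.toℚᵘ (ι k 1ℚ) ℚᵘ.≃ ℚᵘ.mkℚᵘ (+ k) 0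
toℚᵘ-ι zero    = ℚᵘ.≃-refl
toℚᵘ-ι (suc k) = ℚᵘ.≃-trans (ℚ.toℚᵘ-homo-+ 1ℚ (ι k 1ℚ))
  (ℚᵘ.≃-trans (ℚᵘ.+-congʳ ℚᵘ.1ℚᵘ (toℚᵘ-ι k))
    (ℚᵘ.*≡* (cong (ℤ._* + 1) (cong (λ z → + 1 ℤ.+ z) (ℤ.*-identityʳ (+ k))))))

≤-ι1 : ∀ q → ∃[ k ] q ℚ.≤ ι k 1ℚ
≤-ι1 q@(mkℚ n d _) = ℤ.∣ n ∣ , ℚ.toℚᵘ-cancel-≤ (ℚᵘ.≤-respʳ-≃ (ℚᵘ.≃-sym (toℚᵘ-ι ℤ.∣ n ∣)) (ℚᵘ.*≤* (le n)))
  where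
  le : ∀ n → n ℤ.* + 1 ℤ.≤ + ℤ.∣ n ∣ ℤ.* + suc d
  le (+ m)        = subst (+ m ℤ.* + 1 ℤ.≤_) refl (ℤ.*-monoˡ-≤-nonNeg (+ m) (ℤ.+≤+ (ℕ.s≤s ℕ.z≤n)))
  le ℤ.-[1+ m ]   = ℤ.-≤+

archimedean : ∀ q {δ} → 0ℚ ℚ.< δ → ∃[ k ] q ℚ.≤ ι k δ
archimedean q {δ} 0<δ = k , subst₂ ℚ._≤_
  (≡.trans (ℚ.*-assoc q r δ) (≡.trans (cong (q ℚ.*_) (ℚ.*-inverseˡ δ)) (ℚ.*-identityʳ q)))
  (≡.sym (ι-* k δ))
  (ℚ.*-monoʳ-≤-nonNeg δ {{ℚ.pos⇒nonNeg δ}} (proj₂ (≤-ι1 (q ℚ.* r))))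
  where
  instance
    δ-pos : ℚ.Positive δ
    δ-pos = ℚ.positive 0<δ
    δ-nonZero : ℚ.NonZero δ
    δ-nonZero = ℚ.pos⇒nonZero δ
  r = ℚ.1/ δ
  k = proj₁ (≤-ι1 (q ℚ.* r))

record SqrtApprox (q δ : ℚ) : Set where
  field
    root     : ℚ
    0≤root   : 0ℚ ℚ.≤ root
    root²≤   : root ℚ.* root ℚ.≤ q
    <root+δ² : q ℚ.< (root ℚ.+ δ) ℚ.* (root ℚ.+ δ)

sqrtApprox : ∀ q δ → 0ℚ ℚ.≤ q → 0ℚ ℚ.< δ → SqrtApprox q δ
sqrtApprox q δ 0≤q 0<δ = climb (proj₁ arch) 0ℚ ℚ.≤-refl 0≤q enough
  where
  climb : ∀ k s → 0ℚ ℚ.≤ s → s ℚ.* s ℚ.≤ q →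
          q ℚ.< (s ℚ.+ ι k δ) ℚ.* (s ℚ.+ ι k δ) → SqrtApprox q δ
  climb zero    s 0≤s s²≤q q<s² = ⊥-elim (ℚ.<-irrefl refl (ℚ.<-≤-trans
    (subst (q ℚ.<_) (solve 1 (λ s → (s :+ con 0ℚ) :* (s :+ con 0ℚ) := s :* s) refl s) q<s²) s²≤q))
  climb (suc k) s 0≤s s²≤q q<t² with (s ℚ.+ δ) ℚ.* (s ℚ.+ δ) ℚ.≤? q
  ... | yes le = climb k (s ℚ.+ δ)
                   (subst (ℚ._≤ s ℚ.+ δ) (ℚ.+-identityˡ 0ℚ) (ℚ.+-mono-≤ 0≤s (ℚ.<⇒≤ 0<δ))) le
                   (subst (λ t → q ℚ.< t ℚ.* t) (≡.sym (ℚ.+-assoc s δ (ι k δ))) q<t²)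
  ... | no ¬le = record { root = s ; 0≤root = 0≤s ; root²≤ = s²≤q ; <root+δ² = ℚ.≰⇒> ¬le }
  arch = archimedean (1ℚ ℚ.+ q) 0<δ
  t = ι (proj₁ arch) δ
  1≤1+q : 1ℚ ℚ.≤ 1ℚ ℚ.+ q
  1≤1+q = subst (ℚ._≤ 1ℚ ℚ.+ q) (ℚ.+-identityʳ 1ℚ) (ℚ.+-monoʳ-≤ 1ℚ 0≤q)
  0≤1+q : 0ℚ ℚ.≤ 1ℚ ℚ.+ q
  0≤1+q = ℚ.≤-trans (ℚ.<⇒≤ (ℚ.positive⁻¹ 1ℚ)) 1≤1+q
  enough : q ℚ.< (0ℚ ℚ.+ t) ℚ.* (0ℚ ℚ.+ t)
  enough = begin-strict
    q                         ≡⟨ ℚ.+-identityˡ q ⟨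
    0ℚ ℚ.+ q                  <⟨ ℚ.+-monoˡ-< q (ℚ.positive⁻¹ 1ℚ) ⟩
    1ℚ ℚ.+ q                  ≡⟨ ℚ.*-identityˡ (1ℚ ℚ.+ q) ⟨
    1ℚ ℚ.* (1ℚ ℚ.+ q)         ≤⟨ *-mono-≤ 0≤1+q (ℚ.≤-trans 0≤1+q (proj₂ arch)) (ℚ.≤-trans 1≤1+q (proj₂ arch)) (proj₂ arch) ⟩
    t ℚ.* t                   ≡⟨ cong₂ ℚ._*_ (ℚ.+-identityˡ t) (ℚ.+-identityˡ t) ⟨
    (0ℚ ℚ.+ t) ℚ.* (0ℚ ℚ.+ t) ∎
    where open ℚ.≤-Reasoning

mesh : ℕ → ℚ
mesh n = + 1 ℚ./ suc n

mesh-pos : ∀ n → 0ℚ ℚ.< mesh n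
mesh-pos n = ℚ.positive⁻¹ (mesh n) {{ℚ.normalize-pos 1 (suc n)}}

mesh-small : ∀ ε → 0ℚ ℚ.< ε → ∃[ N ] ∀ n → N ℕ.≤ n → mesh n ℚ.≤ ε
mesh-small (mkℚ (+ zero) d _)     0<ε = ⊥-elim (case (ℚ.positive 0<ε) of λ ())
mesh-small (mkℚ ℤ.-[1+ a ] d _)   0<ε = ⊥-elim (case (ℚ.positive 0<ε) of λ ())
mesh-small ε@(mkℚ (+ suc a) d _)  0<ε = d , λ n d≤n →
  ℚ.toℚᵘ-cancel-≤ (ℚᵘ.≤-respˡ-≃ (ℚᵘ.≃-sym (ℚ.toℚᵘ-fromℚᵘ (ℚᵘ.mkℚᵘ (+ 1) n)))
    (ℚᵘ.*≤* (ℤ.+≤+ (ℕ.*-mono-≤ {1} {suc a} (ℕ.s≤s ℕ.z≤n) (ℕ.s≤s d≤n)))))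

p≤∣p∣ : ∀ p → p ℚ.≤ ∣ p ∣
p≤∣p∣ p with ℚ.≤-total 0ℚ p
... | inj₁ 0≤p = ℚ.≤-reflexive (≡.sym (ℚ.0≤p⇒∣p∣≡p 0≤p))
... | inj₂ p≤0 = ℚ.≤-trans p≤0 (ℚ.0≤∣p∣ p)

dist⇒≤ : ∀ x y {ε} → ∣ x ℚ.- y ∣ ℚ.≤ ε → x ℚ.≤ y ℚ.+ ε
dist⇒≤ x y {ε} le = subst (ℚ._≤ y ℚ.+ ε) (solve 2 (λ x y → y :+ (x :- y) := x) refl x y)
  (ℚ.+-monoʳ-≤ y (ℚ.≤-trans (p≤∣p∣ (x ℚ.- y)) le))

≤⇒dist : ∀ x y {ε} → x ℚ.≤ y ℚ.+ ε → y ℚ.≤ x ℚ.+ ε → ∣ x ℚ.- y ∣ ℚ.≤ ε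
≤⇒dist x y {ε} p q with ℚ.∣p∣≡p∨∣p∣≡-p (x ℚ.- y)
... | inj₁ eq = subst₂ ℚ._≤_ (≡.sym eq)
  (solve 2 (λ y e → (y :+ e) :- y := e) refl y ε) (ℚ.+-monoˡ-≤ (ℚ.- y) p)
... | inj₂ eq = subst₂ ℚ._≤_
  (≡.trans (solve 2 (λ x y → y :- x := :- (x :- y)) refl x y) (≡.sym eq))
  (solve 2 (λ x e → (x :+ e) :- x := e) refl x ε) (ℚ.+-monoˡ-≤ (ℚ.- x) q)

module _ {p q γ δ ε : ℚ} (P : SqrtApprox p γ) (Q : SqrtApprox q δ) where
  open SqrtApprox
  private
    h = ε ℚ.* ½

  root-mono : 0ℚ ℚ.< ε → 0ℚ ℚ.< δ → δ ℚ.≤ h → p ℚ.≤ q ℚ.+ h ℚ.* h → root P ℚ.≤ root Q ℚ.+ ε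
  root-mono 0<ε 0<δ δ≤h p≤ with root P ℚ.≤? root Q ℚ.+ ε
  ... | yes le = le
  ... | no ¬le = ⊥-elim (ℚ.<-irrefl refl (begin-strict
    p                       ≤⟨ p≤ ⟩
    q ℚ.+ h ℚ.* h           <⟨ ℚ.+-monoˡ-< (h ℚ.* h) (<root+δ² Q) ⟩
    s ℚ.* s ℚ.+ h ℚ.* h     ≤⟨ square-+ ⟩
    (s ℚ.+ h) ℚ.* (s ℚ.+ h) ≤⟨ *-mono-≤ 0≤s+h (0≤root P) s+h≤ s+h≤ ⟩
    root P ℚ.* root P       ≤⟨ root²≤ P ⟩
    p                       ∎))
    where
    open ℚ.≤-Reasoning
    s = root Q ℚ.+ δ
    0≤+ : ∀ {x y} → 0ℚ ℚ.≤ x → 0ℚ ℚ.≤ y → 0ℚ ℚ.≤ x ℚ.+ y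
    0≤+ {x} {y} 0≤x 0≤y = subst (ℚ._≤ x ℚ.+ y) (ℚ.+-identityˡ 0ℚ) (ℚ.+-mono-≤ 0≤x 0≤y)
    0≤h = ℚ.<⇒≤ (half-pos 0<ε)
    0≤s = 0≤+ (0≤root Q) (ℚ.<⇒≤ 0<δ)
    0≤s+h = 0≤+ 0≤s 0≤h
    s+h≤ : s ℚ.+ h ℚ.≤ root P
    s+h≤ = ℚ.≤-trans (ℚ.+-monoˡ-≤ h (ℚ.+-monoʳ-≤ (root Q) δ≤h))
      (ℚ.≤-trans (ℚ.≤-reflexive (≡.trans (ℚ.+-assoc (root Q) h h) (cong (root Q ℚ.+_) (½+½ ε))))
        (ℚ.<⇒≤ (ℚ.≰⇒> ¬le)))
    0≤sh : 0ℚ ℚ.≤ s ℚ.* h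
    0≤sh = subst (ℚ._≤ s ℚ.* h) (ℚ.*-zeroˡ 0ℚ) (*-mono-≤ ℚ.≤-refl 0≤s 0≤s 0≤h)
    square-+ : s ℚ.* s ℚ.+ h ℚ.* h ℚ.≤ (s ℚ.+ h) ℚ.* (s ℚ.+ h)
    square-+ = subst₂ ℚ._≤_ (ℚ.+-identityʳ _)
      (solve 2 (λ s h → (s :* s :+ h :* h) :+ (s :* h :+ s :* h) := (s :+ h) :* (s :+ h)) refl s h)
      (ℚ.+-monoʳ-≤ (s ℚ.* s ℚ.+ h ℚ.* h) (0≤+ 0≤sh 0≤sh))

sqrtTerm : (x : Real) (n : ℕ) → SqrtApprox (0ℚ ℚ.⊔ seq x n) (mesh n)
sqrtTerm x n = sqrtApprox (0ℚ ℚ.⊔ seq x n) (mesh n) (ℚ.p≤p⊔q 0ℚ (seq x n)) (mesh-pos n)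

⊔-close : ∀ x y {ε} → 0ℚ ℚ.≤ ε → ∣ x ℚ.- y ∣ ℚ.≤ ε → 0ℚ ℚ.⊔ x ℚ.≤ (0ℚ ℚ.⊔ y) ℚ.+ ε
⊔-close x y {ε} 0≤ε le = ℚ.⊔-lub
  (subst (ℚ._≤ (0ℚ ℚ.⊔ y) ℚ.+ ε) (ℚ.+-identityˡ 0ℚ) (ℚ.+-mono-≤ (ℚ.p≤p⊔q 0ℚ y) 0≤ε))
  (ℚ.≤-trans (dist⇒≤ x y le) (ℚ.+-monoˡ-≤ ε (ℚ.p≤q⊔p 0ℚ y)))

-- √ x is the square root of x where x ≥ 0, and 0 where x ≤ 0: its n-th term s is a
-- nonnegative rational with s² ≤ max 0 xₙ < (s + 1 / (1 + n))².
√ : Real → Real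
√ x = real (λ n → SqrtApprox.root (sqrtTerm x n)) λ ε 0<ε →
  let h       = ε ℚ.* ½
      0<h     = half-pos 0<ε
      0<h²    = *-pos 0<h 0<h
      M , f   = mesh-small h 0<h
      N , g   = cauchy x (h ℚ.* h) 0<h²
      bound m n M≤n le = root-mono {ε = ε} (sqrtTerm x m) (sqrtTerm x n) 0<ε (mesh-pos n) (f n M≤n)
        (⊔-close (seq x m) (seq x n) (ℚ.<⇒≤ 0<h²) le)
  in M ℕ.⊔ N , λ m n le le′ →
    let d = g m n (⊔₂ {M} le) (⊔₂ {M} le′) in
    ≤⇒dist (SqrtApprox.root (sqrtTerm x m)) (SqrtApprox.root (sqrtTerm x n))
      (bound m n (⊔₁ le′) d)
      (bound n m (⊔₁ le) (subst (ℚ._≤ h ℚ.* h) (dist-sym (seq x m) (seq x n)) d))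

------------------------------------------------------------------------
-- Complex numbers

open AdjoinI ℝ public using (_+i_) renaming (Element to Complex; R[i] to ℂ)

infixr 8 _^ᵣ_

_^ᵣ_ : Real → ℕ → Real
_^ᵣ_ = SemiringExp._^_ (CommutativeRing.semiring ℝ)

fromℕ : ℕ → Real
fromℕ n = const (+ n ℚ./ 1)

modulus : Complex → Real
modulus (x +i y) = √ (x *ᵣ x +ᵣ y *ᵣ y)

------------------------------------------------------------------------
-- Characters

ℂ* : AbelianGroup 0ℓ 0ℓ
ℂ* = unitGroup ℂ

record Character (G : Group a b) : Set (a ⊔ b) where
  open GroupMorphisms (Group.rawGroup G) (AbelianGroup.rawGroup ℂ*)
  field
    ⟦_⟧            : Group.Carrier G → Unit ℂ
    isHomomorphism : IsGroupHomomorphism ⟦_⟧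

  IsOne : Group.Carrier G → Set
  IsOne g = AbelianGroup._≈_ ℂ* ⟦ g ⟧ (AbelianGroup.ε ℂ*)

  value : Group.Carrier G → Complex
  value g = Unit.val ⟦ g ⟧

open Character

module _ (R : CommutativeRing c ℓ) where
  open CommutativeRing R

  AdditiveCharacter : Set (c ⊔ ℓ)
  AdditiveCharacter = Character +-group

  MultiplicativeCharacter : Set (c ⊔ ℓ)
  MultiplicativeCharacter = Character (AbelianGroup.group (unitGroup R))

  open Unit

  IsPrimitiveAdditive : AdditiveCharacter → Set (lsuc (c ⊔ ℓ))
  IsPrimitiveAdditive ψ = ∀ (I : Ideal R) → (∀ x → x ∈ I → IsOne ψ x) → I ≐ zeroIdeal R

  IsFrobenius : Set (lsuc (c ⊔ ℓ))
  IsFrobenius = Σ[ ψ ∈ AdditiveCharacter ] IsPrimitiveAdditive ψ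

  IsTrivial : MultiplicativeCharacter → Set (c ⊔ ℓ)
  IsTrivial τ = ∀ u → IsOne τ u

  TrivialOn1+ : MultiplicativeCharacter → Ideal R → Set (c ⊔ ℓ)
  TrivialOn1+ τ I = ∀ u x → x ∈ I → val u ≈ 1# + x → IsOne τ u

  record IsConductor (M : Ideal R) (τ : MultiplicativeCharacter) (I : Ideal R)
    : Set (lsuc (c ⊔ ℓ)) where
    field
      ifTrivial    : IsTrivial τ → I ≐ unitIdeal R
      ifNontrivial : ¬ IsTrivial τ →
        (I ⊆ M × TrivialOn1+ τ I) × (∀ J → J ⊆ M → TrivialOn1+ τ J → J ⊆ I)

  IsPrimitiveMultiplicative : Ideal R → MultiplicativeCharacter → Set (lsuc (c ⊔ ℓ))
  IsPrimitiveMultiplicative M τ = IsConductor M τ (zeroIdeal R)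

  Kloosterman : Finite setoid → AdditiveCharacter → MultiplicativeCharacter → Carrier → Complex
  Kloosterman finite ψ τ a = ∑ ℂ.+-commutativeMonoid (unitsFinite R finite)
    (λ u → value τ u ℂ.* value ψ (val u + a * inv u))
    where module ℂ = CommutativeRing ℂ

{-# OPTIONS --safe #-}
module Submission where

-- Let M be the maximal ideal and S its annihilator, so that |M| |S| = |R|. Every nonzero ideal contains S,
-- hence a non-primitive τ is trivial on 1 + S. The substitutions u ↦ (1 + s) u with s in S show that only
-- the terms with u² ≡ a mod M contribute to K(a). So K(a) vanishes unless a ≡ b² for some unit b, and then
-- K(a) = A(b) + A(-b), where A(b) collects the terms with u ≡ b. The correlation A(b) Ā(b) equals |R|,
-- while P = A(b) Ā(-b) is multiplied by ψ(2sb) when a is replaced by (1 + s) a; hence P and P² sum to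
-- zero over the a ≡ b², and |K(a)|⁴ = (2|R| + P + P̄)² is 6|R|² on average there. Summing over all
-- units b counts each such a exactly 2|M| times.

open import Defs
open import Algebra.Bundles using (AbelianGroup; CommutativeRing)
open import Algebra.Solver.Ring.AlmostCommutativeRing using (fromCommutativeRing; _-Raw-AlmostCommutative⟶_)
import Algebra.Morphism.Structures as Morphism
import Algebra.Properties.AbelianGroup as AbelianGroupProperties
import Algebra.Properties.Ring as RingProperties
import Algebra.Properties.Semiring.Mult as SemiringMult
import Algebra.Properties.Semiring.Mult.TCOptimised as OptimisedMult
import Algebra.Properties.Semiring.Sum as SemiringSum
import Algebra.Solver.Ring as RingSolver
open import Data.Empty using (⊥-elim)
open import Data.Fin using (Fin; zero; suc)
open import Data.Fin.Permutation using (Permutation; permutation)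
import Data.Fin.Properties as Fin
open import Data.Integer as ℤ using (ℤ; +_; -[1+_])
import Data.Integer.Properties as ℤ
open import Data.Maybe using (Maybe; just; nothing)
open import Data.Nat as ℕ using (ℕ; zero; suc)
import Data.Nat.Properties as ℕ
open import Data.Nat.Divisibility using (_∣_; _∣0; ∣-refl; ∣⇒≤)
open import Data.Product using (Σ-syntax; ∃; ∃-syntax; _×_; _,_; proj₁; proj₂)
open import Data.Rational as ℚ using (ℚ; 0ℚ; 1ℚ; ½; ∣_∣)
import Data.Rational.Properties as ℚ
import Data.Rational.Solver as ℚSolver
import Data.Rational.Unnormalised as ℚᵘ
import Data.Rational.Unnormalised.Properties as ℚᵘ
open import Data.Sum using (_⊎_; inj₁; inj₂)
open import Function using (_∘_; Inverse; Equivalence)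
open import Level using (Level; _⊔_; lift; lower)
open import Relation.Binary using (Setoid)
import Relation.Binary.Reasoning.Setoid as SetoidReasoning
open import Relation.Binary.PropositionalEquality as ≡ using (_≡_)
open import Relation.Nullary using (¬_; Dec; yes; no; contradiction)
open import Relation.Nullary.Decidable using (map′; ¬?; _×-dec_; decidable-stable)
open import Relation.Unary using (Decidable; Pred)

-- The obstacle is constructive: equality of reals is only stable under double negation, and
-- non-primitivity is a negated statement that yields no ideal. So vanishing results are derived by
-- contradiction with the primitivity of ψ, and |M|, |S|, |R| are elements of the value ring, where
-- a nonzero count is cancelled rather than divided by. That every nonzero ideal contains S, and
-- that |M| |S| = |R|, both come from evaluating a double character sum in two orders. The conjugate
-- of K is the Kloosterman sum of the inverse characters, because characters of finite groups have
-- modulus one; |K|⁴ thus becomes the polynomial expression (K K̄)². The product A(b) Ā(b) is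
-- collected by the ratio w ≡ 1 mod M of the two summation variables. Ratios with w - 1 outside S
-- contribute nothing, while each w in 1 + S contributes |M|, which makes |M| |S| = |R| in all. The
-- 6 arises as 4 + 2: besides the square of 2|R|, the product P P̄ = |R|² occurs twice.

private
  variable
    a b c d e ℓ ℓ₁ : Level

-- Polynomial identities with integer coefficients in a commutative ring.

module IntegerSolver {c ℓ} (R : CommutativeRing c ℓ) where
  open CommutativeRing R
  open RingProperties ring using (-0#≈0#; -‿distribˡ-*; -‿distribʳ-*)
  open AbelianGroupProperties +-abelianGroup using (⁻¹-∙-comm; ⁻¹-involutive)
  open OptimisedMult semiring using (1+×; ×-homo-+; ×1-homo-*) renaming (_×_ to _·_)
  open SetoidReasoning setoid

  private
    -- With the optimised multiple, `+ 0`, `+ 1` and `+ 2` compute to `0#`, `1#` and `1# + 1#`, so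
    -- constants in solver expressions match those in the goals by conversion.
    ⟦_⟧ : ℤ → Carrier
    ⟦ + n ⟧      = n · 1#
    ⟦ -[1+ n ] ⟧ = - (suc n · 1#)

    -‿homo : ∀ i → ⟦ ℤ.- i ⟧ ≈ - ⟦ i ⟧
    -‿homo (+ zero)   = sym -0#≈0#
    -‿homo (+ suc n)  = refl
    -‿homo -[1+ n ]   = sym (⁻¹-involutive _)

    cancel : ∀ x y z → y - z ≈ (x + y) - (x + z)
    cancel x y z = begin
      y - z                     ≈⟨ +-congʳ (+-identityˡ y) ⟨
      (0# + y) - z              ≈⟨ +-congʳ (+-congʳ (-‿inverseˡ x)) ⟨
      ((- x + x) + y) - z       ≈⟨ +-congʳ (+-assoc _ _ _) ⟩
      (- x + (x + y)) - z       ≈⟨ +-congʳ (+-comm _ _) ⟩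
      ((x + y) + - x) - z       ≈⟨ +-assoc _ _ _ ⟩
      (x + y) + (- x - z)       ≈⟨ +-congˡ (⁻¹-∙-comm x z) ⟩
      (x + y) - (x + z)         ∎

    ⊖-homo : ∀ m n → ⟦ m ℤ.⊖ n ⟧ ≈ m · 1# - n · 1#
    ⊖-homo zero    zero    = sym (-‿inverseʳ 0#)
    ⊖-homo zero    (suc n) = sym (+-identityˡ _)
    ⊖-homo (suc m) zero    = sym (trans (+-congˡ -0#≈0#) (+-identityʳ _))
    ⊖-homo (suc m) (suc n) = begin
      ⟦ suc m ℤ.⊖ suc n ⟧           ≡⟨ ≡.cong ⟦_⟧ (ℤ.[1+m]⊖[1+n]≡m⊖n m n) ⟩
      ⟦ m ℤ.⊖ n ⟧                   ≈⟨ ⊖-homo m n ⟩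
      m · 1# - n · 1#               ≈⟨ cancel 1# _ _ ⟩
      (1# + m · 1#) - (1# + n · 1#) ≈⟨ +-cong (1+× m 1#) (-‿cong (1+× n 1#)) ⟨
      suc m · 1# - suc n · 1#       ∎

    +-homo : ∀ i j → ⟦ i ℤ.+ j ⟧ ≈ ⟦ i ⟧ + ⟦ j ⟧
    +-homo (+ m)    (+ n)    = ×-homo-+ 1# m n
    +-homo (+ m)    -[1+ n ] = ⊖-homo m (suc n)
    +-homo -[1+ m ] (+ n)    = trans (⊖-homo n (suc m)) (+-comm _ _)
    +-homo -[1+ m ] -[1+ n ] = begin
      - (suc (suc (m ℕ.+ n)) · 1#)        ≡⟨ ≡.cong (λ k → - (k · 1#)) (ℕ.+-suc (suc m) n) ⟨
      - ((suc m ℕ.+ suc n) · 1#)          ≈⟨ -‿cong (×-homo-+ 1# (suc m) (suc n)) ⟩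
      - (suc m · 1# + suc n · 1#)         ≈⟨ ⁻¹-∙-comm _ _ ⟨
      - (suc m · 1#) - suc n · 1#         ∎

    *-homo : ∀ i j → ⟦ i ℤ.* j ⟧ ≈ ⟦ i ⟧ * ⟦ j ⟧
    *-homo (+ m) (+ n) = begin
      ⟦ + m ℤ.* + n ⟧       ≡⟨ ≡.cong ⟦_⟧ (ℤ.+◃n≡+n (m ℕ.* n)) ⟩
      (m ℕ.* n) · 1#        ≈⟨ ×1-homo-* m n ⟩
      m · 1# * n · 1#       ∎
    *-homo (+ m) -[1+ n ] = begin
      ⟦ + m ℤ.* -[1+ n ] ⟧        ≡⟨ ≡.cong ⟦_⟧ (ℤ.-◃n≡-n (m ℕ.* suc n)) ⟩
      ⟦ ℤ.- + (m ℕ.* suc n) ⟧     ≈⟨ -‿homo (+ (m ℕ.* suc n)) ⟩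
      - ((m ℕ.* suc n) · 1#)      ≈⟨ -‿cong (×1-homo-* m (suc n)) ⟩
      - (m · 1# * suc n · 1#)     ≈⟨ -‿distribʳ-* _ _ ⟩
      m · 1# * - (suc n · 1#)     ∎
    *-homo -[1+ m ] (+ n) = begin
      ⟦ -[1+ m ] ℤ.* + n ⟧        ≡⟨ ≡.cong ⟦_⟧ (ℤ.-◃n≡-n (suc m ℕ.* n)) ⟩
      ⟦ ℤ.- + (suc m ℕ.* n) ⟧     ≈⟨ -‿homo (+ (suc m ℕ.* n)) ⟩
      - ((suc m ℕ.* n) · 1#)      ≈⟨ -‿cong (×1-homo-* (suc m) n) ⟩
      - (suc m · 1# * n · 1#)     ≈⟨ -‿distribˡ-* _ _ ⟩
      - (suc m · 1#) * n · 1#     ∎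
    *-homo -[1+ m ] -[1+ n ] = begin
      ⟦ -[1+ m ] ℤ.* -[1+ n ] ⟧         ≡⟨ ≡.cong ⟦_⟧ (ℤ.+◃n≡+n (suc m ℕ.* suc n)) ⟩
      (suc m ℕ.* suc n) · 1#            ≈⟨ ×1-homo-* (suc m) (suc n) ⟩
      suc m · 1# * suc n · 1#           ≈⟨ ⁻¹-involutive _ ⟨
      - - (suc m · 1# * suc n · 1#)     ≈⟨ -‿cong (-‿distribʳ-* _ _) ⟩
      - (suc m · 1# * - (suc n · 1#))   ≈⟨ -‿distribˡ-* _ _ ⟩
      - (suc m · 1#) * - (suc n · 1#)   ∎

    morphism : ℤ.+-*-rawRing -Raw-AlmostCommutative⟶ fromCommutativeRing R
    morphism = record
      { ⟦_⟧ = ⟦_⟧ ; +-homo = +-homo ; *-homo = *-homo ; -‿homo = -‿homo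
      ; 0-homo = refl ; 1-homo = refl }

    _≟′_ : ∀ i j → Maybe (⟦ i ⟧ ≈ ⟦ j ⟧)
    i ≟′ j with i ℤ.≟ j
    ... | yes i≡j = just (reflexive (≡.cong ⟦_⟧ i≡j))
    ... | no  _   = nothing

  open RingSolver ℤ.+-*-rawRing (fromCommutativeRing R) morphism _≟′_ public
    using (solve; _:=_; _:+_; _:*_; _:-_; :-_; con)

-- Finite setoids and sums over them.

module FiniteSetoid {S : Setoid a ℓ} (F : Finite S) where
  open Setoid S
  private module E = Inverse (proj₂ F)

  to∘from : ∀ x → E.to (E.from x) ≈ x
  to∘from x = E.inverseˡ ≡.refl

  infix 4 _≟_
  _≟_ : ∀ x y → Dec (x ≈ y)
  x ≟ y = map′ (λ eq → trans (sym (to∘from x)) (trans (E.to-cong eq) (to∘from y)))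
               E.from-cong (E.from x Fin.≟ E.from y)

  any? : {P : Pred Carrier ℓ₁} → (∀ {x y} → x ≈ y → P x → P y) → Decidable P → Dec (∃ P)
  any? resp P? = map′ (λ (i , p) → E.to i , p) (λ (x , p) → E.from x , resp (sym (to∘from x)) p)
                      (Fin.any? (λ i → P? (E.to i)))

module Sums (C : CommutativeRing b c) where
  open CommutativeRing C hiding (zero)
  open SemiringSum semiring
    using (sum; sum-cong-≋; sum-replicate; ∑-distrib-+; ∑-comm; *-distribˡ-sum; sum-permute)
  open SemiringMult semiring using () renaming (_×_ to _·_)

  infix 10 Σ⟨_⟩_
  opaque
    -- Opaque, so that a sum does not unfold to its enumeration outside the lemmas that ask for it;
    -- `Σ≡∑` leads back to `∑`.
    Σ⟨_⟩_ : {S : Setoid a ℓ} → Finite S → (Setoid.Carrier S → Carrier) → Carrier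
    Σ⟨ F ⟩ f = ∑ +-commutativeMonoid F f

  -- Sums over nonunits, the socle or a residue class are taken over the whole finite setoid with
  -- this weight, so such subsets need no enumeration of their own.
  𝟙 : {P : Set a} → Dec P → Carrier
  𝟙 (yes _) = 1#
  𝟙 (no  _) = 0#

  𝟙-yes : {P : Set a} (p? : Dec P) → P → 𝟙 p? ≈ 1#
  𝟙-yes (yes _) p = refl
  𝟙-yes (no ¬p) p = contradiction p ¬p

  𝟙-no : {P : Set a} (p? : Dec P) → ¬ P → 𝟙 p? ≈ 0#
  𝟙-no (yes p) ¬p = contradiction p ¬p
  𝟙-no (no _)  ¬p = refl

  𝟙-cong : {P : Set a} {Q : Set d} (p? : Dec P) (q? : Dec Q) → (P → Q) → (Q → P) → 𝟙 p? ≈ 𝟙 q?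
  𝟙-cong (yes p) q? f g = sym (𝟙-yes q? (f p))
  𝟙-cong (no ¬p) q? f g = sym (𝟙-no q? (¬p ∘ g))

  𝟙-⊎ : {P : Set a} {Q : Set d} {T : Set e} (p? : Dec P) (q? : Dec Q) (t? : Dec T) →
        (T → P ⊎ Q) → (P → T) → (Q → T) → (P → ¬ Q) → 𝟙 t? ≈ 𝟙 p? + 𝟙 q?
  𝟙-⊎ p? q? (yes t) split p⇒t q⇒t disjoint with split t
  ... | inj₁ p = sym (trans (+-cong (𝟙-yes p? p) (𝟙-no q? (disjoint p))) (+-identityʳ 1#))
  ... | inj₂ q = sym (trans (+-cong (𝟙-no p? (λ p → disjoint p q)) (𝟙-yes q? q)) (+-identityˡ 1#))
  𝟙-⊎ p? q? (no ¬t) split p⇒t q⇒t disjoint =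
    sym (trans (+-cong (𝟙-no p? (¬t ∘ p⇒t)) (𝟙-no q? (¬t ∘ q⇒t))) (+-identityˡ 0#))

  -- A zero weight hides the value, so inside a weighted sum a term may be rewritten under the
  -- assumption `P`.
  𝟙*-cong : {P : Set a} (p? : Dec P) {x y : Carrier} → (P → x ≈ y) → 𝟙 p? * x ≈ 𝟙 p? * y
  𝟙*-cong (yes p) x≈y = *-congˡ (x≈y p)
  𝟙*-cong (no _)  x≈y = trans (zeroˡ _) (sym (zeroˡ _))

  private
    sum-zero : ∀ {n} {f : Fin n → Carrier} → (∀ i → f i ≈ 0#) → sum f ≈ 0#
    sum-zero {zero}  f≈0 = refl
    sum-zero {suc n} f≈0 = trans (+-cong (f≈0 zero) (sum-zero (f≈0 ∘ suc))) (+-identityˡ 0#)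

    sum-point : ∀ {n} (f : Fin n → Carrier) i → (∀ j → ¬ (j ≡ i) → f j ≈ 0#) → sum f ≈ f i
    sum-point f zero    f≈0 = trans (+-congˡ (sum-zero λ j → f≈0 (suc j) λ ())) (+-identityʳ _)
    sum-point f (suc i) f≈0 = trans
      (+-cong (f≈0 zero λ ()) (sum-point (f ∘ suc) i λ j j≢i → f≈0 (suc j) (j≢i ∘ Fin.suc-injective)))
      (+-identityˡ _)

    -- The count is returned as a natural number, positive as soon as there is a witness; in
    -- characteristic zero this keeps the sum from vanishing.
    sum-𝟙 : ∀ {n} {P : Pred (Fin n) a} (P? : Decidable P) →
            ∃[ k ] (sum (𝟙 ∘ P?) ≈ k · 1# × (∀ i → P i → ∃[ m ] k ≡ suc m))
    sum-𝟙 {n = zero}  P? = 0 , refl , λ ()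
    sum-𝟙 {n = suc n} P? with P? zero | sum-𝟙 (P? ∘ suc)
    ... | yes p | k , eq , _   = suc k , +-congˡ eq , λ _ _ → k , ≡.refl
    ... | no ¬p | k , eq , pos = k , trans (+-identityˡ _) eq ,
      λ { zero p → contradiction p ¬p ; (suc i) p → pos i p }

  module _ {S : Setoid a ℓ} (F : Finite S) where
    private
      module S = Setoid S
      module E = Inverse (proj₂ F)
    open FiniteSetoid F

    opaque
      unfolding Σ⟨_⟩_

      Σ≡∑ : ∀ f → Σ⟨ F ⟩ f ≡ ∑ +-commutativeMonoid F f
      Σ≡∑ f = ≡.refl

      Σ-cong : ∀ {f g} → (∀ x → f x ≈ g x) → Σ⟨ F ⟩ f ≈ Σ⟨ F ⟩ g
      Σ-cong f≈g = sum-cong-≋ (λ i → f≈g (E.to i))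

      Σ-zero : ∀ {f} → (∀ x → f x ≈ 0#) → Σ⟨ F ⟩ f ≈ 0#
      Σ-zero f≈0 = sum-zero (λ i → f≈0 (E.to i))

      Σ-+ : ∀ f g → Σ⟨ F ⟩ (λ x → f x + g x) ≈ Σ⟨ F ⟩ f + Σ⟨ F ⟩ g
      Σ-+ f g = ∑-distrib-+ (f ∘ E.to) (g ∘ E.to)

      Σ-*ˡ : ∀ k f → Σ⟨ F ⟩ (λ x → k * f x) ≈ k * Σ⟨ F ⟩ f
      Σ-*ˡ k f = sym (*-distribˡ-sum k (f ∘ E.to))

      Σ-*ʳ : ∀ k f → Σ⟨ F ⟩ (λ x → f x * k) ≈ Σ⟨ F ⟩ f * k
      Σ-*ʳ k f = trans (Σ-cong (λ x → *-comm (f x) k)) (trans (Σ-*ˡ k f) (*-comm k _))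

      Σ-const : ∀ k → Σ⟨ F ⟩ (λ _ → k) ≈ card F · k
      Σ-const k = sum-replicate (card F)

      Σ-point : ∀ {f : S.Carrier → Carrier} → (∀ {x y} → x S.≈ y → f x ≈ f y) → ∀ z →
                (∀ x → ¬ (x S.≈ z) → f x ≈ 0#) → Σ⟨ F ⟩ f ≈ f z
      Σ-point {f} f-cong z f≈0 = trans
        (sum-point (f ∘ E.to) (E.from z) (λ j j≢ → f≈0 (E.to j) (λ eq → j≢ (≡.sym (E.inverseʳ (S.sym eq))))))
        (f-cong (to∘from z))

      Σ-reindex : ∀ (f : S.Carrier → Carrier) → (∀ {x y} → x S.≈ y → f x ≈ f y) → ∀ (φ χ : S.Carrier → S.Carrier) →
                  (∀ {x y} → x S.≈ y → φ x S.≈ φ y) → (∀ {x y} → x S.≈ y → χ x S.≈ χ y) →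
                  (∀ x → φ (χ x) S.≈ x) → (∀ x → χ (φ x) S.≈ x) →
                  Σ⟨ F ⟩ f ≈ Σ⟨ F ⟩ (f ∘ φ)
      Σ-reindex f f-cong φ χ φ-cong χ-cong φχ χφ =
        trans (sum-permute (f ∘ E.to) π) (sum-cong-≋ (λ i → f-cong (to∘from (φ (E.to i)))))
        where
        lift-inverse : ∀ {φ χ : S.Carrier → S.Carrier} → (∀ {x y} → x S.≈ y → φ x S.≈ φ y) → (∀ x → φ (χ x) S.≈ x) →
                       ∀ i → E.from (φ (E.to (E.from (χ (E.to i))))) ≡ i
        lift-inverse φ-cong φχ i = E.inverseʳ (S.trans (φ-cong (to∘from _)) (φχ (E.to i)))
        π : Permutation (card F) (card F)
        π = permutation (λ i → E.from (φ (E.to i))) (λ i → E.from (χ (E.to i)))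
              (lift-inverse {φ} {χ} φ-cong φχ) (lift-inverse {χ} {φ} χ-cong χφ)

      Σ-𝟙-pos : {P : Pred S.Carrier d} (P? : Decidable P) → (∀ {x y} → x S.≈ y → P x → P y) →
                ∃ P → ∃[ k ] Σ⟨ F ⟩ (𝟙 ∘ P?) ≈ suc k · 1#
      Σ-𝟙-pos P? resp (x , p) with sum-𝟙 (λ i → P? (E.to i))
      ... | k , eq , pos with pos (E.from x) (resp (S.sym (to∘from x)) p)
      ...   | m , ≡.refl = m , eq

  opaque
    unfolding Σ⟨_⟩_

    Σ-swap : {S : Setoid a ℓ} {T : Setoid d ℓ₁} (F : Finite S) (G : Finite T) → ∀ (f : Setoid.Carrier S → Setoid.Carrier T → Carrier) →
             Σ⟨ F ⟩ (λ x → Σ⟨ G ⟩ (λ y → f x y)) ≈ Σ⟨ G ⟩ (λ y → Σ⟨ F ⟩ (λ x → f x y))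
    Σ-swap F G f = ∑-comm {card F} {card G} (λ i j → f (Inverse.to (proj₂ F) i) (Inverse.to (proj₂ G) j))

  module _ (G : AbelianGroup a ℓ) (F : Finite (AbelianGroup.setoid G)) where
    private module G = AbelianGroup G

    Σ-translate : ∀ (f : G.Carrier → Carrier) → (∀ {x y} → x G.≈ y → f x ≈ f y) → ∀ g →
                  Σ⟨ F ⟩ f ≈ Σ⟨ F ⟩ (λ x → f (g G.∙ x))
    Σ-translate f f-cong g = Σ-reindex F f f-cong (g G.∙_) (g G.⁻¹ G.∙_) G.∙-congˡ G.∙-congˡ
      (λ x → G.trans (G.sym (G.assoc g (g G.⁻¹) x)) (G.trans (G.∙-congʳ (G.inverseʳ g)) (G.identityˡ x)))
      (λ x → G.trans (G.sym (G.assoc (g G.⁻¹) g x)) (G.trans (G.∙-congʳ (G.inverseˡ g)) (G.identityˡ x)))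

-- Units, nonunits and the socle of a finite ring.

module FiniteRing {c ℓ} (R : CommutativeRing c ℓ) (F : Finite (CommutativeRing.setoid R)) where
  open CommutativeRing R hiding (zero)
  open RingProperties ring using (-1*x≈-x)
  open FiniteSetoid F using (_≟_; any?)
  private module RS = IntegerSolver R

  IsUnit : Pred Carrier (c ⊔ ℓ)
  IsUnit x = ∃[ y ] x * y ≈ 1#

  isUnit? : Decidable IsUnit
  isUnit? x = any? (λ y≈z xy≈1 → trans (*-congˡ (sym y≈z)) xy≈1) (λ y → (x * y) ≟ 1#)

  NonUnit : Pred Carrier (c ⊔ ℓ)
  NonUnit x = ¬ IsUnit x

  nonUnit? : Decidable NonUnit
  nonUnit? x = ¬? (isUnit? x)

  ¬nonUnit⇒unit : ∀ {x} → ¬ NonUnit x → IsUnit x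
  ¬nonUnit⇒unit {x} = decidable-stable (isUnit? x)

  IsUnit-resp : ∀ {x y} → x ≈ y → IsUnit x → IsUnit y
  IsUnit-resp x≈y (z , eq) = z , trans (*-congʳ (sym x≈y)) eq

  NonUnit-resp : ∀ {x y} → x ≈ y → NonUnit x → NonUnit y
  NonUnit-resp x≈y nx uy = nx (IsUnit-resp (sym x≈y) uy)

  NonUnit-*ˡ : ∀ {x} r → NonUnit x → NonUnit (r * x)
  NonUnit-*ˡ {x} r nx (y , eq) =
    nx (r * y , trans (RS.solve 3 (λ x r y → x RS.:* (r RS.:* y) RS.:= (r RS.:* x) RS.:* y) refl x r y) eq)

  NonUnit-*ʳ : ∀ {x} r → NonUnit x → NonUnit (x * r)
  NonUnit-*ʳ r nx = NonUnit-resp (*-comm r _) (NonUnit-*ˡ r nx)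

  NonUnit-neg : ∀ {x} → NonUnit x → NonUnit (- x)
  NonUnit-neg nx = NonUnit-resp (-1*x≈-x _) (NonUnit-*ˡ (- 1#) nx)

  val-unit : ∀ (u : Unit R) → IsUnit (Unit.val u)
  val-unit u = Unit.inv u , Unit.val*inv u

  IsUnit-* : ∀ {x y} → IsUnit x → IsUnit y → IsUnit (x * y)
  IsUnit-* {x} {y} (x′ , p) (y′ , q) = x′ * y′ ,
    trans (RS.solve 4 (λ x y x′ y′ → (x RS.:* y) RS.:* (x′ RS.:* y′) RS.:= (x RS.:* x′) RS.:* (y RS.:* y′)) refl x y x′ y′)
      (trans (*-cong p q) (*-identityˡ 1#))

  IsUnit-neg : ∀ {x} → IsUnit x → IsUnit (- x)
  IsUnit-neg {x} (y , eq) = - y , trans (RS.solve 2 (λ x y → RS.:- x RS.:* RS.:- y RS.:= x RS.:* y) refl x y) eq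

  NonUnit-cancelˡ : ∀ {x y} → IsUnit x → NonUnit (x * y) → NonUnit y
  NonUnit-cancelˡ ux nxy uy = nxy (IsUnit-* ux uy)

  -- The annihilator S of the maximal ideal, phrased with nonunits so that finite search decides it.
  Socle : Pred Carrier (c ⊔ ℓ)
  Socle x = ∀ y → NonUnit y → x * y ≈ 0#

  -- The negative case carries a nonzero product: it provides the nonzero ideal to which primitivity
  -- is applied.
  socle? : ∀ x → Socle x ⊎ (∃[ y ] NonUnit y × ¬ (x * y ≈ 0#))
  socle? x with any? {P = λ y → NonUnit y × ¬ (x * y ≈ 0#)}
                  (λ y≈z (ny , xy≉0) → NonUnit-resp y≈z ny , λ xz≈0 → xy≉0 (trans (*-congˡ y≈z) xz≈0))
                  (λ y → nonUnit? y ×-dec ¬? ((x * y) ≟ 0#))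
  ... | yes w = inj₂ w
  ... | no ¬w = inj₁ λ y ny → decidable-stable ((x * y) ≟ 0#) (λ xy≉0 → ¬w (y , ny , xy≉0))

  inSocle? : Decidable Socle
  inSocle? x with socle? x
  ... | inj₁ s                = yes s
  ... | inj₂ (y , ny , xy≉0)  = no λ s → xy≉0 (s y ny)

  Socle-resp : ∀ {x y} → x ≈ y → Socle x → Socle y
  Socle-resp x≈y s z nz = trans (*-congʳ (sym x≈y)) (s z nz)

  socle : Ideal R
  socle = record
    { _∈I  = Socle
    ; resp = Socle-resp
    ; 0∈   = λ y _ → zeroˡ y
    ; +∈   = λ {x} {y} sx sy z nz → trans (distribʳ z x y) (trans (+-cong (sx z nz) (sy z nz)) (+-identityˡ 0#))
    ; *∈   = λ r {x} sx z nz → trans (*-assoc r x z) (trans (*-congˡ (sx z nz)) (zeroʳ r))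
    }

  multiples : Carrier → Ideal R
  multiples r = record
    { _∈I  = λ x → ∃[ y ] x ≈ r * y
    ; resp = λ x≈y (z , eq) → z , trans (sym x≈y) eq
    ; 0∈   = 0# , sym (zeroʳ r)
    ; +∈   = λ (z , p) (w , q) → z + w , trans (+-cong p q) (sym (distribˡ r z w))
    ; *∈   = λ s (z , p) → s * z , trans (*-congˡ p)
               (RS.solve 3 (λ s r z → s RS.:* (r RS.:* z) RS.:= r RS.:* (s RS.:* z)) refl s r z)
    }

  -- The hypotheses local, of odd residue characteristic and not a field, restated with decidable
  -- nonunits in place of the maximal ideal; `m` witnesses that the maximal ideal is nonzero.
  record IsOddLocal : Set (c ⊔ ℓ) where
    field
      0-nonUnit : NonUnit 0#
      +-nonUnit : ∀ {x y} → NonUnit x → NonUnit y → NonUnit (x + y)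
      2-unit    : IsUnit (1# + 1#)
      m         : Carrier
      m-nonUnit : NonUnit m
      m≉0       : ¬ (m ≈ 0#)

    unit-+ : ∀ {x y} → IsUnit x → NonUnit y → IsUnit (x + y)
    unit-+ {x} {y} ux ny = ¬nonUnit⇒unit λ nxy →
      NonUnit-resp (RS.solve 2 (λ x y → (x RS.:+ y) RS.:+ RS.:- y RS.:= x) refl x y)
        (+-nonUnit nxy (NonUnit-neg ny)) ux

    -‿nonUnit : ∀ {x y} → NonUnit x → NonUnit y → NonUnit (x - y)
    -‿nonUnit nx ny = +-nonUnit nx (NonUnit-neg ny)

    +-nonUnit⁻ : ∀ {x y} → NonUnit x → NonUnit (x + y) → NonUnit y
    +-nonUnit⁻ {x} {y} nx nxy =
      NonUnit-resp (RS.solve 2 (λ x y → (x RS.:+ y) RS.:- x RS.:= y) refl x y) (-‿nonUnit nxy nx)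

    -- A unit that annihilates `m` would force `m ≈ 0#`; this is where it matters that the ring is
    -- not a field.
    socle⇒nonUnit : ∀ {s} → Socle s → NonUnit s
    socle⇒nonUnit {s} ss (t , eq) = m≉0 (trans
      (trans (sym (*-identityˡ m)) (trans (*-congʳ (sym eq))
        (RS.solve 3 (λ s t m → (s RS.:* t) RS.:* m RS.:= t RS.:* (s RS.:* m)) refl s t m)))
      (trans (*-congˡ (ss m m-nonUnit)) (zeroʳ t)))

    -- The ideal xM, which is nonzero exactly when x lies outside the socle.
    multiplesByNonUnits : Carrier → Ideal R
    multiplesByNonUnits x = record
      { _∈I  = λ y → ∃[ t ] NonUnit t × y ≈ x * t
      ; resp = λ y≈z (t , nt , eq) → t , nt , trans (sym y≈z) eq
      ; 0∈   = 0# , 0-nonUnit , sym (zeroʳ x)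
      ; +∈   = λ (t , nt , p) (s , ns , q) → t + s , +-nonUnit nt ns , trans (+-cong p q) (sym (distribˡ x t s))
      ; *∈   = λ r (t , nt , p) → r * t , NonUnit-*ˡ r nt , trans (*-congˡ p)
                 (RS.solve 3 (λ r x t → r RS.:* (x RS.:* t) RS.:= x RS.:* (r RS.:* t)) refl r x t)
      }

-- Value rings, abstract characters and cardinalities as values.

record IsCharacteristicZeroDomain (C : CommutativeRing d e) : Set (d ⊔ e) where
  open CommutativeRing C
  open SemiringMult semiring using () renaming (_×_ to _·_)
  field
    stable  : ∀ {x y} → ¬ ¬ (x ≈ y) → x ≈ y
    domain  : ∀ {x y} → x * y ≈ 0# → ¬ (x ≈ 0#) → y ≈ 0#
    suc·1≉0 : ∀ n → ¬ (suc n · 1# ≈ 0#)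

  *-cancelˡ : ∀ {k x y} → ¬ (k ≈ 0#) → k * x ≈ k * y → x ≈ y
  *-cancelˡ {k} {x} {y} k≉0 eq = trans (S.solve 2 (λ x y → x S.:= (x S.:- y) S.:+ y) refl x y)
    (trans (+-congʳ (domain (trans (S.solve 3 (λ k x y → k S.:* (x S.:- y) S.:= k S.:* x S.:- k S.:* y) refl k x y)
      (trans (+-congʳ eq) (-‿inverseʳ _))) k≉0)) (+-identityˡ y))
    where module S = IntegerSolver C

record PrimitiveCharacter (R : CommutativeRing c ℓ) (C : CommutativeRing d e)
  : Set (Level.suc (c ⊔ ℓ) ⊔ d ⊔ e) where
  private
    module R = CommutativeRing R
    module C = CommutativeRing C
  field
    ψ         : R.Carrier → C.Carrier
    ψ-cong    : ∀ {x y} → x R.≈ y → ψ x C.≈ ψ y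
    ψ-+       : ∀ x y → ψ (x R.+ y) C.≈ ψ x C.* ψ y
    ψ-0       : ψ R.0# C.≈ C.1#
    isPrimitive : ∀ (I : Ideal R) → (∀ x → x ∈ I → ψ x C.≈ C.1#) → ∀ {x} → x ∈ I → x R.≈ R.0#

module Counting {c ℓ d e} (R : CommutativeRing c ℓ) (F : Finite (CommutativeRing.setoid R))
  (C : CommutativeRing d e) (isDomain : IsCharacteristicZeroDomain C) where
  open CommutativeRing R hiding (zero)
  open FiniteRing R F
  open IsCharacteristicZeroDomain isDomain
  open Sums C
  private
    module C = CommutativeRing C

  infix 4 _≋_
  _≋_ = C._≈_

  -- The cardinalities |R|, |M| and |S| inside the value ring, where they can be compared with sums
  -- of character values.
  N #nonUnits #socle : C.Carrier
  N         = Σ⟨ F ⟩ (λ _ → C.1#)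
  #nonUnits = Σ⟨ F ⟩ (λ x → 𝟙 (nonUnit? x))
  #socle    = Σ⟨ F ⟩ (λ x → 𝟙 (inSocle? x))

  count≉0 : ∀ {P : Pred Carrier a} (P? : Decidable P) → (∀ {x y} → x ≈ y → P x → P y) → ∃ P →
            ¬ (Σ⟨ F ⟩ (λ x → 𝟙 (P? x)) ≋ C.0#)
  count≉0 P? resp w eq = let k , eq′ = Σ-𝟙-pos F P? resp w in suc·1≉0 k (C.trans (C.sym eq′) eq)

  count-all : ∀ {P : Pred Carrier a} (P? : Decidable P) → (∀ x → P x) → Σ⟨ F ⟩ (λ x → 𝟙 (P? x)) ≋ N
  count-all P? all = Σ-cong F (λ x → 𝟙-yes (P? x) (all x))

  N≉0 : ¬ (N ≋ C.0#)
  N≉0 eq = count≉0 {P = λ x → x ≈ x} (λ x → yes refl) (λ _ _ → refl) (0# , refl)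
             (C.trans (count-all {P = λ x → x ≈ x} (λ _ → yes refl) (λ _ → refl)) eq)

-- Orthogonality relations of a primitive additive character.

module Orthogonality {c ℓ d e} (R : CommutativeRing c ℓ) (F : Finite (CommutativeRing.setoid R))
  (local : FiniteRing.IsOddLocal R F)
  (C : CommutativeRing d e) (isDomain : IsCharacteristicZeroDomain C)
  (character : PrimitiveCharacter R C) where
  open CommutativeRing R hiding (zero)
  open FiniteSetoid F using (_≟_; any?)
  open FiniteRing R F
  open IsOddLocal local
  open IsCharacteristicZeroDomain isDomain
  open PrimitiveCharacter character
  open Sums C
  open Counting R F C isDomain
  private
    module C  = CommutativeRing C
    module RS = IntegerSolver R
    module CS = IntegerSolver C
  open SetoidReasoning C.setoid

  ψ-≈0 : ∀ {x} → x ≈ 0# → ψ x ≋ C.1#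
  ψ-≈0 x≈0 = C.trans (ψ-cong x≈0) ψ-0

  -- If X ≉ 0, then ψ is trivial on I, which contradicts primitivity.
  vanish : ∀ (I : Ideal R) {z} → z ∈ I → ¬ (z ≈ 0#) → ∀ {X} → (∀ t → t ∈ I → ψ t C.* X ≋ X) → X ≋ C.0#
  vanish I z∈I z≉0 {X} fix = stable λ X≉0 → z≉0 (isPrimitive I (λ t t∈I → stable λ ψt≉1 →
    X≉0 (domain
      (C.trans (CS.solve 2 (λ p X → (p CS.:- CS.con (+ 1)) CS.:* X CS.:= p CS.:* X CS.:- X) C.refl (ψ t) X)
               (C.trans (C.+-congʳ (fix t t∈I)) (C.-‿inverseʳ X)))
      (λ eq → ψt≉1 (C.trans (CS.solve 1 (λ p → p CS.:= (p CS.:- CS.con (+ 1)) CS.:+ CS.con (+ 1)) C.refl (ψ t))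
                            (C.trans (C.+-congʳ eq) (C.+-identityˡ C.1#)))))) z∈I)

  -- Translating x by y fixes the sum and multiplies it by `ψ (r * y)`, and by primitivity ψ is not
  -- identically 1 on the nonzero ideal (r).
  Σψ-multiples : ∀ {r} → ¬ (r ≈ 0#) → Σ⟨ F ⟩ (λ x → ψ (r * x)) ≋ C.0#
  Σψ-multiples {r} r≉0 = vanish (multiples r) {r} (1# , sym (*-identityʳ r)) r≉0 λ t (y , t≈ry) → begin
    ψ t C.* Σ⟨ F ⟩ (λ x → ψ (r * x))      ≈⟨ Σ-*ˡ F _ _ ⟨
    Σ⟨ F ⟩ (λ x → ψ t C.* ψ (r * x))      ≈⟨ Σ-cong F (λ x → C.trans (C.sym (ψ-+ _ _))
                                              (ψ-cong (trans (+-congʳ t≈ry) (sym (distribˡ r y x))))) ⟩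
    Σ⟨ F ⟩ (λ x → ψ (r * (y + x)))        ≈⟨ Σ-translate +-abelianGroup F (λ x → ψ (r * x)) (λ eq → ψ-cong (*-congˡ eq)) y ⟨
    Σ⟨ F ⟩ (λ x → ψ (r * x))              ∎

  -- Both sides count the pairs (r, x) with weight ψ (r (m x + y)).
  socle⊆multiples : ∀ {m y} → ¬ (m ≈ 0#) → Socle y → y ∈ multiples m
  socle⊆multiples {m} {y} m≉0 sy = decidable-stable (any? (λ p q → trans q (*-congˡ p)) (λ r → y ≟ (m * r))) λ ¬∃ →
    -- If y were no multiple of m, then m x + y would never vanish and all sums over r would be
    -- zero. The number of annihilators of m would then be zero, although 0 is one of them.
    count≉0 ann? (λ p q → trans (*-congʳ (sym p)) q) (0# , zeroˡ m) (domain (begin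
      N C.* Σ⟨ F ⟩ (λ r → 𝟙 (ann? r))                   ≈⟨ Σ-*ˡ F _ _ ⟨
      Σ⟨ F ⟩ (λ r → N C.* 𝟙 (ann? r))                   ≈⟨ Σ-cong F (λ r → by-annihilator r (ann? r)) ⟩
      Σ⟨ F ⟩ (λ r → Σ⟨ F ⟩ (λ x → ψ (r * (m * x + y)))) ≈⟨ Σ-swap F F _ ⟩
      Σ⟨ F ⟩ (λ x → Σ⟨ F ⟩ (λ r → ψ (r * (m * x + y)))) ≈⟨ Σ-zero F (λ x → C.trans
          (Σ-cong F (λ r → ψ-cong (*-comm r _))) (Σψ-multiples (λ eq → ¬∃ (- x ,
            trans (RS.solve 3 (λ m x y → y RS.:= (m RS.:* x RS.:+ y) RS.:+ m RS.:* (RS.:- x)) refl m x y)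
              (trans (+-congʳ eq) (+-identityˡ _)))))) ⟩
      C.0#                                              ∎) N≉0)
    where
    ann? : ∀ r → Dec (r * m ≈ 0#)
    ann? r = (r * m) ≟ 0#

    expand : ∀ r x → r * (m * x + y) ≈ r * y + (r * m) * x
    expand r x = RS.solve 4 (λ r m x y → r RS.:* (m RS.:* x RS.:+ y) RS.:= r RS.:* y RS.:+ (r RS.:* m) RS.:* x) refl r m x y

    -- An r that annihilates m ≉ 0 is a nonunit, so it also annihilates the socle element y and
    -- every term is 1. For any other r the factor ψ (r y) splits off and orthogonality applies.
    by-annihilator : ∀ r (p? : Dec (r * m ≈ 0#)) → N C.* 𝟙 p? ≋ Σ⟨ F ⟩ (λ x → ψ (r * (m * x + y)))
    by-annihilator r (yes rm≈0) = C.trans (C.*-identityʳ N) (Σ-cong F (λ x → C.sym (ψ-≈0 (vanishes x))))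
      where
      r-nonUnit : NonUnit r
      r-nonUnit (s , rs≈1) = m≉0 (trans (sym (*-identityˡ m)) (trans (*-congʳ (sym rs≈1))
        (trans (RS.solve 3 (λ r s m → (r RS.:* s) RS.:* m RS.:= s RS.:* (r RS.:* m)) refl r s m)
          (trans (*-congˡ rm≈0) (zeroʳ s)))))
      vanishes : ∀ x → r * (m * x + y) ≈ 0#
      vanishes x = trans (expand r x) (trans
        (+-cong (trans (*-comm r y) (sy r r-nonUnit)) (trans (*-congʳ rm≈0) (zeroˡ x))) (+-identityˡ 0#))
    by-annihilator r (no rm≉0) = begin
      N C.* C.0#                                          ≈⟨ C.zeroʳ N ⟩
      C.0#                                                ≈⟨ C.zeroʳ _ ⟨
      ψ (r * y) C.* C.0#                                  ≈⟨ C.*-congˡ (Σψ-multiples rm≉0) ⟨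
      ψ (r * y) C.* Σ⟨ F ⟩ (λ x → ψ ((r * m) * x))        ≈⟨ Σ-*ˡ F _ _ ⟨
      Σ⟨ F ⟩ (λ x → ψ (r * y) C.* ψ ((r * m) * x))        ≈⟨ Σ-cong F (λ x → C.trans (C.sym (ψ-+ _ _)) (ψ-cong (sym (expand r x)))) ⟩
      Σ⟨ F ⟩ (λ x → ψ (r * (m * x + y)))                  ∎

  -- Both sides are the sum of ψ (x r) over all x and all nonunits r.
  #nonUnits*#socle≈N : #nonUnits C.* #socle ≋ N
  #nonUnits*#socle≈N = begin
    #nonUnits C.* #socle                                            ≈⟨ Σ-*ˡ F _ _ ⟨
    Σ⟨ F ⟩ (λ x → #nonUnits C.* 𝟙 (inSocle? x))                     ≈⟨ Σ-cong F by-socle ⟩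
    Σ⟨ F ⟩ (λ x → Σ⟨ F ⟩ (λ r → 𝟙 (nonUnit? r) C.* ψ (x * r)))      ≈⟨ Σ-swap F F _ ⟩
    Σ⟨ F ⟩ (λ r → Σ⟨ F ⟩ (λ x → 𝟙 (nonUnit? r) C.* ψ (x * r)))      ≈⟨ Σ-cong F (λ r → Σ-*ˡ F _ _) ⟩
    Σ⟨ F ⟩ (λ r → 𝟙 (nonUnit? r) C.* Σ⟨ F ⟩ (λ x → ψ (x * r)))
      ≈⟨ Σ-point F (λ {x} {y} x≈y → C.*-cong
            (𝟙-cong (nonUnit? x) (nonUnit? y) (NonUnit-resp x≈y) (NonUnit-resp (sym x≈y)))
            (Σ-cong F (λ z → ψ-cong (*-congˡ x≈y))))
          0#
          (λ r r≉0 → C.trans (C.*-congˡ (C.trans (Σ-cong F (λ x → ψ-cong (*-comm x r))) (Σψ-multiples r≉0))) (C.zeroʳ _)) ⟩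
    𝟙 (nonUnit? 0#) C.* Σ⟨ F ⟩ (λ x → ψ (x * 0#))
      ≈⟨ C.*-cong (𝟙-yes (nonUnit? 0#) 0-nonUnit) (Σ-cong F (λ x → ψ-≈0 (zeroʳ x))) ⟩
    C.1# C.* N                                                      ≈⟨ C.*-identityˡ N ⟩
    N                                                               ∎
    where
    -- For x in the socle all weighted terms are 1. Otherwise xM is a nonzero ideal, and shifting r
    -- by a nonunit s preserves the weight and multiplies the sum by ψ (x s).
    by-socle : ∀ x → #nonUnits C.* 𝟙 (inSocle? x) ≋ Σ⟨ F ⟩ (λ r → 𝟙 (nonUnit? r) C.* ψ (x * r))
    by-socle x with socle? x
    ... | inj₁ sx = C.trans (C.*-identityʳ _) (Σ-cong F (λ r → C.trans (C.sym (C.*-identityʳ _))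
                      (𝟙*-cong (nonUnit? r) (λ nr → C.sym (ψ-≈0 (sx r nr))))))
    ... | inj₂ (y , ny , xy≉0) = C.trans (C.zeroʳ _) (C.sym
      (vanish (multiplesByNonUnits x) (y , ny , refl) xy≉0 λ t (s , ns , t≈xs) → begin
        ψ t C.* Σ⟨ F ⟩ (λ r → 𝟙 (nonUnit? r) C.* ψ (x * r))     ≈⟨ Σ-*ˡ F _ _ ⟨
        Σ⟨ F ⟩ (λ r → ψ t C.* (𝟙 (nonUnit? r) C.* ψ (x * r)))   ≈⟨ Σ-cong F (λ r → C.trans
          (CS.solve 3 (λ a b c → a CS.:* (b CS.:* c) CS.:= b CS.:* (a CS.:* c)) C.refl _ _ _)
          (C.*-cong (𝟙-cong (nonUnit? r) (nonUnit? (s + r)) (+-nonUnit ns) (+-nonUnit⁻ ns))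
            (C.trans (C.sym (ψ-+ _ _)) (ψ-cong (trans (+-congʳ t≈xs) (sym (distribˡ x s r))))))) ⟩
        Σ⟨ F ⟩ (λ r → 𝟙 (nonUnit? (s + r)) C.* ψ (x * (s + r))) ≈⟨ Σ-translate +-abelianGroup F
          (λ r → 𝟙 (nonUnit? r) C.* ψ (x * r))
          (λ {r} {r′} p → C.*-cong (𝟙-cong (nonUnit? r) (nonUnit? r′) (NonUnit-resp p) (NonUnit-resp (sym p))) (ψ-cong (*-congˡ p))) s ⟨
        Σ⟨ F ⟩ (λ r → 𝟙 (nonUnit? r) C.* ψ (x * r))             ∎))

  #nonUnits≉0 : ¬ (#nonUnits ≋ C.0#)
  #nonUnits≉0 = count≉0 nonUnit? NonUnit-resp (0# , 0-nonUnit)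

  #socle≉0 : ¬ (#socle ≋ C.0#)
  #socle≉0 = count≉0 inSocle? Socle-resp (0# , λ y _ → zeroˡ y)

  -- If the socle were zero, then by the previous count every element would be a nonunit.
  socle≉0 : ∃[ s ] Socle s × ¬ (s ≈ 0#)
  socle≉0 = decidable-stable
    (any? {P = λ s → Socle s × ¬ (s ≈ 0#)} (λ p (ss , s≉0) → Socle-resp p ss , λ eq → s≉0 (trans p eq))
          (λ s → inSocle? s ×-dec ¬? (s ≟ 0#)))
    λ ¬∃ → count≉0 isUnit? IsUnit-resp (1# , 1# , *-identityˡ 1#) (
      let X = Σ⟨ F ⟩ (λ x → 𝟙 (isUnit? x))
          #socle≈1 : #socle ≋ C.1#
          #socle≈1 = C.trans
            (Σ-point F (λ {x} {y} p → 𝟙-cong (inSocle? x) (inSocle? y) (Socle-resp p) (Socle-resp (sym p))) 0#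
              (λ x x≉0 → 𝟙-no (inSocle? x) (λ sx → ¬∃ (x , sx , x≉0))))
            (𝟙-yes (inSocle? 0#) (λ y _ → zeroˡ y))
          split : N ≋ #nonUnits C.+ X
          split = C.trans (Σ-cong F (λ x → C.sym (complement (isUnit? x)))) (Σ-+ F _ _)
      in begin
        X                               ≈⟨ CS.solve 2 (λ n x → x CS.:= (n CS.:+ x) CS.:- n) C.refl #nonUnits X ⟩
        (#nonUnits C.+ X) C.- #nonUnits ≈⟨ C.+-congʳ (C.trans (C.sym split) (C.trans (C.sym #nonUnits*#socle≈N)
                                             (C.trans (C.*-congˡ #socle≈1) (C.*-identityʳ _)))) ⟩
        #nonUnits C.- #nonUnits         ≈⟨ C.-‿inverseʳ _ ⟩
        C.0#                            ∎)
    where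
    complement : ∀ {P : Set (c ⊔ ℓ)} (p? : Dec P) → 𝟙 (¬? p?) C.+ 𝟙 p? ≋ C.1#
    complement (yes _) = C.+-identityˡ C.1#
    complement (no  _) = C.+-identityʳ C.1#

  -- This makes the socle a detector of nonunits: a nonunit y is annihilated by every s, while for a
  -- unit y the products s y run over the whole socle, a nonzero ideal.
  Σψ-socle : ∀ y → Σ⟨ F ⟩ (λ s → 𝟙 (inSocle? s) C.* ψ (s * y)) ≋ #socle C.* 𝟙 (nonUnit? y)
  Σψ-socle y with isUnit? y
  ... | no  ny = C.trans (Σ-cong F (λ s → C.trans (𝟙*-cong (inSocle? s) (λ ss → ψ-≈0 (ss y ny))) (C.*-identityʳ _)))
                   (C.sym (C.*-identityʳ _))
  ... | yes (y′ , yy′≈1) = let s₀ , ss₀ , s₀≉0 = socle≉0 in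
    C.trans (vanish socle {s₀} ss₀ s₀≉0 λ t st →
      let s   = y′ * t
          sy≈t : s * y ≈ t
          sy≈t = trans (RS.solve 3 (λ y y′ t → (y′ RS.:* t) RS.:* y RS.:= (y RS.:* y′) RS.:* t) refl y y′ t)
                   (trans (*-congʳ yy′≈1) (*-identityˡ t))
          ss : Socle s
          ss = Ideal.*∈ socle y′ st
      in begin
      ψ t C.* Σ⟨ F ⟩ (λ r → 𝟙 (inSocle? r) C.* ψ (r * y))       ≈⟨ Σ-*ˡ F _ _ ⟨
      Σ⟨ F ⟩ (λ r → ψ t C.* (𝟙 (inSocle? r) C.* ψ (r * y)))     ≈⟨ Σ-cong F (λ r → C.trans
        (CS.solve 3 (λ a b c → a CS.:* (b CS.:* c) CS.:= b CS.:* (a CS.:* c)) C.refl _ _ _)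
        (C.*-cong (𝟙-cong (inSocle? r) (inSocle? (s + r)) (Ideal.+∈ socle ss)
            (λ ssr → Socle-resp (RS.solve 2 (λ s r → RS.:- RS.con (+ 1) RS.:* s RS.:+ (s RS.:+ r) RS.:= r) refl s r)
                       (Ideal.+∈ socle (Ideal.*∈ socle (- 1#) ss) ssr)))
          (C.trans (C.sym (ψ-+ _ _)) (ψ-cong (trans (+-congʳ (sym sy≈t)) (sym (distribʳ y s r))))))) ⟩
      Σ⟨ F ⟩ (λ r → 𝟙 (inSocle? (s + r)) C.* ψ ((s + r) * y))   ≈⟨ Σ-translate +-abelianGroup F
        (λ r → 𝟙 (inSocle? r) C.* ψ (r * y))
        (λ {r} {r′} p → C.*-cong (𝟙-cong (inSocle? r) (inSocle? r′) (Socle-resp p) (Socle-resp (sym p))) (ψ-cong (*-congʳ p))) s ⟨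
      Σ⟨ F ⟩ (λ r → 𝟙 (inSocle? r) C.* ψ (r * y))               ∎)
    (C.sym (C.zeroʳ _))

-- What the computation takes from non-primitivity, in a form that passes to the inverse character.
record SocleTrivialCharacter (R : CommutativeRing c ℓ) (F : Finite (CommutativeRing.setoid R))
  (C : CommutativeRing d e) : Set (c ⊔ ℓ ⊔ d ⊔ e) where
  private
    module R = CommutativeRing R
    module C = CommutativeRing C
    module U = AbelianGroup (unitGroup R)
  field
    τ       : U.Carrier → C.Carrier
    τ-cong  : ∀ {u v} → u U.≈ v → τ u C.≈ τ v
    τ-∙     : ∀ u v → τ (u U.∙ v) C.≈ τ u C.* τ v
    τ-socle : ∀ u → FiniteRing.Socle R F (Unit.val u R.- R.1#) → τ u C.≈ C.1#

-- Arithmetic of units modulo the maximal ideal.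

module OddLocal {c ℓ} (R : CommutativeRing c ℓ) (F : Finite (CommutativeRing.setoid R))
  (local : FiniteRing.IsOddLocal R F) where
  open CommutativeRing R hiding (zero)
  open FiniteRing R F
  open IsOddLocal local
  open Unit
  private module RS = IntegerSolver R

  -- Since s is itself a nonunit, s² = 0. The explicit inverse `1# - s` makes u + a/u change by
  -- exactly s (u - a/u) under u ↦ (1 + s) u.
  socleUnit : ∀ {s} → Socle s → Unit R
  socleUnit {s} ss = unit (1# + s) (1# - s)
    (trans (RS.solve 1 (λ s → (RS.con (+ 1) RS.:+ s) RS.:* (RS.con (+ 1) RS.:- s) RS.:= RS.con (+ 1) RS.:- s RS.:* s) refl s)
      (trans (+-congˡ (-‿cong (ss s (socle⇒nonUnit ss))))
        (RS.solve 0 (RS.con (+ 1) RS.:- RS.con (+ 0) RS.:= RS.con (+ 1)) refl)))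

  -- Multiplication by a socle element factors through the residue field; exponents are evaluated
  -- this way throughout.
  socle-cong : ∀ {s x y} → Socle s → NonUnit (x - y) → s * x ≈ s * y
  socle-cong {s} {x} {y} ss n = trans
    (RS.solve 3 (λ s x y → s RS.:* x RS.:= s RS.:* (x RS.:- y) RS.:+ s RS.:* y) refl s x y)
    (trans (+-congʳ (ss _ n)) (+-identityˡ _))

  NonUnit-minus : ∀ {x y z} → x - y ≈ z → NonUnit x → NonUnit y → NonUnit z
  NonUnit-minus eq nx ny = NonUnit-resp eq (-‿nonUnit nx ny)

  NonUnit-plus : ∀ {x y z} → x + y ≈ z → NonUnit x → NonUnit y → NonUnit z
  NonUnit-plus eq nx ny = NonUnit-resp eq (+-nonUnit nx ny)

  NonUnit-sub-cong : ∀ {x x′ y y′} → x ≈ x′ → y ≈ y′ → NonUnit (x - y) → NonUnit (x′ - y′)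
  NonUnit-sub-cong p q = NonUnit-resp (+-cong p (-‿cong q))

  -- From a/u - b = u⁻¹ (a - b²) - u⁻¹ b (u - b): the involution u ↦ a/u preserves the residue class
  -- of a square root of a.
  quotient≡root : ∀ {a b} (u : Unit R) → NonUnit (a - b * b) → NonUnit (val u - b) → NonUnit (a * inv u - b)
  quotient≡root {a} {b} u na nu = NonUnit-minus
    (trans (RS.solve 4 (λ a b u i → i RS.:* (a RS.:- b RS.:* b) RS.:- (i RS.:* b) RS.:* (u RS.:- b) RS.:= a RS.:* i RS.:- (u RS.:* i) RS.:* b) refl a b (val u) (inv u))
      (+-congˡ (-‿cong (trans (*-congʳ (val*inv u)) (*-identityˡ b)))))
    (NonUnit-*ˡ (inv u) na) (NonUnit-*ˡ (inv u * b) nu)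

  -- Odd characteristic keeps the residue classes of b and -b apart.
  double-unit : ∀ {b} → IsUnit b → IsUnit (b - - b)
  double-unit {b} ub = IsUnit-resp
    (RS.solve 1 (λ b → (RS.con (+ 1) RS.:+ RS.con (+ 1)) RS.:* b RS.:= b RS.:- RS.:- b) refl b) (IsUnit-* 2-unit ub)

  module _ {d e} (C : CommutativeRing d e) where
    open Sums C
    private module C = CommutativeRing C

    -- A product of units is a unit, so one factor of a nonunit (u - b)(u + b) is a nonunit; never
    -- both, as they differ by the unit 2b. `Q` is left open to cover both a ≡ u² and u ≡ a/u.
    𝟙-square : ∀ {Q : Set a} (Q? : Dec Q) {u b} → IsUnit b →
               (Q → NonUnit ((u - b) * (u + b))) → (NonUnit ((u - b) * (u + b)) → Q) →
               𝟙 Q? C.≈ 𝟙 (nonUnit? (u - b)) C.+ 𝟙 (nonUnit? (u - - b))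
    𝟙-square Q? {u} {b} ub Q⇒ ⇒Q = 𝟙-⊎ (nonUnit? (u - b)) (nonUnit? (u - - b)) Q?
      split
      (λ n → ⇒Q (NonUnit-*ʳ (u + b) n))
      (λ n → ⇒Q (NonUnit-*ˡ (u - b) (NonUnit-resp minus-minus n)))
      (λ n n′ → NonUnit-minus (RS.solve 2 (λ u b → (u RS.:- RS.:- b) RS.:- (u RS.:- b) RS.:= b RS.:- RS.:- b) refl u b) n′ n (double-unit ub))
      where
      minus-minus : u - - b ≈ u + b
      minus-minus = RS.solve 2 (λ u b → u RS.:- RS.:- b RS.:= u RS.:+ b) refl u b
      split : _ → NonUnit (u - b) ⊎ NonUnit (u - - b)
      split q with isUnit? (u - b)
      ... | no  n = inj₁ n
      ... | yes v = inj₂ (NonUnit-resp (sym minus-minus) (NonUnit-cancelˡ v (Q⇒ q)))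

module UnitCounting {c ℓ d e} (R : CommutativeRing c ℓ) (F : Finite (CommutativeRing.setoid R))
  (local : FiniteRing.IsOddLocal R F)
  (C : CommutativeRing d e) (isDomain : IsCharacteristicZeroDomain C) where
  open CommutativeRing R hiding (zero)
  open FiniteSetoid F using (_≟_)
  open FiniteRing R F
  open IsOddLocal local
  open OddLocal R F local
  open Sums C
  open Counting R F C isDomain
  open Unit
  private
    module C  = CommutativeRing C
    module RS = IntegerSolver R
  open SetoidReasoning C.setoid

  U : Finite (AbelianGroup.setoid (unitGroup R))
  U = unitsFinite R F

  -- Counts pairs of a unit u and an element x equal to its value. Units are compared by value
  -- alone, so exactly one lies over each x in `P`.
  count-units : ∀ {P : Pred Carrier a} (P? : Decidable P) → (∀ {x y} → x ≈ y → P x → P y) →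
                (∀ {x} → P x → IsUnit x) → Σ⟨ U ⟩ (λ u → 𝟙 (P? (val u))) ≋ Σ⟨ F ⟩ (λ x → 𝟙 (P? x))
  count-units {P = P} P? resp P⇒unit = begin
    Σ⟨ U ⟩ (λ u → 𝟙 (P? (val u)))                               ≈⟨ Σ-cong U (λ u → C.sym (at-val u)) ⟩
    Σ⟨ U ⟩ (λ u → Σ⟨ F ⟩ (λ x → 𝟙 (x ≟ val u) C.* 𝟙 (P? x)))    ≈⟨ Σ-swap U F _ ⟩
    Σ⟨ F ⟩ (λ x → Σ⟨ U ⟩ (λ u → 𝟙 (x ≟ val u) C.* 𝟙 (P? x)))    ≈⟨ Σ-cong F (λ x → at-unit x (P? x)) ⟩
    Σ⟨ F ⟩ (λ x → 𝟙 (P? x))                                     ∎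
    where
    at-val : ∀ u → Σ⟨ F ⟩ (λ x → 𝟙 (x ≟ val u) C.* 𝟙 (P? x)) ≋ 𝟙 (P? (val u))
    at-val u = C.trans
      (Σ-point F (λ {x} {y} p → C.*-cong
          (𝟙-cong (x ≟ val u) (y ≟ val u) (trans (sym p)) (trans p)) (𝟙-cong (P? x) (P? y) (resp p) (resp (sym p))))
        (val u) (λ x x≉u → C.trans (C.*-congʳ (𝟙-no (x ≟ val u) x≉u)) (C.zeroˡ _)))
      (C.trans (C.*-congʳ (𝟙-yes (val u ≟ val u) refl)) (C.*-identityˡ _))
    at-unit : ∀ x (p? : Dec (P x)) → Σ⟨ U ⟩ (λ u → 𝟙 (x ≟ val u) C.* 𝟙 p?) ≋ 𝟙 p?
    at-unit x (no _)  = Σ-zero U (λ u → C.zeroʳ _)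
    at-unit x (yes p) = let y , xy≈1 = P⇒unit p ; u₀ = unit x y xy≈1 in C.trans
      (Σ-point U (λ {u} {v} eq → C.*-congʳ (𝟙-cong (x ≟ val u) (x ≟ val v) (λ q → trans q eq) (λ q → trans q (sym eq)))) u₀
        (λ u u≉ → C.trans (C.*-congʳ (𝟙-no (x ≟ val u) (λ q → u≉ (sym q)))) (C.zeroˡ _)))
      (C.trans (C.*-identityʳ _) (𝟙-yes (x ≟ x) refl))

  private
    count-coset : ∀ {P : Pred Carrier a} (P? : Decidable P) → (∀ {x y} → x ≈ y → P x → P y) → ∀ b →
                  (∀ {x} → P (x - b) → IsUnit x) → Σ⟨ U ⟩ (λ u → 𝟙 (P? (val u - b))) ≋ Σ⟨ F ⟩ (λ x → 𝟙 (P? x))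
    count-coset P? resp b P⇒unit = begin
      Σ⟨ U ⟩ (λ u → 𝟙 (P? (val u - b)))  ≈⟨ count-units (λ x → P? (x - b)) (λ p → resp (+-congʳ p)) P⇒unit ⟩
      Σ⟨ F ⟩ (λ x → 𝟙 (P? (x - b)))      ≈⟨ Σ-translate +-abelianGroup F _
                                             (λ {x} {y} p → 𝟙-cong (P? (x - b)) (P? (y - b)) (resp (+-congʳ p)) (resp (+-congʳ (sym p)))) b ⟩
      Σ⟨ F ⟩ (λ x → 𝟙 (P? (b + x - b)))  ≈⟨ Σ-cong F (λ x →
                                             let eq = RS.solve 2 (λ b x → b RS.:+ x RS.:- b RS.:= x) refl b x
                                             in 𝟙-cong (P? (b + x - b)) (P? x) (resp eq) (resp (sym eq))) ⟩
      Σ⟨ F ⟩ (λ x → 𝟙 (P? x))            ∎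

    minus-plus : ∀ b x → b + (x - b) ≈ x
    minus-plus = RS.solve 2 (λ b x → b RS.:+ (x RS.:- b) RS.:= x) refl

  count-residue : ∀ {b} → IsUnit b → Σ⟨ U ⟩ (λ u → 𝟙 (nonUnit? (val u - b))) ≋ #nonUnits
  count-residue {b} ub = count-coset nonUnit? NonUnit-resp b
    (λ {x} n → IsUnit-resp (minus-plus b x) (unit-+ ub n))

  count-1+socle : Σ⟨ U ⟩ (λ u → 𝟙 (inSocle? (val u - 1#))) ≋ #socle
  count-1+socle = count-coset inSocle? Socle-resp 1#
    (λ {x} s → IsUnit-resp (minus-plus 1# x) (unit-+ (1# , *-identityˡ 1#) (socle⇒nonUnit s)))

  count-roots : ∀ {a b} → IsUnit b → NonUnit (a - b * b) →
                Σ⟨ U ⟩ (λ u → 𝟙 (nonUnit? (a - val u * val u))) ≋ #nonUnits C.+ #nonUnits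
  count-roots {a} {b} ub na = begin
    Σ⟨ U ⟩ (λ u → 𝟙 (nonUnit? (a - val u * val u)))     ≈⟨ Σ-cong U (λ u → 𝟙-square C (nonUnit? (a - val u * val u)) ub
        (λ n → NonUnit-minus (identity u) na n)
        (λ n → NonUnit-minus (identity′ u) na n)) ⟩
    Σ⟨ U ⟩ (λ u → 𝟙 (nonUnit? (val u - b)) C.+ 𝟙 (nonUnit? (val u - - b))) ≈⟨ Σ-+ U _ _ ⟩
    Σ⟨ U ⟩ (λ u → 𝟙 (nonUnit? (val u - b))) C.+ Σ⟨ U ⟩ (λ u → 𝟙 (nonUnit? (val u - - b)))
      ≈⟨ C.+-cong (count-residue ub) (count-residue (IsUnit-neg ub)) ⟩
    #nonUnits C.+ #nonUnits ∎
    where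
    identity : ∀ u → (a - b * b) - (a - val u * val u) ≈ (val u - b) * (val u + b)
    identity u = RS.solve 3 (λ a b u → (a RS.:- b RS.:* b) RS.:- (a RS.:- u RS.:* u) RS.:= (u RS.:- b) RS.:* (u RS.:+ b)) refl a b (val u)
    identity′ : ∀ u → (a - b * b) - (val u - b) * (val u + b) ≈ a - val u * val u
    identity′ u = RS.solve 3 (λ a b u → (a RS.:- b RS.:* b) RS.:- (u RS.:- b) RS.:* (u RS.:+ b) RS.:= a RS.:- u RS.:* u) refl a b (val u)

-- Localisation of Kloosterman sums at square roots, and the correlation sum.

module KloostermanSum {c ℓ d e} (R : CommutativeRing c ℓ) (F : Finite (CommutativeRing.setoid R))
  (local : FiniteRing.IsOddLocal R F)
  (C : CommutativeRing d e) (isDomain : IsCharacteristicZeroDomain C)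
  (character : PrimitiveCharacter R C) (twist : SocleTrivialCharacter R F C) where
  open CommutativeRing R hiding (zero)
  open FiniteRing R F
  open IsOddLocal local
  open IsCharacteristicZeroDomain isDomain
  open OddLocal R F local
  open Sums C
  open Counting R F C isDomain
  open UnitCounting R F local C isDomain
  open Orthogonality R F local C isDomain character
  open PrimitiveCharacter character
  open SocleTrivialCharacter twist
  open Unit
  private
    module C  = CommutativeRing C
    module RS = IntegerSolver R
    module CS = IntegerSolver C
    module G  = AbelianGroup (unitGroup R)
  open SetoidReasoning C.setoid

  term : Carrier → Unit R → C.Carrier
  term a u = τ u C.* ψ (val u + a * inv u)

  term-cong : ∀ {a a′} → a ≈ a′ → ∀ {u v : Unit R} → val u ≈ val v → term a u ≋ term a′ v
  term-cong a≈a′ {u} {v} u≈v =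
    C.*-cong (τ-cong {u} {v} u≈v) (ψ-cong (+-cong u≈v (*-cong a≈a′ (G.⁻¹-cong {u} {v} u≈v))))

  K : Carrier → C.Carrier
  K a = Σ⟨ U ⟩ (term a)

  part : Carrier → Carrier → C.Carrier
  part a b = Σ⟨ U ⟩ (λ u → 𝟙 (nonUnit? (val u - b)) C.* term a u)

  part-cong : ∀ {a a′} b → a ≈ a′ → part a b ≋ part a′ b
  part-cong b a≈a′ = Σ-cong U (λ u → C.*-congˡ (term-cong a≈a′ {u} {u} refl))

  term-socle : ∀ a u {s} (ss : Socle s) → term a (socleUnit ss G.∙ u) ≋ term a u C.* ψ (s * (val u - a * inv u))
  term-socle a u {s} ss = begin
    τ (socleUnit ss G.∙ u) C.* ψ ((1# + s) * val u + a * ((1# - s) * inv u))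
      ≈⟨ C.*-cong (C.trans (τ-∙ (socleUnit ss) u) (C.trans (C.*-congʳ (τ-socle (socleUnit ss)
            (Socle-resp (RS.solve 1 (λ s → s RS.:= RS.con (+ 1) RS.:+ s RS.:- RS.con (+ 1)) refl s) ss))) (C.*-identityˡ _)))
          (C.trans (ψ-cong (RS.solve 4 (λ s u a i → (RS.con (+ 1) RS.:+ s) RS.:* u RS.:+ a RS.:* ((RS.con (+ 1) RS.:- s) RS.:* i)
              RS.:= (u RS.:+ a RS.:* i) RS.:+ s RS.:* (u RS.:- a RS.:* i)) refl s (val u) a (inv u))) (ψ-+ _ _)) ⟩
    τ u C.* (ψ (val u + a * inv u) C.* ψ (s * (val u - a * inv u)))   ≈⟨ C.*-assoc _ _ _ ⟨
    term a u C.* ψ (s * (val u - a * inv u))                          ∎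

  -- Averaging over the substitutions u ↦ (1 + s) u with s in the socle.
  K-stationary : ∀ a → K a ≋ Σ⟨ U ⟩ (λ u → 𝟙 (nonUnit? (val u - a * inv u)) C.* term a u)
  K-stationary a = *-cancelˡ #socle≉0 (begin
    #socle C.* K a                                                  ≈⟨ Σ-*ʳ F _ _ ⟨
    Σ⟨ F ⟩ (λ s → 𝟙 (inSocle? s) C.* K a)                           ≈⟨ Σ-cong F (λ s → 𝟙*-cong (inSocle? s) (λ ss →
        C.trans (Σ-translate (unitGroup R) U (term a) (λ {u} {v} → term-cong refl {u} {v}) (socleUnit ss))
                (Σ-cong U (λ u → term-socle a u ss)))) ⟩
    Σ⟨ F ⟩ (λ s → 𝟙 (inSocle? s) C.* Σ⟨ U ⟩ (λ u → term a u C.* ψ (s * (val u - a * inv u))))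
      ≈⟨ Σ-cong F (λ s → C.sym (Σ-*ˡ U _ _)) ⟩
    Σ⟨ F ⟩ (λ s → Σ⟨ U ⟩ (λ u → 𝟙 (inSocle? s) C.* (term a u C.* ψ (s * (val u - a * inv u)))))
      ≈⟨ Σ-swap F U _ ⟩
    Σ⟨ U ⟩ (λ u → Σ⟨ F ⟩ (λ s → 𝟙 (inSocle? s) C.* (term a u C.* ψ (s * (val u - a * inv u)))))
      ≈⟨ Σ-cong U (λ u → C.trans (Σ-cong F (λ s →
           CS.solve 3 (λ a b c → a CS.:* (b CS.:* c) CS.:= b CS.:* (a CS.:* c)) C.refl _ _ _))
           (C.trans (Σ-*ˡ F _ _) (C.*-congˡ (Σψ-socle _)))) ⟩
    Σ⟨ U ⟩ (λ u → term a u C.* (#socle C.* 𝟙 (nonUnit? (val u - a * inv u))))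
      ≈⟨ Σ-cong U (λ u → CS.solve 3 (λ a b c → a CS.:* (b CS.:* c) CS.:= b CS.:* (c CS.:* a)) C.refl _ _ _) ⟩
    Σ⟨ U ⟩ (λ u → #socle C.* (𝟙 (nonUnit? (val u - a * inv u)) C.* term a u))
      ≈⟨ Σ-*ˡ U _ _ ⟩
    #socle C.* Σ⟨ U ⟩ (λ u → 𝟙 (nonUnit? (val u - a * inv u)) C.* term a u) ∎)

  private
    -- Turns the stationarity condition u ≡ a/u into u² ≡ a.
    quotient-square : ∀ a (u : Unit R) → val u * (val u - a * inv u) ≈ val u * val u - a
    quotient-square a u = trans
      (RS.solve 3 (λ a u i → u RS.:* (u RS.:- a RS.:* i) RS.:= u RS.:* u RS.:- (u RS.:* i) RS.:* a) refl a (val u) (inv u))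
      (+-congˡ (-‿cong (trans (*-congʳ (val*inv u)) (*-identityˡ a))))

  K-nonresidue : ∀ a → (∀ u → ¬ NonUnit (a - val u * val u)) → K a ≋ C.0#
  K-nonresidue a nr = C.trans (K-stationary a) (Σ-zero U (λ u → C.trans
    (C.*-congʳ (𝟙-no (nonUnit? (val u - a * inv u)) (λ n → nr u (NonUnit-resp
      (trans (-‿cong (quotient-square a u)) (RS.solve 2 (λ u a → RS.:- (u RS.:* u RS.:- a) RS.:= a RS.:- u RS.:* u) refl (val u) a))
      (NonUnit-neg (NonUnit-*ˡ (val u) n))))))
    (C.zeroˡ _)))

  K-split : ∀ {a b} → IsUnit b → NonUnit (a - b * b) → K a ≋ part a b C.+ part a (- b)
  K-split {a} {b} ub na = begin
    K a                                                               ≈⟨ K-stationary a ⟩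
    Σ⟨ U ⟩ (λ u → 𝟙 (nonUnit? (val u - a * inv u)) C.* term a u)      ≈⟨ Σ-cong U (λ u → C.trans (C.*-congʳ
      (𝟙-square C (nonUnit? (val u - a * inv u)) ub
        (λ n → NonUnit-plus (trans (+-congʳ (quotient-square a u)) (identity u)) (NonUnit-*ˡ (val u) n) na)
        (λ n → NonUnit-cancelˡ (val-unit u) (NonUnit-minus (trans (identity′ u) (sym (quotient-square a u))) n na))))
      (C.distribʳ _ _ _)) ⟩
    Σ⟨ U ⟩ (λ u → 𝟙 (nonUnit? (val u - b)) C.* term a u C.+ 𝟙 (nonUnit? (val u - - b)) C.* term a u)
      ≈⟨ Σ-+ U _ _ ⟩
    part a b C.+ part a (- b)                                         ∎
    where
    identity : ∀ u → (val u * val u - a) + (a - b * b) ≈ (val u - b) * (val u + b)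
    identity u = RS.solve 3 (λ a b u → (u RS.:* u RS.:- a) RS.:+ (a RS.:- b RS.:* b) RS.:= (u RS.:- b) RS.:* (u RS.:+ b)) refl a b (val u)
    identity′ : ∀ u → (val u - b) * (val u + b) - (a - b * b) ≈ val u * val u - a
    identity′ u = RS.solve 3 (λ a b u → (u RS.:- b) RS.:* (u RS.:+ b) RS.:- (a RS.:- b RS.:* b) RS.:= u RS.:* u RS.:- a) refl a b (val u)

  -- The replacement adds s a/u to each exponent, and s only sees the residue class of a/u, which is
  -- that of b for every u in the part.
  part-socle : ∀ {a b s} → NonUnit (a - b * b) → Socle s → part ((1# + s) * a) b ≋ ψ (s * b) C.* part a b
  part-socle {a} {b} {s} na ss = C.trans (Σ-cong U (λ u → C.trans
    (𝟙*-cong (nonUnit? (val u - b)) (λ n → C.trans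
      (C.*-congˡ (C.trans (ψ-cong (exponent u n)) (ψ-+ _ _)))
      (CS.solve 3 (λ t p q → t CS.:* (p CS.:* q) CS.:= p CS.:* (t CS.:* q)) C.refl _ _ _)))
    (CS.solve 3 (λ i p t → i CS.:* (p CS.:* t) CS.:= p CS.:* (i CS.:* t)) C.refl _ _ _)))
    (Σ-*ˡ U _ _)
    where
    exponent : ∀ u → NonUnit (val u - b) → val u + ((1# + s) * a) * inv u ≈ s * b + (val u + a * inv u)
    exponent u n = trans
      (RS.solve 4 (λ s a u i → u RS.:+ ((RS.con (+ 1) RS.:+ s) RS.:* a) RS.:* i RS.:= s RS.:* (a RS.:* i) RS.:+ (u RS.:+ a RS.:* i)) refl s a (val u) (inv u))
      (+-congʳ (socle-cong ss (quotient≡root u na n)))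

  module Correlation {a b} (ub : IsUnit b) (na : NonUnit (a - b * b)) where
    q : Unit R → Unit R → Carrier
    q v w = a * (inv v * inv w)

    -- The sum over v that remains when terms at v w and v are multiplied with one conjugated: (v w
    -- + a/(v w)) - (v + a/v) factors as (w - 1)(v - a/(v w)).
    inner : Unit R → C.Carrier
    inner w = Σ⟨ U ⟩ (λ v → 𝟙 (nonUnit? (val v - b)) C.* ψ ((val w - 1#) * (val v - q v w)))

    q≡b : ∀ v w → NonUnit (val v - b) → NonUnit (val w - 1#) → NonUnit (q v w - b)
    q≡b v w nv nw = quotient≡root (v G.∙ w) na
      (NonUnit-plus (RS.solve 3 (λ v w b → v RS.:* (w RS.:- RS.con (+ 1)) RS.:+ (v RS.:- b) RS.:= v RS.:* w RS.:- b) refl (val v) (val w) b)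
        (NonUnit-*ˡ (val v) nw) nv)

    -- Both v and `q v w` are congruent to b, so w - 1 annihilates their difference and every term
    -- of the class is 1.
    inner-socle : ∀ w → Socle (val w - 1#) → inner w ≋ #nonUnits
    inner-socle w sw = C.trans
      (Σ-cong U (λ v → C.trans
        (𝟙*-cong (nonUnit? (val v - b)) (λ nv → ψ-≈0 (sw _ (NonUnit-minus
          (RS.solve 3 (λ v q b → (v RS.:- b) RS.:- (q RS.:- b) RS.:= v RS.:- q) refl (val v) (q v w) b)
          nv (q≡b v w nv (socle⇒nonUnit sw))))))
        (C.*-identityʳ _)))
      (count-residue ub)

    -- If (w - 1) t lies in the socle for a nonunit t, then v ↦ (1 + t) v multiplies the terms by
    -- ψ (2 b (w - 1) t), and every element of the socle is of the form 2 b (w - 1) t.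
    module Shift (w : Unit R) (nw : NonUnit (val w - 1#)) {z t} (nt : NonUnit t)
      (sx : Socle ((val w - 1#) * t)) (z≈ : z ≈ (b - - b) * ((val w - 1#) * t)) where
      x = (val w - 1#) * t
      1+t : IsUnit (1# + t)
      1+t = unit-+ (1# , *-identityˡ 1#) nt
      g : Unit R
      g = unit (1# + t) (proj₁ 1+t) (proj₂ 1+t)

      near : ∀ (v : Unit R) → NonUnit (val v - b) → NonUnit (val g * val v - b)
      near v nv = NonUnit-plus
        (RS.solve 3 (λ t v b → t RS.:* v RS.:+ (v RS.:- b) RS.:= (RS.con (+ 1) RS.:+ t) RS.:* v RS.:- b) refl t (val v) b)
        (NonUnit-*ʳ (val v) nt) nv

      near⁻ : ∀ (v : Unit R) → NonUnit (val g * val v - b) → NonUnit (val v - b)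
      near⁻ v n = NonUnit-minus
        (RS.solve 3 (λ t v b → ((RS.con (+ 1) RS.:+ t) RS.:* v RS.:- b) RS.:- t RS.:* v RS.:= v RS.:- b) refl t (val v) b)
        n (NonUnit-*ʳ (val v) nt)

      -- Expand 1/(1 + t) = 1 - t + t²/(1 + t) and multiply by w - 1. The remainder is x t/(1 + t),
      -- which vanishes since x lies in the socle.
      d*g⁻¹ : (val w - 1#) * inv g ≈ (val w - 1#) - x
      d*g⁻¹ = trans
        (RS.solve 3 (λ d t i → d RS.:* i RS.:= d RS.:* ((RS.con (+ 1) RS.:+ t) RS.:* i) RS.:- d RS.:* t RS.:* ((RS.con (+ 1) RS.:+ t) RS.:* i RS.:- t RS.:* i)) refl (val w - 1#) t (inv g))
        (+-cong (trans (*-congˡ (val*inv g)) (*-identityʳ _))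
            (-‿cong (trans (*-congˡ (+-congʳ (val*inv g)))
              (trans (RS.solve 2 (λ x s → x RS.:* (RS.con (+ 1) RS.:- s) RS.:= x RS.:- x RS.:* s) refl x (t * inv g))
                (trans (+-congˡ (-‿cong (sx _ (NonUnit-*ʳ (inv g) nt))))
                  (RS.solve 1 (λ x → x RS.:- RS.con (+ 0) RS.:= x) refl x))))))

      -- With d = w - 1 the new exponent is d (v - q) + x (v + q). Here v + q ≡ 2b, and x in the
      -- socle depends only on this residue, so the extra summand is z.
      exponent : ∀ (v : Unit R) → NonUnit (val v - b) →
        z + (val w - 1#) * (val v - q v w) ≈ (val w - 1#) * (val g * val v - q (g G.∙ v) w)
      exponent v nv = let d = val w - 1# in sym (trans
        (RS.solve 7 (λ d t v a i j g′ → d RS.:* ((RS.con (+ 1) RS.:+ t) RS.:* v RS.:- a RS.:* (g′ RS.:* i RS.:* j))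
          RS.:= d RS.:* v RS.:+ d RS.:* t RS.:* v RS.:- (d RS.:* g′) RS.:* (a RS.:* (i RS.:* j))) refl d t (val v) a (inv v) (inv w) (inv g))
        (trans (+-congˡ (-‿cong (*-congʳ d*g⁻¹)))
        (trans (RS.solve 4 (λ d x v q → d RS.:* v RS.:+ x RS.:* v RS.:- (d RS.:- x) RS.:* q RS.:= x RS.:* (v RS.:+ q) RS.:+ d RS.:* (v RS.:- q)) refl d x (val v) (q v w))
        (+-congʳ (trans
          (socle-cong sx (NonUnit-plus (RS.solve 3 (λ v q b → (v RS.:- b) RS.:+ (q RS.:- b) RS.:= (v RS.:+ q) RS.:- (b RS.:- RS.:- b)) refl (val v) (q v w) b)
            nv (q≡b v w nv nw)))
          (trans (*-comm _ _) (sym z≈)))))))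

      summand : Unit R → C.Carrier
      summand v = 𝟙 (nonUnit? (val v - b)) C.* ψ ((val w - 1#) * (val v - q v w))

      summand-cong : ∀ {u v : Unit R} → val u ≈ val v → summand u ≋ summand v
      summand-cong {u} {v} eq = C.*-cong
        (𝟙-cong (nonUnit? (val u - b)) (nonUnit? (val v - b)) (NonUnit-resp (+-congʳ eq)) (NonUnit-resp (+-congʳ (sym eq))))
        (ψ-cong (*-congˡ (+-cong eq (-‿cong (*-congˡ (*-congʳ (G.⁻¹-cong {u} {v} eq)))))))

      shift : ψ z C.* inner w ≋ inner w
      shift = begin
        ψ z C.* inner w                         ≈⟨ Σ-*ˡ U _ _ ⟨
        Σ⟨ U ⟩ (λ v → ψ z C.* summand v)        ≈⟨ Σ-cong U (λ v → C.trans
          (CS.solve 3 (λ p i s → p CS.:* (i CS.:* s) CS.:= i CS.:* (p CS.:* s)) C.refl _ _ _)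
          (C.trans (𝟙*-cong (nonUnit? (val v - b)) (λ nv → C.trans (C.sym (ψ-+ _ _)) (ψ-cong (exponent v nv))))
            (C.*-congʳ (𝟙-cong (nonUnit? (val v - b)) (nonUnit? (val g * val v - b)) (near v) (near⁻ v))))) ⟩
        Σ⟨ U ⟩ (λ v → summand (g G.∙ v))        ≈⟨ Σ-translate (unitGroup R) U summand (λ {u} {v} → summand-cong {u} {v}) g ⟨
        inner w                                 ∎

    inner-vanish : ∀ w → NonUnit (val w - 1#) → ¬ Socle (val w - 1#) → inner w ≋ C.0#
    inner-vanish w nw ¬sw with socle? (val w - 1#)
    ... | inj₁ sw = contradiction sw ¬sw
    ... | inj₂ (t₀ , nt₀ , dt₀≉0) = let s₀ , ss₀ , s₀≉0 = socle≉0 ; h , 2bh≈1 = double-unit ub in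
      vanish socle {s₀} ss₀ s₀≉0 λ z sz →
        -- The equation 2 b (w - 1) t = z is solved as follows: z/(2b) lies in the socle, hence is a
        -- multiple r of the nonzero element (w - 1) t₀, and t = t₀ r is again a nonunit.
        let r , hz≈dt₀r = socle⊆multiples dt₀≉0 (Ideal.*∈ socle h sz)
            hz≈dt = trans hz≈dt₀r (*-assoc (val w - 1#) t₀ r)
        in Shift.shift w nw {z} {t₀ * r} (NonUnit-*ʳ r nt₀) (Socle-resp hz≈dt (Ideal.*∈ socle h sz))
          (trans (trans (sym (*-identityˡ z)) (trans (*-congʳ (sym 2bh≈1)) (*-assoc _ h z))) (*-congˡ hz≈dt))

  module _ {a b} (ub : IsUnit b) (na : NonUnit (a - b * b)) where
    open Correlation ub na

    -- Triviality of τ on 1 + S enters here: it removes the twist from exactly those w whose inner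
    -- sum survives.
    correlation : Σ⟨ U ⟩ (λ w → 𝟙 (nonUnit? (val w - 1#)) C.* (τ w C.* inner w)) ≋ N
    correlation = begin
      Σ⟨ U ⟩ (λ w → 𝟙 (nonUnit? (val w - 1#)) C.* (τ w C.* inner w))  ≈⟨ Σ-cong U by-socle ⟩
      Σ⟨ U ⟩ (λ w → #nonUnits C.* 𝟙 (inSocle? (val w - 1#)))          ≈⟨ Σ-*ˡ U _ _ ⟩
      #nonUnits C.* Σ⟨ U ⟩ (λ w → 𝟙 (inSocle? (val w - 1#)))          ≈⟨ C.*-congˡ count-1+socle ⟩
      #nonUnits C.* #socle                                            ≈⟨ #nonUnits*#socle≈N ⟩
      N                                                               ∎
      where
      by-socle : ∀ w → 𝟙 (nonUnit? (val w - 1#)) C.* (τ w C.* inner w) ≋ #nonUnits C.* 𝟙 (inSocle? (val w - 1#))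
      by-socle w = go (inSocle? (val w - 1#)) (nonUnit? (val w - 1#))
        where
        go : (s? : Dec (Socle (val w - 1#))) (n? : Dec (NonUnit (val w - 1#))) →
             𝟙 n? C.* (τ w C.* inner w) ≋ #nonUnits C.* 𝟙 s?
        go (yes s) n? = C.trans (C.*-cong (𝟙-yes n? (socle⇒nonUnit s)) (C.*-cong (τ-socle w s) (inner-socle w s)))
          (CS.solve 1 (λ n → CS.con (+ 1) CS.:* (CS.con (+ 1) CS.:* n) CS.:= n CS.:* CS.con (+ 1)) C.refl #nonUnits)
        go (no ¬s) (yes n) = C.trans (C.*-congˡ (C.trans (C.*-congˡ (inner-vanish w n ¬s)) (C.zeroʳ _)))
          (C.trans (C.zeroʳ _) (C.sym (C.zeroʳ _)))
        go (no ¬s) (no _)  = C.trans (C.zeroˡ _) (C.sym (C.zeroʳ _))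

-- The fourth moment for a pair of mutually inverse characters.

module FourthMoment {c ℓ d e} (R : CommutativeRing c ℓ) (F : Finite (CommutativeRing.setoid R))
  (local : FiniteRing.IsOddLocal R F)
  (C : CommutativeRing d e) (isDomain : IsCharacteristicZeroDomain C)
  (χ χ̄ : PrimitiveCharacter R C) (σ σ̄ : SocleTrivialCharacter R F C) where
  open CommutativeRing R hiding (zero)
  open FiniteSetoid (unitsFinite R F) using (any?)
  open FiniteRing R F
  open IsOddLocal local
  open IsCharacteristicZeroDomain isDomain
  open OddLocal R F local
  open Sums C
  open Counting R F C isDomain
  open UnitCounting R F local C isDomain
  open Orthogonality R F local C isDomain χ using (vanish; socle≉0; #nonUnits≉0)
  open PrimitiveCharacter χ using (ψ; ψ-cong; ψ-+)
  open PrimitiveCharacter χ̄ using () renaming (ψ to ψ̄)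
  open SocleTrivialCharacter σ using (τ; τ-∙)
  open SocleTrivialCharacter σ̄ using () renaming (τ to τ̄)
  open KloostermanSum R F local C isDomain χ σ
  -- The conjugate sum is built from a second pair of characters, so every lemma on `K` applies to
  -- it; the assumption that the two pairs are inverse follows where their products are first
  -- formed.
  module Conjugate = KloostermanSum R F local C isDomain χ̄ σ̄
  open Conjugate using () renaming (K to K̄; part to part̄; term to term̄)
  open Unit
  private
    module C  = CommutativeRing C
    module RS = IntegerSolver R
    module CS = IntegerSolver C
    module G  = AbelianGroup (unitGroup R)
  open SetoidReasoning C.setoid
  open SemiringMult C.semiring using (×1-homo-*) renaming (_×_ to _·_)

  -- The substitution a ↦ (1 + s) a multiplies the sum by ψ (s g), and s g runs over the socle.
  Σ-twisted : ∀ {b g} (X : Carrier → C.Carrier) → (∀ {a a′} → a ≈ a′ → X a ≋ X a′) → IsUnit g →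
              (∀ {a s} → NonUnit (a - b * b) → Socle s → X ((1# + s) * a) ≋ ψ (s * g) C.* X a) →
              Σ⟨ U ⟩ (λ a → 𝟙 (nonUnit? (val a - b * b)) C.* X (val a)) ≋ C.0#
  Σ-twisted {b} {g} X X-cong (h , gh≈1) twist = let s₀ , ss₀ , s₀≉0 = socle≉0 in
    vanish socle {s₀} ss₀ s₀≉0 λ z sz →
      let s  = h * z
          ss : Socle s
          ss = Ideal.*∈ socle h sz
          sg≈z : s * g ≈ z
          sg≈z = trans (RS.solve 3 (λ h z g → (h RS.:* z) RS.:* g RS.:= (g RS.:* h) RS.:* z) refl h z g)
                   (trans (*-congʳ gh≈1) (*-identityˡ z))
          move : ∀ a → (a - b * b) + s * a ≈ (1# + s) * a - b * b
          move a = RS.solve 3 (λ a b s → (a RS.:- b RS.:* b) RS.:+ s RS.:* a RS.:= (RS.con (+ 1) RS.:+ s) RS.:* a RS.:- b RS.:* b) refl a b s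
          move⁻ : ∀ a → ((1# + s) * a - b * b) - s * a ≈ a - b * b
          move⁻ a = RS.solve 3 (λ a b s → ((RS.con (+ 1) RS.:+ s) RS.:* a RS.:- b RS.:* b) RS.:- s RS.:* a RS.:= a RS.:- b RS.:* b) refl a b s
          sa : ∀ a → NonUnit (s * a)
          sa a = NonUnit-*ʳ a (socle⇒nonUnit ss)
      in begin
      ψ z C.* Σ⟨ U ⟩ (λ a → 𝟙 (nonUnit? (val a - b * b)) C.* X (val a))     ≈⟨ Σ-*ˡ U _ _ ⟨
      Σ⟨ U ⟩ (λ a → ψ z C.* (𝟙 (nonUnit? (val a - b * b)) C.* X (val a)))   ≈⟨ Σ-cong U (λ a → C.trans
        (CS.solve 3 (λ p i s → p CS.:* (i CS.:* s) CS.:= i CS.:* (p CS.:* s)) C.refl _ _ _)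
        (C.trans
          (𝟙*-cong (nonUnit? (val a - b * b)) (λ na →
            C.trans (C.*-congʳ (ψ-cong (sym sg≈z))) (C.sym (twist na ss))))
          (C.*-congʳ (𝟙-cong (nonUnit? (val a - b * b)) (nonUnit? ((1# + s) * val a - b * b))
            (λ n → NonUnit-plus (move (val a)) n (sa (val a))) (λ n → NonUnit-minus (move⁻ (val a)) n (sa (val a))))))) ⟩
      Σ⟨ U ⟩ (λ a → 𝟙 (nonUnit? ((1# + s) * val a - b * b)) C.* X ((1# + s) * val a))
        ≈⟨ Σ-translate (unitGroup R) U (λ a → 𝟙 (nonUnit? (val a - b * b)) C.* X (val a))
             (λ {u} {v} p → C.*-cong (𝟙-cong (nonUnit? (val u - b * b)) (nonUnit? (val v - b * b))
                               (NonUnit-resp (+-congʳ p)) (NonUnit-resp (+-congʳ (sym p)))) (X-cong p)) (socleUnit ss) ⟨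
      Σ⟨ U ⟩ (λ a → 𝟙 (nonUnit? (val a - b * b)) C.* X (val a))             ∎

  #units : C.Carrier
  #units = Σ⟨ U ⟩ (λ _ → C.1#)

  fourth : Carrier → C.Carrier
  fourth a = (K a C.* K̄ a) C.* (K a C.* K̄ a)

  module _ (ψψ̄≈1 : ∀ x → ψ x C.* ψ̄ x ≋ C.1#) (ττ̄≈1 : ∀ u → τ u C.* τ̄ u ≋ C.1#) where

    ψ*ψ̄ : ∀ x y → ψ x C.* ψ̄ y ≋ ψ (x - y)
    ψ*ψ̄ x y = begin
      ψ x C.* ψ̄ y                       ≈⟨ C.*-congʳ (ψ-cong (RS.solve 2 (λ x y → x RS.:= (x RS.:- y) RS.:+ y) refl x y)) ⟩
      ψ ((x - y) + y) C.* ψ̄ y           ≈⟨ C.*-congʳ (ψ-+ _ _) ⟩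
      ψ (x - y) C.* ψ y C.* ψ̄ y         ≈⟨ C.*-assoc _ _ _ ⟩
      ψ (x - y) C.* (ψ y C.* ψ̄ y)       ≈⟨ C.*-congˡ (ψψ̄≈1 y) ⟩
      ψ (x - y) C.* C.1#                ≈⟨ C.*-identityʳ _ ⟩
      ψ (x - y)                         ∎

    part-norm : ∀ {a b} → IsUnit b → NonUnit (a - b * b) → part a b C.* part̄ a b ≋ N
    part-norm {a} {b} ub na = begin
      part a b C.* part̄ a b                                             ≈⟨ Σ-*ʳ U _ _ ⟨
      Σ⟨ U ⟩ (λ u → f u C.* part̄ a b)                                   ≈⟨ Σ-cong U (λ u → C.sym (Σ-*ˡ U _ _)) ⟩
      Σ⟨ U ⟩ (λ u → Σ⟨ U ⟩ (λ v → f u C.* f̄ v))                         ≈⟨ Σ-swap U U _ ⟩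
      -- For fixed v the substitution u = v w makes the ratio w the new variable.
      Σ⟨ U ⟩ (λ v → Σ⟨ U ⟩ (λ u → f u C.* f̄ v))                         ≈⟨ Σ-cong U (λ v → Σ-translate (unitGroup R) U _
                                                                            (λ {u} {u′} p → C.*-congʳ (f-cong {u} {u′} p)) v) ⟩
      Σ⟨ U ⟩ (λ v → Σ⟨ U ⟩ (λ w → f (v G.∙ w) C.* f̄ v))                 ≈⟨ Σ-cong U (λ v → Σ-cong U (λ w → rearrange v w)) ⟩
      Σ⟨ U ⟩ (λ v → Σ⟨ U ⟩ (λ w → 𝟙 (nonUnit? (val w - 1#)) C.* (τ w C.* h v w)))  ≈⟨ Σ-swap U U _ ⟩
      Σ⟨ U ⟩ (λ w → Σ⟨ U ⟩ (λ v → 𝟙 (nonUnit? (val w - 1#)) C.* (τ w C.* h v w)))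
        ≈⟨ Σ-cong U (λ w → C.trans (Σ-*ˡ U _ _) (C.*-congˡ (Σ-*ˡ U _ _))) ⟩
      Σ⟨ U ⟩ (λ w → 𝟙 (nonUnit? (val w - 1#)) C.* (τ w C.* inner w))    ≈⟨ correlation ub na ⟩
      N                                                                 ∎
      where
      open Correlation ub na using (q; inner)
      f f̄ : Unit R → C.Carrier
      f u = 𝟙 (nonUnit? (val u - b)) C.* term a u
      f̄ v = 𝟙 (nonUnit? (val v - b)) C.* term̄ a v
      h : Unit R → Unit R → C.Carrier
      h v w = 𝟙 (nonUnit? (val v - b)) C.* ψ ((val w - 1#) * (val v - q v w))

      f-cong : ∀ {u v : Unit R} → val u ≈ val v → f u ≋ f v
      f-cong {u} {v} p = C.*-cong
        (𝟙-cong (nonUnit? (val u - b)) (nonUnit? (val v - b)) (NonUnit-resp (+-congʳ p)) (NonUnit-resp (+-congʳ (sym p))))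
        (term-cong refl {u} {v} p)

      terms : ∀ v w → term a (v G.∙ w) C.* term̄ a v ≋ τ w C.* ψ ((val w - 1#) * (val v - q v w))
      terms v w = begin
        (τ (v G.∙ w) C.* ψ (val v * val w + q v w)) C.* (τ̄ v C.* ψ̄ (val v + a * inv v))
          ≈⟨ C.*-congʳ (C.*-congʳ (τ-∙ v w)) ⟩
        (τ v C.* τ w C.* ψ (val v * val w + q v w)) C.* (τ̄ v C.* ψ̄ (val v + a * inv v))
          ≈⟨ CS.solve 5 (λ p q r s t → (p CS.:* q CS.:* r) CS.:* (s CS.:* t) CS.:= (p CS.:* s) CS.:* (q CS.:* (r CS.:* t))) C.refl _ _ _ _ _ ⟩
        (τ v C.* τ̄ v) C.* (τ w C.* (ψ (val v * val w + q v w) C.* ψ̄ (val v + a * inv v)))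
          ≈⟨ C.trans (C.*-congʳ (ττ̄≈1 v)) (C.trans (C.*-identityˡ _) (C.*-congˡ (ψ*ψ̄ _ _))) ⟩
        τ w C.* ψ ((val v * val w + q v w) - (val v + a * inv v))
          ≈⟨ C.*-congˡ (ψ-cong exponent) ⟩
        τ w C.* ψ ((val w - 1#) * (val v - q v w)) ∎
        where
        exponent : (val v * val w + q v w) - (val v + a * inv v) ≈ (val w - 1#) * (val v - q v w)
        exponent = trans
          (+-congˡ (-‿cong (+-congˡ (trans (sym (*-identityʳ _)) (*-congˡ (sym (val*inv w)))))))
          (RS.solve 5 (λ v w a i j → (v RS.:* w RS.:+ a RS.:* (i RS.:* j)) RS.:- (v RS.:+ a RS.:* i RS.:* (w RS.:* j))
            RS.:= (w RS.:- RS.con (+ 1)) RS.:* (v RS.:- a RS.:* (i RS.:* j))) refl (val v) (val w) a (inv v) (inv w))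

      rearrange : ∀ v w → f (v G.∙ w) C.* f̄ v ≋ 𝟙 (nonUnit? (val w - 1#)) C.* (τ w C.* h v w)
      rearrange v w = begin
        (𝟙 (nonUnit? (val v * val w - b)) C.* term a (v G.∙ w)) C.* (𝟙 (nonUnit? (val v - b)) C.* term̄ a v)
          ≈⟨ CS.solve 4 (λ i s j t → (i CS.:* s) CS.:* (j CS.:* t) CS.:= j CS.:* (i CS.:* (s CS.:* t))) C.refl _ _ _ _ ⟩
        𝟙 (nonUnit? (val v - b)) C.* (𝟙 (nonUnit? (val v * val w - b)) C.* (term a (v G.∙ w) C.* term̄ a v))
          ≈⟨ 𝟙*-cong (nonUnit? (val v - b)) (λ nv → C.*-cong
               (𝟙-cong (nonUnit? (val v * val w - b)) (nonUnit? (val w - 1#))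
                 (λ n → NonUnit-cancelˡ (val-unit v) (NonUnit-minus
                   (RS.solve 3 (λ v w b → (v RS.:* w RS.:- b) RS.:- (v RS.:- b) RS.:= v RS.:* (w RS.:- RS.con (+ 1))) refl (val v) (val w) b) n nv))
                 (λ n → NonUnit-plus
                   (RS.solve 3 (λ v w b → v RS.:* (w RS.:- RS.con (+ 1)) RS.:+ (v RS.:- b) RS.:= v RS.:* w RS.:- b) refl (val v) (val w) b)
                   (NonUnit-*ˡ (val v) n) nv))
               (terms v w)) ⟩
        𝟙 (nonUnit? (val v - b)) C.* (𝟙 (nonUnit? (val w - 1#)) C.* (τ w C.* ψ ((val w - 1#) * (val v - q v w))))
          ≈⟨ CS.solve 4 (λ i j t p → i CS.:* (j CS.:* (t CS.:* p)) CS.:= j CS.:* (t CS.:* (i CS.:* p))) C.refl _ _ _ _ ⟩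
        𝟙 (nonUnit? (val w - 1#)) C.* (τ w C.* h v w) ∎

    -- With roots b and -b this is P; with the roots exchanged it plays the role of P̄. Free
    -- arguments let the same lemmas serve both.
    cross : Carrier → Carrier → Carrier → C.Carrier
    cross a b b′ = part a b C.* part̄ a b′

    cross-cong : ∀ b b′ {a a′} → a ≈ a′ → cross a b b′ ≋ cross a′ b b′
    cross-cong b b′ p = C.*-cong (part-cong b p) (Conjugate.part-cong b′ p)

    cross-socle : ∀ {a b b′ s} → b * b ≈ b′ * b′ → NonUnit (a - b * b) → Socle s →
                  cross ((1# + s) * a) b b′ ≋ ψ (s * (b - b′)) C.* cross a b b′
    cross-socle {a} {b} {b′} {s} b²≈b′² na ss = begin
      cross ((1# + s) * a) b b′
        ≈⟨ C.*-cong (part-socle na ss) (Conjugate.part-socle (NonUnit-sub-cong refl b²≈b′² na) ss) ⟩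
      (ψ (s * b) C.* part a b) C.* (ψ̄ (s * b′) C.* part̄ a b′)
        ≈⟨ CS.solve 4 (λ p x q y → (p CS.:* x) CS.:* (q CS.:* y) CS.:= (p CS.:* q) CS.:* (x CS.:* y)) C.refl _ _ _ _ ⟩
      (ψ (s * b) C.* ψ̄ (s * b′)) C.* cross a b b′
        ≈⟨ C.*-congʳ (C.trans (ψ*ψ̄ _ _) (ψ-cong (RS.solve 3 (λ s b b′ → s RS.:* b RS.:- s RS.:* b′ RS.:= s RS.:* (b RS.:- b′)) refl s b b′))) ⟩
      ψ (s * (b - b′)) C.* cross a b b′ ∎

    Σ-cross : ∀ {b b′} → b * b ≈ b′ * b′ → IsUnit (b - b′) →
              Σ⟨ U ⟩ (λ a → 𝟙 (nonUnit? (val a - b * b)) C.* cross (val a) b b′) ≋ C.0#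
    Σ-cross {b} {b′} b²≈b′² ug = Σ-twisted (λ a → cross a b b′) (cross-cong b b′) ug (cross-socle b²≈b′²)

    -- Squaring doubles the frequency b - b′, which remains a unit because 2 is one.
    Σ-cross² : ∀ {b b′} → b * b ≈ b′ * b′ → IsUnit (b - b′) →
               Σ⟨ U ⟩ (λ a → 𝟙 (nonUnit? (val a - b * b)) C.* (cross (val a) b b′ C.* cross (val a) b b′)) ≋ C.0#
    Σ-cross² {b} {b′} b²≈b′² ug = Σ-twisted (λ a → cross a b b′ C.* cross a b b′)
      (λ p → C.*-cong (cross-cong b b′ p) (cross-cong b b′ p)) (IsUnit-* 2-unit ug)
      λ {a} {s} na ss → C.trans (C.*-cong (cross-socle b²≈b′² na ss) (cross-socle b²≈b′² na ss))
        (C.trans (CS.solve 2 (λ p x → (p CS.:* x) CS.:* (p CS.:* x) CS.:= (p CS.:* p) CS.:* (x CS.:* x)) C.refl _ _)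
          (C.*-congʳ (C.trans (C.sym (ψ-+ _ _)) (ψ-cong
            (RS.solve 2 (λ s g → s RS.:* g RS.:+ s RS.:* g RS.:= s RS.:* ((RS.con (+ 1) RS.:+ RS.con (+ 1)) RS.:* g)) refl s (b - b′))))))

    private
      4ᶜ 6ᶜ : C.Carrier
      4ᶜ = (C.1# C.+ C.1#) C.+ (C.1# C.+ C.1#)
      6ᶜ = 4ᶜ C.+ (C.1# C.+ C.1#)

    -- Regrouping x y as (A Ā)(B B̄) turns the mixed product into N², so all that still depends on a
    -- is linear in x + y or in x² + y².
    fourth-expand : ∀ {a b} → IsUnit b → NonUnit (a - b * b) →
      let x = cross a b (- b) ; y = cross a (- b) b in
      fourth a ≋ 6ᶜ C.* (N C.* N) C.+ ((4ᶜ C.* N) C.* (x C.+ y) C.+ (x C.* x C.+ y C.* y))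
    fourth-expand {a} {b} ub na = begin
      fourth a
        ≈⟨ C.*-cong KK̄ KK̄ ⟩
      ((A C.+ B) C.* (Ā C.+ B̄)) C.* ((A C.+ B) C.* (Ā C.+ B̄))
        ≈⟨ CS.solve 4 (λ A B Ā B̄ → let n = A CS.:* Ā ; m = B CS.:* B̄ ; x = A CS.:* B̄ ; y = B CS.:* Ā in
             ((A CS.:+ B) CS.:* (Ā CS.:+ B̄)) CS.:* ((A CS.:+ B) CS.:* (Ā CS.:+ B̄)) CS.:=
             (n CS.:+ m) CS.:* (n CS.:+ m) CS.:+ CS.con (+ 2) CS.:* (n CS.:* m)
               CS.:+ (CS.con (+ 2) CS.:* (n CS.:+ m) CS.:* (x CS.:+ y) CS.:+ (x CS.:* x CS.:+ y CS.:* y))) C.refl A B Ā B̄ ⟩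
      (A C.* Ā C.+ B C.* B̄) C.* (A C.* Ā C.+ B C.* B̄) C.+ two C.* ((A C.* Ā) C.* (B C.* B̄))
        C.+ (two C.* (A C.* Ā C.+ B C.* B̄) C.* (x C.+ y) C.+ (x C.* x C.+ y C.* y))
        ≈⟨ C.+-cong (C.+-cong (C.*-cong norms norms) (C.*-congˡ (C.*-cong norm norm⁻))) (C.+-congʳ (C.*-congʳ (C.*-congˡ norms))) ⟩
      (N C.+ N) C.* (N C.+ N) C.+ two C.* (N C.* N) C.+ (two C.* (N C.+ N) C.* (x C.+ y) C.+ (x C.* x C.+ y C.* y))
        ≈⟨ CS.solve 3 (λ N x y → let 1ₛ = CS.con (+ 1) ; 4ₛ = (1ₛ CS.:+ 1ₛ) CS.:+ (1ₛ CS.:+ 1ₛ) ; 6ₛ = 4ₛ CS.:+ (1ₛ CS.:+ 1ₛ) in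
             (N CS.:+ N) CS.:* (N CS.:+ N) CS.:+ CS.con (+ 2) CS.:* (N CS.:* N)
               CS.:+ (CS.con (+ 2) CS.:* (N CS.:+ N) CS.:* (x CS.:+ y) CS.:+ (x CS.:* x CS.:+ y CS.:* y)) CS.:=
             6ₛ CS.:* (N CS.:* N) CS.:+ ((4ₛ CS.:* N) CS.:* (x CS.:+ y) CS.:+ (x CS.:* x CS.:+ y CS.:* y))) C.refl N x y ⟩
      6ᶜ C.* (N C.* N) C.+ ((4ᶜ C.* N) C.* (x C.+ y) C.+ (x C.* x C.+ y C.* y)) ∎
      where
      A B Ā B̄ x y two : C.Carrier
      A = part a b
      B = part a (- b)
      Ā = part̄ a b
      B̄ = part̄ a (- b)
      x = A C.* B̄
      y = B C.* Ā
      two = C.1# C.+ C.1#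
      KK̄ : K a C.* K̄ a ≋ (A C.+ B) C.* (Ā C.+ B̄)
      KK̄ = C.*-cong (K-split ub na) (Conjugate.K-split ub na)
      norm : A C.* Ā ≋ N
      norm = part-norm ub na
      norm⁻ : B C.* B̄ ≋ N
      norm⁻ = part-norm (IsUnit-neg ub) (NonUnit-sub-cong refl (RS.solve 1 (λ b → b RS.:* b RS.:= RS.:- b RS.:* RS.:- b) refl b) na)
      norms : A C.* Ā C.+ B C.* B̄ ≋ N C.+ N
      norms = C.+-cong norm norm⁻

    Σ-near-square : ∀ {b} → IsUnit b →
      Σ⟨ U ⟩ (λ a → 𝟙 (nonUnit? (val a - b * b)) C.* fourth (val a)) ≋ (6ᶜ C.* (N C.* N)) C.* #nonUnits
    Σ-near-square {b} ub = begin
      Σ⟨ U ⟩ (λ a → 𝟙 (near a) C.* fourth (val a))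
        ≈⟨ Σ-cong U (λ a → C.trans (𝟙*-cong (near a) (fourth-expand ub))
             (CS.solve 5 (λ i s t x y → i CS.:* (s CS.:+ (t CS.:* (x CS.:+ y) CS.:+ (x CS.:* x CS.:+ y CS.:* y)))
               CS.:= s CS.:* i CS.:+ (t CS.:* (i CS.:* x CS.:+ i CS.:* y) CS.:+ (i CS.:* (x CS.:* x) CS.:+ i CS.:* (y CS.:* y)))) C.refl _ _ _ _ _)) ⟩
      Σ⟨ U ⟩ (λ a → S C.* 𝟙 (near a) C.+ (T C.* (X a C.+ Y a) C.+ (X² a C.+ Y² a)))
        ≈⟨ C.trans (Σ-+ U _ _) (C.+-cong (Σ-*ˡ U _ _) (C.trans (Σ-+ U _ _) (C.+-cong
             (C.trans (Σ-*ˡ U _ _) (C.*-congˡ (Σ-+ U _ _))) (Σ-+ U _ _)))) ⟩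
      S C.* Σ⟨ U ⟩ (λ a → 𝟙 (near a)) C.+ (T C.* (Σ⟨ U ⟩ X C.+ Σ⟨ U ⟩ Y) C.+ (Σ⟨ U ⟩ X² C.+ Σ⟨ U ⟩ Y²))
        ≈⟨ C.+-cong (C.*-congˡ (count-residue (IsUnit-* ub ub))) (C.+-cong
             (C.*-congˡ (C.+-cong (Σ-cross b²≈ (double-unit ub)) (from-neg Y (λ a → cross (val a) (- b) b) (λ _ → C.refl) (Σ-cross (sym b²≈) -2b-unit))))
             (C.+-cong (Σ-cross² b²≈ (double-unit ub)) (from-neg Y² (λ a → cross (val a) (- b) b C.* cross (val a) (- b) b) (λ _ → C.refl) (Σ-cross² (sym b²≈) -2b-unit)))) ⟩
      S C.* #nonUnits C.+ (T C.* (C.0# C.+ C.0#) C.+ (C.0# C.+ C.0#))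
        ≈⟨ CS.solve 3 (λ S n T → let z = CS.con (+ 0) in S CS.:* n CS.:+ (T CS.:* (z CS.:+ z) CS.:+ (z CS.:+ z)) CS.:= S CS.:* n) C.refl S #nonUnits T ⟩
      S C.* #nonUnits ∎
      where
      near : ∀ (a : Unit R) → Dec (NonUnit (val a - b * b))
      near a = nonUnit? (val a - b * b)
      S T : C.Carrier
      S = 6ᶜ C.* (N C.* N)
      T = 4ᶜ C.* N
      X Y X² Y² : Unit R → C.Carrier
      X a = 𝟙 (near a) C.* cross (val a) b (- b)
      Y a = 𝟙 (near a) C.* cross (val a) (- b) b
      X² a = 𝟙 (near a) C.* (cross (val a) b (- b) C.* cross (val a) b (- b))
      Y² a = 𝟙 (near a) C.* (cross (val a) (- b) b C.* cross (val a) (- b) b)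
      b²≈ : b * b ≈ - b * - b
      b²≈ = RS.solve 1 (λ b → b RS.:* b RS.:= RS.:- b RS.:* RS.:- b) refl b
      -2b-unit : IsUnit (- b - b)
      -2b-unit = IsUnit-resp (RS.solve 1 (λ b → RS.:- (b RS.:- RS.:- b) RS.:= RS.:- b RS.:- b) refl b) (IsUnit-neg (double-unit ub))
      from-neg : ∀ (f g : Unit R → C.Carrier) → (∀ a → f a ≋ 𝟙 (near a) C.* g a) →
                 Σ⟨ U ⟩ (λ a → 𝟙 (nonUnit? (val a - - b * - b)) C.* g a) ≋ C.0# → Σ⟨ U ⟩ f ≋ C.0#
      from-neg f g f≋ eq = C.trans (Σ-cong U (λ a → C.trans (f≋ a) (C.*-congʳ
        (𝟙-cong (near a) (nonUnit? (val a - - b * - b)) (NonUnit-sub-cong refl b²≈) (NonUnit-sub-cong refl (sym b²≈)))))) eq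

    -- Every a with K a ≉ 0 is congruent to b² for exactly 2 |M| units b.
    roots-weight : ∀ (a : Unit R) → fourth (val a) C.* Σ⟨ U ⟩ (λ b → 𝟙 (nonUnit? (val a - val b * val b)))
                         ≋ (#nonUnits C.+ #nonUnits) C.* fourth (val a)
    roots-weight a with any? {P = λ (b : Unit R) → NonUnit (val a - val b * val b)}
                          (λ p → NonUnit-sub-cong refl (*-cong p p)) (λ b → nonUnit? (val a - val b * val b))
    ... | yes (b , na) = C.trans (C.*-congˡ (count-roots (val-unit b) na)) (C.*-comm _ _)
    ... | no ¬root     = C.trans (C.*-congʳ fourth≈0) (C.trans (C.zeroˡ _) (C.sym (C.trans (C.*-congˡ fourth≈0) (C.zeroʳ _))))
      where
      fourth≈0 : fourth (val a) ≋ C.0#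
      fourth≈0 = C.trans (C.*-congʳ (C.trans (C.*-congʳ (K-nonresidue (val a) (λ u n → ¬root (u , n)))) (C.zeroˡ _))) (C.zeroˡ _)

    -- Origin of the 3: pairs (a, b) with a ≡ b² give 6 |R|² |M| for each unit b, while each
    -- contributing a is counted 2 |M| times.
    fourthMoment-#units : Σ⟨ U ⟩ (λ a → fourth (val a)) ≋ (C.1# C.+ C.1# C.+ C.1#) C.* #units C.* (N C.* N)
    fourthMoment-#units = cancel (begin
      (#nonUnits C.+ #nonUnits) C.* Σ⟨ U ⟩ (λ a → fourth (val a))                     ≈⟨ Σ-*ˡ U _ _ ⟨
      Σ⟨ U ⟩ (λ a → (#nonUnits C.+ #nonUnits) C.* fourth (val a))                     ≈⟨ Σ-cong U (λ a → C.sym (roots-weight a)) ⟩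
      Σ⟨ U ⟩ (λ a → fourth (val a) C.* Σ⟨ U ⟩ (λ b → 𝟙 (nonUnit? (val a - val b * val b))))
        ≈⟨ Σ-cong U (λ a → C.trans (C.sym (Σ-*ˡ U _ _)) (Σ-cong U (λ b → C.*-comm _ _))) ⟩
      Σ⟨ U ⟩ (λ a → Σ⟨ U ⟩ (λ b → 𝟙 (nonUnit? (val a - val b * val b)) C.* fourth (val a)))   ≈⟨ Σ-swap U U _ ⟩
      Σ⟨ U ⟩ (λ b → Σ⟨ U ⟩ (λ a → 𝟙 (nonUnit? (val a - val b * val b)) C.* fourth (val a)))   ≈⟨ Σ-cong U (λ b → C.trans
        (Σ-near-square (val-unit b)) (C.sym (C.*-identityʳ _))) ⟩
      Σ⟨ U ⟩ (λ b → ((6ᶜ C.* (N C.* N)) C.* #nonUnits) C.* C.1#)                      ≈⟨ Σ-*ˡ U _ _ ⟩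
      ((6ᶜ C.* (N C.* N)) C.* #nonUnits) C.* #units
        ≈⟨ CS.solve 3 (λ N n u → let 1ₛ = CS.con (+ 1) ; 4ₛ = (1ₛ CS.:+ 1ₛ) CS.:+ (1ₛ CS.:+ 1ₛ) ; 6ₛ = 4ₛ CS.:+ (1ₛ CS.:+ 1ₛ) in
             ((6ₛ CS.:* (N CS.:* N)) CS.:* n) CS.:* u CS.:= (n CS.:+ n) CS.:* ((1ₛ CS.:+ 1ₛ CS.:+ 1ₛ) CS.:* u CS.:* (N CS.:* N))) C.refl N #nonUnits #units ⟩
      (#nonUnits C.+ #nonUnits) C.* ((C.1# C.+ C.1# C.+ C.1#) C.* #units C.* (N C.* N)) ∎)
      where
      double≉0 : ∀ {n} → ¬ (n ≋ C.0#) → ¬ (n C.+ n ≋ C.0#)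
      double≉0 {n} n≉0 eq = suc·1≉0 1 (domain
        (C.trans (CS.solve 1 (λ n → n CS.:* (CS.con (+ 1) CS.:+ (CS.con (+ 1) CS.:+ CS.con (+ 0))) CS.:= n CS.:+ n) C.refl n) eq) n≉0)
      cancel : ∀ {X Y} → (#nonUnits C.+ #nonUnits) C.* X ≋ (#nonUnits C.+ #nonUnits) C.* Y → X ≋ Y
      cancel = *-cancelˡ (double≉0 #nonUnits≉0)

    fourthMoment : Σ⟨ U ⟩ (λ a → fourth (val a)) ≋ (3 ℕ.* card U ℕ.* card F ℕ.^ 2) · C.1#
    fourthMoment = C.trans fourthMoment-#units (C.sym (C.trans (×1-homo-* (3 ℕ.* card U) (card F ℕ.^ 2)) (C.*-cong
      (C.trans (×1-homo-* 3 (card U)) (C.*-cong three (C.sym (Σ-const U C.1#)))) square)))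
      where
      three : 3 · C.1# ≋ C.1# C.+ C.1# C.+ C.1#
      three = C.trans (C.+-congˡ (C.+-congˡ (C.+-identityʳ C.1#))) (C.sym (C.+-assoc C.1# C.1# C.1#))
      square : (card F ℕ.^ 2) · C.1# ≋ N C.* N
      square = C.trans (×1-homo-* (card F) (card F ℕ.* 1)) (C.*-cong (C.sym (Σ-const F C.1#))
        (C.trans (C.reflexive (≡.cong (_· C.1#) (ℕ.*-identityʳ (card F)))) (C.sym (Σ-const F C.1#))))

-- From the unique maximal ideal to nonunits.

module LocalRing {c ℓ} (R : CommutativeRing c ℓ) (F : Finite (CommutativeRing.setoid R)) (isLocal : IsLocal R) where
  open CommutativeRing R hiding (zero)
  open FiniteSetoid F using (_≟_; any?; to∘from)
  open FiniteRing R F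
  open IsLocal isLocal
  private
    module RS = IntegerSolver R
    module M  = Ideal maximalIdeal

  private
    -- The ideal I + (r), encoded by the coefficient of r so that decidability of I is inherited by
    -- a search over the ring.
    adjoin : Ideal R → Carrier → Ideal R
    adjoin I r = record
      { _∈I  = λ x → ∃[ y ] (x - r * y) ∈ I
      ; resp = λ x≈x′ (y , p) → y , I.resp (+-congʳ x≈x′) p
      ; 0∈   = 0# , I.resp (RS.solve 1 (λ r → RS.con (+ 0) RS.:= RS.con (+ 0) RS.:- r RS.:* RS.con (+ 0)) refl r) I.0∈
      ; +∈   = λ {x} {x′} (y , p) (y′ , p′) → y + y′ , I.resp
                 (RS.solve 5 (λ r x x′ y y′ → (x RS.:- r RS.:* y) RS.:+ (x′ RS.:- r RS.:* y′) RS.:= (x RS.:+ x′) RS.:- r RS.:* (y RS.:+ y′)) refl r x x′ y y′)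
                 (I.+∈ p p′)
      ; *∈   = λ s {x} (y , p) → s * y , I.resp
                 (RS.solve 4 (λ r s x y → s RS.:* (x RS.:- r RS.:* y) RS.:= s RS.:* x RS.:- r RS.:* (s RS.:* y)) refl r s x y)
                 (I.*∈ s p)
      }
      where module I = Ideal I

    ⊆-adjoin : ∀ I r → I ⊆ adjoin I r
    ⊆-adjoin I r {x} p = 0# , Ideal.resp I (RS.solve 2 (λ x r → x RS.:= x RS.:- r RS.:* RS.con (+ 0)) refl x r) p

    ∈-adjoin : ∀ I r → r ∈ adjoin I r
    ∈-adjoin I r = 1# , Ideal.resp I (RS.solve 1 (λ r → RS.con (+ 0) RS.:= r RS.:- r RS.:* RS.con (+ 1)) refl r) (Ideal.0∈ I)

    adjoin-⊆ : ∀ I r J → I ⊆ J → r ∈ J → adjoin I r ⊆ J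
    adjoin-⊆ I r J I⊆J r∈J {x} (y , p) = Ideal.resp J
      (RS.solve 3 (λ x r y → (x RS.:- r RS.:* y) RS.:+ y RS.:* r RS.:= x) refl x r y)
      (Ideal.+∈ J (I⊆J p) (Ideal.*∈ J y r∈J))

    adjoin? : ∀ I r → (∀ x → Dec (x ∈ I)) → ∀ x → Dec (x ∈ adjoin I r)
    adjoin? I r I? x = any? (λ p → Ideal.resp I (+-congˡ (-‿cong (*-congˡ p)))) (λ y → I? (x - r * y))

    -- Elements xs i are adjoined one after the other as long as the ideal stays proper.
    climb : ∀ {k} (xs : Fin k → Carrier) (I : Ideal R) → (∀ x → Dec (x ∈ I)) → IsProper I →
            Σ[ J ∈ Ideal R ] (I ⊆ J × IsProper J ×
              (∀ L → J ⊆ L → IsProper L → ∀ i → xs i ∈ L → xs i ∈ J))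
    climb {zero}  xs I I? proper = I , (λ p → p) , proper , λ _ _ _ ()
    climb {suc k} xs I I? proper with adjoin? I (xs zero) I? 1#
    -- No proper ideal above `I` contains `xs zero`, so it can be passed over for good.
    ... | yes 1∈ = let J , I⊆J , J-proper , max = climb (xs ∘ suc) I I? proper in
      J , I⊆J , J-proper , λ
        { L J⊆L L-proper zero    x∈L → contradiction (adjoin-⊆ I (xs zero) L (λ p → J⊆L (I⊆J p)) x∈L 1∈) L-proper
        ; L J⊆L L-proper (suc i) x∈L → max L J⊆L L-proper i x∈L }
    ... | no 1∉ = let J , I′⊆J , J-proper , max = climb (xs ∘ suc) (adjoin I (xs zero)) (adjoin? I (xs zero) I?) 1∉ in
      J , (λ p → I′⊆J (⊆-adjoin I (xs zero) p)) , J-proper , λ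
        { L J⊆L L-proper zero    x∈L → I′⊆J (∈-adjoin I (xs zero))
        ; L J⊆L L-proper (suc i) x∈L → max L J⊆L L-proper i x∈L }

  -- Adjoining the enumerated elements greedily extends I to some maximal ideal, which uniqueness
  -- identifies with the given one.
  proper⊆maximal : ∀ I → (∀ x → Dec (x ∈ I)) → IsProper I → I ⊆ maximalIdeal
  proper⊆maximal I I? proper p =
    let J , I⊆J , J-proper , max = climb (Inverse.to (proj₂ F)) I I? proper
        J-max : ∀ L → J ⊆ L → IsProper L → L ⊆ J
        J-max L J⊆L L-proper {x} x∈L = Ideal.resp J (to∘from x)
          (max L J⊆L L-proper (Inverse.from (proj₂ F) x) (Ideal.resp L (sym (to∘from x)) x∈L))
    in proj₁ (unique J (J-proper , J-max)) (I⊆J p)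

  nonUnit⇒∈ : ∀ {x} → NonUnit x → x ∈ maximalIdeal
  nonUnit⇒∈ {x} nx = proper⊆maximal (multiples x)
    (λ z → any? (λ p q → trans q (*-congˡ p)) (λ y → z ≟ (x * y)))
    (λ (y , 1≈xy) → nx (y , sym 1≈xy)) (1# , sym (*-identityʳ x))

  ∈⇒nonUnit : ∀ {x} → x ∈ maximalIdeal → NonUnit x
  ∈⇒nonUnit {x} x∈M (y , xy≈1) = proj₁ isMaximal (M.resp (trans (*-comm y x) xy≈1) (M.*∈ y x∈M))

  isOddLocal : ¬ IsField R → OddCharacteristic (R / maximalIdeal) → IsOddLocal
  isOddLocal ¬field (p , isChar , ¬2∣p) = record
    { 0-nonUnit = ∈⇒nonUnit M.0∈
    ; +-nonUnit = λ nx ny → ∈⇒nonUnit (M.+∈ (nonUnit⇒∈ nx) (nonUnit⇒∈ ny))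
    ; 2-unit    = ¬nonUnit⇒unit λ n → 2∉ (nonUnit⇒∈ n)
    ; m         = proj₁ nonzero
    ; m-nonUnit = proj₁ (proj₂ nonzero)
    ; m≉0       = proj₂ (proj₂ nonzero)
    }
    where
    1∉ : ¬ (1# ∈ maximalIdeal)
    1∉ = proj₁ isMaximal
    p∤1 : ¬ (p ∣ 1)
    p∤1 p∣1 = 1∉ (M.resp (RS.solve 0 (RS.con (+ 1) RS.:+ RS.con (+ 0) RS.:- RS.con (+ 0) RS.:= RS.con (+ 1)) refl)
                (Equivalence.from (isChar 1) p∣1))
    p∤2 : ∀ {p} → ¬ (p ∣ 1) → ¬ (2 ∣ p) → ¬ (p ∣ 2)
    -- Characteristic 0 is divisible by 2, so oddness excludes it.
    p∤2 {0} _ ¬2∣p _ = ¬2∣p (2 ∣0)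
    p∤2 {1} p∤1 _ _ = p∤1 ∣-refl
    p∤2 {2} _ ¬2∣p _ = ¬2∣p ∣-refl
    p∤2 {suc (suc (suc p))} _ _ p∣2 with ∣⇒≤ p∣2
    ... | ℕ.s≤s (ℕ.s≤s ())
    2∉ : ¬ ((1# + 1#) ∈ maximalIdeal)
    2∉ 2∈ = p∤2 p∤1 ¬2∣p (Equivalence.to (isChar 2) (M.resp
      (RS.solve 0 (RS.con (+ 1) RS.:+ RS.con (+ 1) RS.:= (RS.con (+ 1) RS.:+ (RS.con (+ 1) RS.:+ RS.con (+ 0))) RS.:- RS.con (+ 0)) refl) 2∈))
    nonzero : ∃[ x ] NonUnit x × ¬ (x ≈ 0#)
    nonzero = decidable-stable
      (any? {P = λ x → NonUnit x × ¬ (x ≈ 0#)} (λ p (n , ≉0) → NonUnit-resp p n , λ q → ≉0 (trans p q))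
        (λ x → nonUnit? x ×-dec ¬? (x ≟ 0#)))
      λ ¬∃ → ¬field ((λ 1≈0 → 1∉ (M.resp (sym 1≈0) M.0∈)) ,
        λ x x≉0 → ¬nonUnit⇒unit λ n → ¬∃ (x , n , x≉0))

-- Complexification, norms and unitarity of characters.

record IsRealLike (F : CommutativeRing b c) : Set (b ⊔ Level.suc c) where
  open CommutativeRing F
  field
    stable     : ∀ {x y} → ¬ ¬ (x ≈ y) → x ≈ y
    domain     : ∀ {x y} → x * y ≈ 0# → ¬ (x ≈ 0#) → y ≈ 0#
    1≉0        : ¬ (1# ≈ 0#)
    NonNeg     : Pred Carrier c
    nonNeg-0   : NonNeg 0#
    nonNeg-1   : NonNeg 1#
    nonNeg-+   : ∀ {x y} → NonNeg x → NonNeg y → NonNeg (x + y)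
    nonNeg-sq  : ∀ x → NonNeg (x * x)
    +≈0⇒≈0     : ∀ {x y} → NonNeg x → NonNeg y → x + y ≈ 0# → x ≈ 0#

module Complexification {c ℓ} (F : CommutativeRing c ℓ) (isRealLike : IsRealLike F) where
  open CommutativeRing F hiding (zero)
  open IsRealLike isRealLike
  open AdjoinI F using (Element; R[i]) renaming (_+i_ to infix 5 _+𝕚_) public
  open Element
  open SemiringMult semiring using () renaming (_×_ to _·_)
  private
    module C  = CommutativeRing R[i]
    module FS = IntegerSolver F
    module ΣF = Sums F
    module ΣC = Sums R[i]
  open SemiringMult C.semiring using () renaming (_×_ to _·ᶜ_)

  square≈0 : ∀ {x} → x * x ≈ 0# → x ≈ 0#
  square≈0 x²≈0 = stable λ x≉0 → x≉0 (domain x²≈0 x≉0)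

  norm : Element → Carrier
  norm z = re z * re z + im z * im z

  conj : Element → Element
  conj z = re z +𝕚 (- im z)

  nonNeg-norm : ∀ z → NonNeg (norm z)
  nonNeg-norm z = nonNeg-+ (nonNeg-sq (re z)) (nonNeg-sq (im z))

  norm≈0 : ∀ {z} → norm z ≈ 0# → z C.≈ C.0#
  norm≈0 {z} eq = square≈0 (+≈0⇒≈0 (nonNeg-sq (re z)) (nonNeg-sq (im z)) eq) ,
                  square≈0 (+≈0⇒≈0 (nonNeg-sq (im z)) (nonNeg-sq (re z)) (trans (+-comm _ _) eq))

  norm-* : ∀ z w → norm (z C.* w) ≈ norm z * norm w
  norm-* (a +𝕚 b) (p +𝕚 q) = FS.solve 4 (λ a b p q →
    let r = a FS.:* p FS.:- b FS.:* q ; s = a FS.:* q FS.:+ b FS.:* p in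
    r FS.:* r FS.:+ s FS.:* s FS.:= (a FS.:* a FS.:+ b FS.:* b) FS.:* (p FS.:* p FS.:+ q FS.:* q)) refl a b p q

  norm-cong : ∀ {z w} → z C.≈ w → norm z ≈ norm w
  norm-cong (p , q) = +-cong (*-cong p p) (*-cong q q)

  z*conj : ∀ z → z C.* conj z C.≈ (norm z +𝕚 0#)
  z*conj (a +𝕚 b) =
    FS.solve 2 (λ a b → a FS.:* a FS.:- b FS.:* (FS.:- b) FS.:= a FS.:* a FS.:+ b FS.:* b) refl a b ,
    FS.solve 2 (λ a b → a FS.:* (FS.:- b) FS.:+ b FS.:* a FS.:= FS.con (+ 0)) refl a b

  conj-* : ∀ z w → conj (z C.* w) C.≈ conj z C.* conj w
  conj-* (a +𝕚 b) (p +𝕚 q) =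
    FS.solve 4 (λ a b p q → a FS.:* p FS.:- b FS.:* q FS.:= a FS.:* p FS.:- (FS.:- b) FS.:* (FS.:- q)) refl a b p q ,
    FS.solve 4 (λ a b p q → FS.:- (a FS.:* q FS.:+ b FS.:* p) FS.:= a FS.:* (FS.:- q) FS.:+ (FS.:- b) FS.:* p) refl a b p q

  nonNeg-· : ∀ n → NonNeg (n · 1#)
  nonNeg-· zero    = nonNeg-0
  nonNeg-· (suc n) = nonNeg-+ nonNeg-1 (nonNeg-· n)

  re-· : ∀ n → re (n ·ᶜ C.1#) ≈ n · 1#
  re-· zero    = refl
  re-· (suc n) = +-congˡ (re-· n)

  -- The norm is multiplicative and vanishes only at 0, which carries the domain property over. A
  -- sum of ones cannot vanish, since its nonnegative summands would vanish separately.
  isDomain : IsCharacteristicZeroDomain R[i]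
  isDomain = record
    { stable  = λ ¬¬p → stable (λ ¬q → ¬¬p (λ p → ¬q (proj₁ p))) , stable (λ ¬q → ¬¬p (λ p → ¬q (proj₂ p)))
    ; domain  = λ {z} {w} zw≈0 z≉0 → norm≈0 (domain
        (trans (sym (norm-* z w)) (trans (norm-cong zw≈0) (FS.solve 0 (FS.con (+ 0) FS.:* FS.con (+ 0) FS.:+ FS.con (+ 0) FS.:* FS.con (+ 0) FS.:= FS.con (+ 0)) refl)))
        (λ eq → z≉0 (norm≈0 eq)))
    ; suc·1≉0 = λ n (eq , _) → 1≉0 (+≈0⇒≈0 nonNeg-1 (nonNeg-· n) (trans (sym (re-· (suc n))) eq))
    }

  private
    open SemiringSum semiring using () renaming (sum to sumF)
    open SemiringSum C.semiring using () renaming (sum to sumC)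

    nonNeg-sum : ∀ {n} {f : Fin n → Carrier} → (∀ i → NonNeg (f i)) → NonNeg (sumF f)
    nonNeg-sum {zero}  nn = nonNeg-0
    nonNeg-sum {suc n} nn = nonNeg-+ (nn zero) (nonNeg-sum (nn ∘ suc))

    sum≈0 : ∀ {n} {f : Fin n → Carrier} → (∀ i → NonNeg (f i)) → sumF f ≈ 0# → ∀ i → f i ≈ 0#
    sum≈0 nn eq zero    = +≈0⇒≈0 (nn zero) (nonNeg-sum (nn ∘ suc)) eq
    sum≈0 nn eq (suc i) = sum≈0 (nn ∘ suc) (+≈0⇒≈0 (nonNeg-sum (nn ∘ suc)) (nn zero) (trans (+-comm _ _) eq)) i

    re-sum : ∀ {n} (f : Fin n → Element) → re (sumC f) ≈ sumF (re ∘ f)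
    re-sum {zero}  f = refl
    re-sum {suc n} f = +-congˡ (re-sum (f ∘ suc))

    conj-sum : ∀ {n} (f : Fin n → Element) → conj (sumC f) C.≈ sumC (conj ∘ f)
    conj-sum {zero}  f = refl , FS.solve 0 (FS.:- FS.con (+ 0) FS.:= FS.con (+ 0)) refl
    conj-sum {suc n} f = +-congˡ (proj₁ (conj-sum (f ∘ suc))) ,
      trans (FS.solve 2 (λ x y → FS.:- (x FS.:+ y) FS.:= FS.:- x FS.:+ FS.:- y) refl _ _) (+-congˡ (proj₂ (conj-sum (f ∘ suc))))

  module _ {S : Setoid a b} (fin : Finite S) where
    open ΣF using () renaming (Σ⟨_⟩_ to ΣF⟨_⟩_)
    open ΣC using () renaming (Σ⟨_⟩_ to ΣC⟨_⟩_)
    private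
      module S = Setoid S
      module E = Inverse (proj₂ fin)

    Σ≈0 : ∀ {f} → (∀ {x y} → x S.≈ y → f x ≈ f y) → (∀ x → NonNeg (f x)) → ΣF⟨ fin ⟩ f ≈ 0# → ∀ x → f x ≈ 0#
    Σ≈0 {f} f-cong nn eq x = trans (f-cong (S.sym (FiniteSetoid.to∘from fin x)))
      (sum≈0 (λ i → nn (E.to i)) (trans (reflexive (≡.sym (ΣF.Σ≡∑ fin f))) eq) (E.from x))

    re-Σ : ∀ f → re (ΣC⟨ fin ⟩ f) ≈ ΣF⟨ fin ⟩ (re ∘ f)
    re-Σ f = trans (reflexive (≡.cong re (ΣC.Σ≡∑ fin f))) (trans (re-sum (f ∘ E.to)) (reflexive (≡.sym (ΣF.Σ≡∑ fin _))))

    conj-Σ : ∀ f → conj (ΣC⟨ fin ⟩ f) C.≈ ΣC⟨ fin ⟩ (conj ∘ f)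
    conj-Σ f = C.trans (C.reflexive (≡.cong conj (ΣC.Σ≡∑ fin f)))
      (C.trans (conj-sum (f ∘ E.to)) (C.reflexive (≡.sym (ΣC.Σ≡∑ fin _))))

  module UnitaryCharacter (G : AbelianGroup a b) (fin : Finite (AbelianGroup.setoid G))
    (χ : AbelianGroup.Carrier G → Element) where
    private module G = AbelianGroup G
    open ΣF

    module _ (χ-cong : ∀ {g h} → g G.≈ h → χ g C.≈ χ h) (χ-∙ : ∀ g h → χ (g G.∙ h) C.≈ χ g C.* χ h)
      (χ-ε : χ G.ε C.≈ C.1#) where

      private
        T : Carrier
        T = Σ⟨ fin ⟩ (λ g → norm (χ g))

        norm-1 : norm C.1# ≈ 1#
        norm-1 = FS.solve 0 (FS.con (+ 1) FS.:* FS.con (+ 1) FS.:+ FS.con (+ 0) FS.:* FS.con (+ 0) FS.:= FS.con (+ 1)) refl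

        T≉0 : ¬ (T ≈ 0#)
        T≉0 eq = 1≉0 (trans (sym (trans (norm-cong χ-ε) norm-1))
          (Σ≈0 fin (λ p → norm-cong (χ-cong p)) (λ g → nonNeg-norm (χ g)) eq G.ε))

      -- By translation invariance of T = Σ |χ g|², |χ h|² T = T.
      norm≈1 : ∀ h → norm (χ h) ≈ 1#
      norm≈1 h = trans (FS.solve 1 (λ n → n FS.:= (n FS.:- FS.con (+ 1)) FS.:+ FS.con (+ 1)) refl _)
        (trans (+-congʳ (domain (trans
          (FS.solve 2 (λ T n → T FS.:* (n FS.:- FS.con (+ 1)) FS.:= n FS.:* T FS.:- T) refl T (norm (χ h)))
          (trans (+-congʳ (sym fixed)) (-‿inverseʳ T))) T≉0)) (+-identityˡ 1#))
        where
        fixed : T ≈ norm (χ h) * T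
        fixed = trans (Σ-translate G fin (λ g → norm (χ g)) (λ p → norm-cong (χ-cong p)) h)
          (trans (Σ-cong fin (λ g → trans (norm-cong (χ-∙ h g)) (norm-* (χ h) (χ g)))) (Σ-*ˡ fin _ _))

      χ*χ⁻¹ : ∀ g → χ g C.* χ (g G.⁻¹) C.≈ C.1#
      χ*χ⁻¹ g = C.trans (C.sym (χ-∙ g (g G.⁻¹))) (C.trans (χ-cong (G.inverseʳ g)) χ-ε)

      -- Norm one makes the conjugate an inverse of χ g, and inverses are unique.
      conj-χ : ∀ g → conj (χ g) C.≈ χ (g G.⁻¹)
      conj-χ g = begin
        conj (χ g)                                ≈⟨ C.*-identityʳ _ ⟨
        conj (χ g) C.* C.1#                       ≈⟨ C.*-congˡ (χ*χ⁻¹ g) ⟨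
        conj (χ g) C.* (χ g C.* χ (g G.⁻¹))       ≈⟨ C.*-assoc _ _ _ ⟨
        (conj (χ g) C.* χ g) C.* χ (g G.⁻¹)       ≈⟨ C.*-congʳ (C.trans (C.*-comm _ _) (C.trans (z*conj (χ g)) (norm≈1 g , refl))) ⟩
        C.1# C.* χ (g G.⁻¹)                       ≈⟨ C.*-identityˡ _ ⟩
        χ (g G.⁻¹)                                ∎
        where open SetoidReasoning C.setoid

-- Stability, the domain property and square roots for Cauchy reals.

module RealNumbers where
  open Real using (seq; cauchy)
  private module S = ℚSolver.+-*-Solver

  -- A property of the representing sequence, not of its class under `≃`; squares and their sums
  -- have it term by term.
  NonNegative : Real → Set
  NonNegative x = ∀ n → 0ℚ ℚ.≤ seq x n

  +-nonNegative : ∀ {p q} → 0ℚ ℚ.≤ p → 0ℚ ℚ.≤ q → 0ℚ ℚ.≤ p ℚ.+ q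
  +-nonNegative {p} {q} 0≤p 0≤q = ≡.subst (ℚ._≤ p ℚ.+ q) (ℚ.+-identityˡ 0ℚ) (ℚ.+-mono-≤ 0≤p 0≤q)

  *-nonNegative : ∀ {p q} → 0ℚ ℚ.≤ p → 0ℚ ℚ.≤ q → 0ℚ ℚ.≤ p ℚ.* q
  *-nonNegative {p} {q} 0≤p 0≤q = ≡.subst (ℚ._≤ p ℚ.* q) (ℚ.*-zeroˡ 0ℚ) (*-mono-≤ ℚ.≤-refl 0≤p 0≤p 0≤q)

  square-nonNegative : ∀ p → 0ℚ ℚ.≤ p ℚ.* p
  square-nonNegative p with ℚ.∣p∣≡p∨∣p∣≡-p p
  ... | inj₁ eq = *-nonNegative (≡.subst (0ℚ ℚ.≤_) eq (ℚ.0≤∣p∣ p)) (≡.subst (0ℚ ℚ.≤_) eq (ℚ.0≤∣p∣ p))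
  ... | inj₂ eq = ≡.subst (0ℚ ℚ.≤_) (S.solve 1 (λ p → (S.:- p) S.:* (S.:- p) S.:= p S.:* p) ≡.refl p)
                    (*-nonNegative (≡.subst (0ℚ ℚ.≤_) eq (ℚ.0≤∣p∣ p)) (≡.subst (0ℚ ℚ.≤_) eq (ℚ.0≤∣p∣ p)))

  minus-zero : ∀ p → p ℚ.- 0ℚ ≡ p
  minus-zero = S.solve 1 (λ p → p S.:- S.con 0ℚ S.:= p) ≡.refl

  -- The positive form of being nonzero. Its negation already gives equality with zero, and it is
  -- closed under products; stability and the domain property rest on these two facts.
  Apart₀ : Real → Set
  Apart₀ x = ∃[ ε ] 0ℚ ℚ.< ε × ∃[ N ] ∀ n → N ℕ.≤ n → ε ℚ.≤ ∣ seq x n ∣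

  half-< : ∀ {ε} → 0ℚ ℚ.< ε → ε ℚ.* ½ ℚ.< ε
  half-< {ε} 0<ε = ≡.subst₂ ℚ._<_ (ℚ.+-identityʳ _) (½+½ ε) (ℚ.+-monoʳ-< (ε ℚ.* ½) (half-pos 0<ε))

  apart⇒≄0 : ∀ {x} → Apart₀ x → ¬ (x ≃ const 0ℚ)
  apart⇒≄0 {x} (ε , 0<ε , N , f) eq = let M , g = eq (ε ℚ.* ½) (half-pos 0<ε) ; k = M ℕ.⊔ N in
    ℚ.<-irrefl ≡.refl (ℚ.<-≤-trans (half-< 0<ε) (ℚ.≤-trans (f k (ℕ.m≤n⊔m M N))
      (≡.subst (λ q → ∣ q ∣ ℚ.≤ ε ℚ.* ½) (minus-zero (seq x k)) (g k (ℕ.m≤m⊔n M N)))))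

  -- A rational comparison at one late index N decides: if |x_N| ≤ ε/2 the tail stays within ε,
  -- otherwise it stays above ε/4 and x is apart from zero.
  ¬apart⇒≃0 : ∀ {x} → ¬ Apart₀ x → x ≃ const 0ℚ
  ¬apart⇒≃0 {x} ¬apart ε 0<ε with cauchy x (ε ℚ.* ½ ℚ.* ½) (half-pos (half-pos 0<ε))
  ... | N , f with ∣ seq x N ∣ ℚ.≤? ε ℚ.* ½
  ...   | yes le = N , λ n N≤n → ≡.subst (ℚ._≤ ε) (≡.cong ∣_∣ (≡.sym (minus-zero (seq x n)))) (begin
      ∣ seq x n ∣                                 ≡⟨ ≡.cong ∣_∣ (S.solve 2 (λ p q → p S.:= (p S.:- q) S.:+ q) ≡.refl (seq x n) (seq x N)) ⟩
      ∣ (seq x n ℚ.- seq x N) ℚ.+ seq x N ∣       ≤⟨ ℚ.∣p+q∣≤∣p∣+∣q∣ (seq x n ℚ.- seq x N) (seq x N) ⟩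
      ∣ seq x n ℚ.- seq x N ∣ ℚ.+ ∣ seq x N ∣     ≤⟨ ℚ.+-mono-≤ (f n N N≤n ℕ.≤-refl) le ⟩
      ε ℚ.* ½ ℚ.* ½ ℚ.+ ε ℚ.* ½                   ≤⟨ ℚ.+-monoˡ-≤ (ε ℚ.* ½) (ℚ.<⇒≤ (half-< (half-pos 0<ε))) ⟩
      ε ℚ.* ½ ℚ.+ ε ℚ.* ½                         ≡⟨ ½+½ ε ⟩
      ε                                           ∎)
    where open ℚ.≤-Reasoning
  ...   | no ¬le = ⊥-elim (¬apart (h , half-pos (half-pos 0<ε) , N , λ n N≤n → bound n (f N n ℕ.≤-refl N≤n)))
    where
    h = ε ℚ.* ½ ℚ.* ½
    bound : ∀ n → ∣ seq x N ℚ.- seq x n ∣ ℚ.≤ h → h ℚ.≤ ∣ seq x n ∣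
    bound n close with h ℚ.≤? ∣ seq x n ∣
    ... | yes p = p
    ... | no ¬p = ⊥-elim (ℚ.<-irrefl ≡.refl (begin-strict
      ε ℚ.* ½                                     <⟨ ℚ.≰⇒> ¬le ⟩
      ∣ seq x N ∣                                 ≡⟨ ≡.cong ∣_∣ (S.solve 2 (λ p q → p S.:= (p S.:- q) S.:+ q) ≡.refl (seq x N) (seq x n)) ⟩
      ∣ (seq x N ℚ.- seq x n) ℚ.+ seq x n ∣       ≤⟨ ℚ.∣p+q∣≤∣p∣+∣q∣ (seq x N ℚ.- seq x n) (seq x n) ⟩
      ∣ seq x N ℚ.- seq x n ∣ ℚ.+ ∣ seq x n ∣     ≤⟨ ℚ.+-mono-≤ close (ℚ.<⇒≤ (ℚ.≰⇒> ¬p)) ⟩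
      h ℚ.+ h                                     ≡⟨ ½+½ (ε ℚ.* ½) ⟩
      ε ℚ.* ½                                     ∎))
      where open ℚ.≤-Reasoning

  apart-* : ∀ {x y} → Apart₀ x → Apart₀ y → Apart₀ (x *ᵣ y)
  apart-* {x} {y} (ε , 0<ε , M , f) (δ , 0<δ , N , g) = ε ℚ.* δ , *-pos 0<ε 0<δ , M ℕ.⊔ N , λ n le →
    ≡.subst (ε ℚ.* δ ℚ.≤_) (≡.sym (ℚ.∣p*q∣≡∣p∣*∣q∣ (seq x n) (seq y n)))
      (*-mono-≤ (ℚ.<⇒≤ 0<δ) (ℚ.0≤∣p∣ (seq x n)) (f n (⊔₁ le)) (g n (⊔₂ {M} le)))

  ≃0-stable : ∀ {x} → ¬ ¬ (x ≃ const 0ℚ) → x ≃ const 0ℚ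
  ≃0-stable {x} ¬¬eq = ¬apart⇒≃0 {x} λ apart → ¬¬eq (apart⇒≄0 {x} apart)

  ≃-stable : ∀ {x y} → ¬ ¬ (x ≃ y) → x ≃ y
  ≃-stable {x} {y} ¬¬eq ε 0<ε = let N , f = ≃0-stable {x +ᵣ (-ᵣ y)} (λ ¬diff → ¬¬eq (λ eq → ¬diff (difference eq))) ε 0<ε
    in N , λ n le → ≡.subst (λ q → ∣ q ∣ ℚ.≤ ε) (minus-zero _) (f n le)
    where
    difference : x ≃ y → x +ᵣ (-ᵣ y) ≃ const 0ℚ
    difference eq δ 0<δ = let M , g = eq δ 0<δ in
      M , λ n le → ≡.subst (λ q → ∣ q ∣ ℚ.≤ δ) (≡.sym (minus-zero _)) (g n le)

  ≃-domain : ∀ {x y} → x *ᵣ y ≃ const 0ℚ → ¬ (x ≃ const 0ℚ) → y ≃ const 0ℚ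
  ≃-domain {x} {y} xy≃0 x≄0 = ¬apart⇒≃0 {y} λ ay → x≄0 (¬apart⇒≃0 {x} λ ax →
    apart⇒≄0 {x *ᵣ y} (apart-* {x} {y} ax ay) xy≃0)

  +≃0⇒≃0 : ∀ {x y} → NonNegative x → NonNegative y → x +ᵣ y ≃ const 0ℚ → x ≃ const 0ℚ
  +≃0⇒≃0 {x} {y} 0≤x 0≤y eq ε 0<ε = let N , f = eq ε 0<ε in N , λ n le →
    ≤⇒dist (seq x n) 0ℚ
      (ℚ.≤-trans (≡.subst (ℚ._≤ seq x n ℚ.+ seq y n) (ℚ.+-identityʳ (seq x n)) (ℚ.+-monoʳ-≤ (seq x n) (0≤y n)))
        (dist⇒≤ (seq x n ℚ.+ seq y n) 0ℚ (f n le)))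
      (+-nonNegative (0≤x n) (ℚ.<⇒≤ 0<ε))

  isRealLike : IsRealLike ℝ
  isRealLike = record
    { stable    = λ {x} {y} → ≃-stable {x} {y}
    ; domain    = λ {x} {y} → ≃-domain {x} {y}
    ; 1≉0       = apart⇒≄0 {const 1ℚ} (1ℚ , ℚ.positive⁻¹ 1ℚ , 0 , λ _ _ → ℚ.≤-refl)
    ; NonNeg    = NonNegative
    ; nonNeg-0  = λ _ → ℚ.≤-refl
    ; nonNeg-1  = λ _ → ℚ.<⇒≤ (ℚ.positive⁻¹ 1ℚ)
    ; nonNeg-+  = λ 0≤x 0≤y n → +-nonNegative (0≤x n) (0≤y n)
    ; nonNeg-sq = λ x n → square-nonNegative (seq x n)
    ; +≈0⇒≈0    = λ {x} {y} → +≃0⇒≃0 {x} {y}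
    }

  √-square : ∀ {x} → NonNegative x → √ x *ᵣ √ x ≃ x
  √-square {x} 0≤x ε 0<ε =
    let B , 0<B , K , bounded = eventuallyBounded (√ x)
        0≤2B       = +-nonNegative (ℚ.<⇒≤ 0<B) (ℚ.<⇒≤ 0<B)
        -- Chosen with 2B δ + δ = ε. The square of the approximate root r misses its target by at
        -- most 2 r h + h², where r ≤ B and the mesh h is at most δ and at most 1.
        δ , 0<δ , eq = scale (B ℚ.+ B) 1ℚ 0≤2B (ℚ.positive⁻¹ 1ℚ) 0<ε
        M , f      = mesh-small δ 0<δ
        L , g      = mesh-small 1ℚ (ℚ.positive⁻¹ 1ℚ)
    in (K ℕ.⊔ K) ℕ.⊔ (M ℕ.⊔ L) , λ n le →
      let (K≤n , _) , (M≤n , L≤n) = ⊔₄ K K M L le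
          open SqrtApprox (sqrtTerm x n)
          x≡ : 0ℚ ℚ.⊔ seq x n ≡ seq x n
          x≡ = ℚ.p≤q⇒p⊔q≡q (0≤x n)
          h  = mesh n
          0≤h = ℚ.<⇒≤ (mesh-pos n)
          root≤B = ℚ.≤-trans (p≤∣p∣ root) (bounded n K≤n)
          error : (root ℚ.+ root) ℚ.* h ℚ.+ h ℚ.* h ℚ.≤ ε
          error = ≡.subst ((root ℚ.+ root) ℚ.* h ℚ.+ h ℚ.* h ℚ.≤_) eq (ℚ.+-mono-≤
            (*-mono-≤ 0≤h 0≤2B (ℚ.+-mono-≤ root≤B root≤B) (f n M≤n))
            (*-mono-≤ 0≤h (ℚ.<⇒≤ (ℚ.positive⁻¹ 1ℚ)) (g n L≤n) (f n M≤n)))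
      in ≤⇒dist (root ℚ.* root) (seq x n)
        (ℚ.≤-trans (≡.subst (root ℚ.* root ℚ.≤_) x≡ root²≤)
          (≡.subst (ℚ._≤ seq x n ℚ.+ ε) (ℚ.+-identityʳ (seq x n)) (ℚ.+-monoʳ-≤ (seq x n) (ℚ.<⇒≤ 0<ε))))
        (ℚ.≤-trans (≡.subst (ℚ._≤ (root ℚ.+ h) ℚ.* (root ℚ.+ h)) x≡ (ℚ.<⇒≤ <root+δ²))
          (≡.subst (ℚ._≤ root ℚ.* root ℚ.+ ε)
            (S.solve 2 (λ r h → r S.:* r S.:+ ((r S.:+ r) S.:* h S.:+ h S.:* h) S.:= (r S.:+ h) S.:* (r S.:+ h)) ≡.refl root h)
            (ℚ.+-monoʳ-≤ (root ℚ.* root) error)))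

  open SemiringMult (CommutativeRing.semiring ℝ) using () renaming (_×_ to _·_)

  ·1≃fromℕ : ∀ n → n · const 1ℚ ≃ fromℕ n
  ·1≃fromℕ n = pointwise {n · const 1ℚ} {fromℕ n} λ k → ≡.trans (seq-· n k) (ℚ.toℚᵘ-injective
    (ℚᵘ.≃-trans (toℚᵘ-ι n) (ℚᵘ.≃-sym (ℚ.toℚᵘ-fromℚᵘ (ℚᵘ.mkℚᵘ (+ n) 0)))))
    where
    seq-· : ∀ n k → seq (n · const 1ℚ) k ≡ ι n 1ℚ
    seq-· zero    k = ≡.refl
    seq-· (suc n) k = ≡.cong (1ℚ ℚ.+_) (seq-· n k)

  modulus⁴ : ∀ z → modulus z ^ᵣ 4 ≃ Complexification.norm ℝ isRealLike z *ᵣ Complexification.norm ℝ isRealLike z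
  modulus⁴ (x +i y) = fourthPower (√ q) q (√-square {q} (λ n → +-nonNegative (square-nonNegative (seq x n)) (square-nonNegative (seq y n))))
    where
    q : Real
    q = x *ᵣ x +ᵣ y *ᵣ y
    module RS = CommutativeRing ℝ
    fourthPower : ∀ s q → s *ᵣ s ≃ q → s ^ᵣ 4 ≃ q *ᵣ q
    fourthPower s q eq = RS.trans {s ^ᵣ 4} {(s *ᵣ s) *ᵣ (s *ᵣ s)} {q *ᵣ q}
      (pointwise {s ^ᵣ 4} {(s *ᵣ s) *ᵣ (s *ᵣ s)} λ n →
        S.solve 1 (λ s → s S.:* (s S.:* (s S.:* (s S.:* S.con 1ℚ))) S.:= (s S.:* s) S.:* (s S.:* s)) ≡.refl (seq s n))
      (*ᵣ-cong {s *ᵣ s} {q} {s *ᵣ s} {q} eq eq)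

-- The conjugate sum as a Kloosterman sum, and the moment of absolute values.

module AbsoluteFourthMoment {c ℓ d e} (R : CommutativeRing c ℓ) (F : Finite (CommutativeRing.setoid R))
  (local : FiniteRing.IsOddLocal R F)
  (𝕂 : CommutativeRing d e) (isRealLike : IsRealLike 𝕂)
  (χ : PrimitiveCharacter R (AdjoinI.R[i] 𝕂)) (σ : SocleTrivialCharacter R F (AdjoinI.R[i] 𝕂)) where
  open CommutativeRing R hiding (zero)
  open FiniteRing R F
  open Complexification 𝕂 isRealLike
  open PrimitiveCharacter χ
  open SocleTrivialCharacter σ
  open Unit
  private
    module K  = CommutativeRing 𝕂
    module C  = CommutativeRing R[i]
    module RS = IntegerSolver R
    module KS = IntegerSolver 𝕂
    module G  = AbelianGroup (unitGroup R)
    module ΣK = Sums 𝕂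
  open SemiringMult K.semiring using () renaming (_×_ to _·_)
  open SemiringMult C.semiring using () renaming (_×_ to _·ᶜ_)

  χ̄ : PrimitiveCharacter R R[i]
  χ̄ = record
    { ψ           = λ x → ψ (- x)
    ; ψ-cong      = λ p → ψ-cong (-‿cong p)
    ; ψ-+         = λ x y → C.trans (ψ-cong (RS.solve 2 (λ x y → RS.:- (x RS.:+ y) RS.:= RS.:- x RS.:+ RS.:- y) refl x y)) (ψ-+ _ _)
    ; ψ-0         = C.trans (ψ-cong (RS.solve 0 (RS.:- RS.con (+ 0) RS.:= RS.con (+ 0)) refl)) ψ-0
    ; isPrimitive = λ I trivial → isPrimitive I λ x x∈I → C.trans
        (ψ-cong (RS.solve 1 (λ x → x RS.:= RS.:- (RS.:- RS.con (+ 1) RS.:* x)) refl x))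
        (trivial (- 1# * x) (Ideal.*∈ I (- 1#) x∈I))
    }

  σ̄ : SocleTrivialCharacter R F R[i]
  σ̄ = record
    { τ       = λ u → τ (u G.⁻¹)
    ; τ-cong  = λ {u} {v} p → τ-cong {u G.⁻¹} {v G.⁻¹} (G.⁻¹-cong {u} {v} p)
    ; τ-∙     = λ u v → C.trans (τ-cong {(u G.∙ v) G.⁻¹} {u G.⁻¹ G.∙ v G.⁻¹} refl) (τ-∙ (u G.⁻¹) (v G.⁻¹))
    -- Uses u⁻¹ - 1 = -u⁻¹ (u - 1), which stays in the socle.
    ; τ-socle = λ u su → τ-socle (u G.⁻¹) (Socle-resp
        (trans (RS.solve 2 (λ u i → (RS.:- i) RS.:* (u RS.:- RS.con (+ 1)) RS.:= i RS.:- u RS.:* i) refl (val u) (inv u))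
          (+-congˡ (-‿cong (val*inv u))))
        (Ideal.*∈ socle (- inv u) su))
    }

  private
    τ-ε : τ G.ε C.≈ C.1#
    τ-ε = τ-socle G.ε (Socle-resp (sym (-‿inverseʳ 1#)) (Ideal.0∈ socle))

    module Ψ = UnitaryCharacter +-abelianGroup F ψ
    module T = UnitaryCharacter (unitGroup R) (unitsFinite R F) τ

  open FourthMoment R F local R[i] isDomain χ χ̄ σ σ̄ using (fourth; fourthMoment; module Conjugate)
  open Conjugate using () renaming (K to K̄)
  open KloostermanSum R F local R[i] isDomain χ σ using (K; term)
  open UnitCounting R F local R[i] isDomain using (U)

  conj-K : ∀ a → conj (K a) C.≈ K̄ a
  conj-K a = C.trans (conj-Σ U (term a)) (Sums.Σ-cong R[i] U (λ u → C.trans (conj-* _ _)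
    (C.*-cong (T.conj-χ (λ {u} {v} → τ-cong {u} {v}) τ-∙ τ-ε u) (Ψ.conj-χ ψ-cong ψ-+ ψ-0 _))))

  -- The product K K̄ has vanishing imaginary part, so taking real parts of the complex moment loses
  -- nothing.
  re-fourth : ∀ a → Element.re (fourth a) K.≈ norm (K a) K.* norm (K a)
  re-fourth a = K.trans (proj₁ (C.*-cong KK̄ KK̄)) (KS.solve 1 (λ n → n KS.:* n KS.:- KS.con (+ 0) KS.:* KS.con (+ 0) KS.:= n KS.:* n) K.refl (norm (K a)))
    where
    KK̄ : K a C.* K̄ a C.≈ (norm (K a) +𝕚 K.0#)
    KK̄ = C.trans (C.*-congˡ (C.sym (conj-K a))) (z*conj (K a))

  absoluteFourthMoment : ΣK.Σ⟨_⟩_ U (λ a → norm (K (val a)) K.* norm (K (val a)))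
                         K.≈ (3 ℕ.* card U ℕ.* card F ℕ.^ 2) · K.1#
  absoluteFourthMoment = begin
    ΣK.Σ⟨_⟩_ U (λ a → norm (K (val a)) K.* norm (K (val a)))  ≈⟨ ΣK.Σ-cong U (λ a → K.sym (re-fourth (val a))) ⟩
    ΣK.Σ⟨_⟩_ U (λ a → Element.re (fourth (val a)))            ≈⟨ re-Σ U (λ a → fourth (val a)) ⟨
    Element.re (Sums.Σ⟨_⟩_ R[i] U (λ a → fourth (val a)))     ≈⟨ proj₁ moment ⟩
    Element.re ((3 ℕ.* card U ℕ.* card F ℕ.^ 2) ·ᶜ C.1#)      ≈⟨ re-· (3 ℕ.* card U ℕ.* card F ℕ.^ 2) ⟩
    (3 ℕ.* card U ℕ.* card F ℕ.^ 2) · K.1#                    ∎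
    where
    open SetoidReasoning K.setoid
    moment : Sums.Σ⟨_⟩_ R[i] U (λ a → fourth (val a)) C.≈ (3 ℕ.* card U ℕ.* card F ℕ.^ 2) ·ᶜ C.1#
    moment = fourthMoment (Ψ.χ*χ⁻¹ ψ-cong ψ-+ ψ-0) (T.χ*χ⁻¹ (λ {u} {v} → τ-cong {u} {v}) τ-∙ τ-ε)

  module _ (summand : Carrier → Unit R → Element)
    (summand≈ : ∀ a u → summand a u C.≈ τ u C.* ψ (val u + a * inv u))
    (Kl : Carrier → Element) (Kl≈ : ∀ a → Kl a C.≈ ∑ C.+-commutativeMonoid U (summand a))
    (g : Element → K.Carrier) (g≈ : ∀ z → g z K.≈ norm z K.* norm z) where

    ∑-fourthMoment : ∑ K.+-commutativeMonoid U (λ a → g (Kl (val a))) K.≈ (3 ℕ.* card U ℕ.* card F ℕ.^ 2) · K.1#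
    ∑-fourthMoment = begin
      ∑ K.+-commutativeMonoid U (λ a → g (Kl (val a)))          ≡⟨ ΣK.Σ≡∑ U _ ⟨
      ΣK.Σ⟨_⟩_ U (λ a → g (Kl (val a)))                         ≈⟨ ΣK.Σ-cong U (λ a → K.trans (g≈ _)
          (K.*-cong (norm-cong (Kl≈K (val a))) (norm-cong (Kl≈K (val a))))) ⟩
      ΣK.Σ⟨_⟩_ U (λ a → norm (K (val a)) K.* norm (K (val a)))  ≈⟨ absoluteFourthMoment ⟩
      (3 ℕ.* card U ℕ.* card F ℕ.^ 2) · K.1#                    ∎
      where
      open SetoidReasoning K.setoid
      Kl≈K : ∀ a → Kl a C.≈ K a
      Kl≈K a = C.trans (Kl≈ a) (C.trans (C.reflexive (≡.sym (Sums.Σ≡∑ R[i] U (summand a)))) (Sums.Σ-cong R[i] U (summand≈ a)))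

-- Transfer to complex characters and the theorem.

module _ {c ℓ} (R : CommutativeRing c ℓ) (F : Finite (CommutativeRing.setoid R))
  (local : FiniteRing.IsOddLocal R F)
  (Ψ : AdditiveCharacter R) (Ψ-primitive : IsPrimitiveAdditive R Ψ) (T : MultiplicativeCharacter R) where
  open CommutativeRing R hiding (zero)
  open FiniteRing R F
  open RealNumbers
  private
    module Ψ = Character Ψ
    module T = Character T
    module ΨH = Morphism.GroupMorphisms.IsGroupHomomorphism Ψ.isHomomorphism
    module TH = Morphism.GroupMorphisms.IsGroupHomomorphism T.isHomomorphism
    module K  = CommutativeRing ℝ

  primitiveCharacter : PrimitiveCharacter R ℂ
  primitiveCharacter = record
    { ψ           = Ψ.value
    ; ψ-cong      = ΨH.⟦⟧-cong
    ; ψ-+         = ΨH.homo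
    ; ψ-0         = ΨH.ε-homo
    ; isPrimitive = λ I trivial x∈I → lower (proj₁ (Ψ-primitive I trivial) x∈I)
    }

  module _ (T-socle : ∀ u → Socle (Unit.val u - 1#) → T.IsOne u) where

    socleTrivialCharacter : SocleTrivialCharacter R F ℂ
    socleTrivialCharacter = record
      { τ       = T.value
      ; τ-cong  = TH.⟦⟧-cong
      ; τ-∙     = TH.homo
      ; τ-socle = T-socle
      }

    private
      module C = CommutativeRing ℂ

      U : Finite (AbelianGroup.setoid (unitGroup R))
      U = unitsFinite R F

      summand : Carrier → Unit R → Complex
      summand a u = T.value u C.* Ψ.value (Unit.val u + a * Unit.inv u)

      -- Conversion of products in ℂ compares the Cauchy moduli of their coordinates and does not
      -- terminate in practice, so the two sums are matched summand by summand with respect to ≈.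
      Kloosterman≈ : ∀ a → Kloosterman R F Ψ T a C.≈ ∑ C.+-commutativeMonoid U (summand a)
      Kloosterman≈ a = SemiringSum.sum-cong-≋ C.semiring {card U}
        (λ i → C.refl {summand a (Inverse.to (proj₂ U) i)})

    fourthMoment-socle :
      ∑ (CommutativeRing.+-commutativeMonoid ℝ) (unitsFinite R F)
        (λ a → modulus (Kloosterman R F Ψ T (Unit.val a)) ^ᵣ 4)
      ≃ fromℕ (3 ℕ.* card (unitsFinite R F) ℕ.* card F ℕ.^ 2)
    fourthMoment-socle = K.trans
      {∑ (CommutativeRing.+-commutativeMonoid ℝ) (unitsFinite R F)
        (λ a → modulus (Kloosterman R F Ψ T (Unit.val a)) ^ᵣ 4)}
      {(3 ℕ.* card (unitsFinite R F) ℕ.* card F ℕ.^ 2) · const 1ℚ}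
      {fromℕ (3 ℕ.* card (unitsFinite R F) ℕ.* card F ℕ.^ 2)}
      (AbsoluteFourthMoment.∑-fourthMoment R F local ℝ isRealLike primitiveCharacter socleTrivialCharacter
        summand (λ a u → C.refl {summand a u}) (Kloosterman R F Ψ T) Kloosterman≈ (λ z → modulus z ^ᵣ 4) modulus⁴)
      (·1≃fromℕ (3 ℕ.* card (unitsFinite R F) ℕ.* card F ℕ.^ 2))
      where open SemiringMult (CommutativeRing.semiring ℝ) using () renaming (_×_ to _·_)

open import Data.Nat using (_*_; _^_)

mainTheorem12 : ∀ {c ℓ} (R : CommutativeRing c ℓ)
    (finite : Finite (CommutativeRing.setoid R))
    (local : IsLocal R) →
    IsFrobenius R →
    ¬ IsField R →
    OddCharacteristic (R / IsLocal.maximalIdeal local) →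
    (ψ : AdditiveCharacter R) → IsPrimitiveAdditive R ψ →
    (τ : MultiplicativeCharacter R) →
    ¬ IsPrimitiveMultiplicative R (IsLocal.maximalIdeal local) τ →
    ∑ (CommutativeRing.+-commutativeMonoid ℝ) (unitsFinite R finite)
    (λ a → modulus (Kloosterman R finite ψ τ (Unit.val a)) ^ᵣ 4)
    ≃ fromℕ (3 * card (unitsFinite R finite) * card finite ^ 2)
mainTheorem12 R finite local _ ¬field odd ψ ψ-primitive τ τ-nonprimitive =
  -- By stability the formula may be assumed to fail. Under that assumption the conductor of τ is
  -- shown to be (0), against non-primitivity.
  RealNumbers.≃-stable {LHS} {RHS} λ ¬goal → τ-nonprimitive record
    { ifTrivial    = λ trivial → ⊥-elim (¬goal (moment (λ u _ → trivial u)))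
    ; ifNontrivial = λ _ →
        ((λ { (lift x≈0) → M.resp (sym x≈0) M.0∈ }) ,
         (λ { u x (lift x≈0) u≈1+x → C.trans {Character.value τ u} {Character.value τ G.ε} {C.1#}
                (IsGroupHomomorphism.⟦⟧-cong (Character.isHomomorphism τ)
                  {u} {G.ε} (trans u≈1+x (trans (+-congˡ x≈0) (+-identityʳ 1#))))
                (IsGroupHomomorphism.ε-homo (Character.isHomomorphism τ)) })) ,
        -- A nonzero x in J would put the socle inside (x) and hence inside J. Then τ would be
        -- trivial on 1 + S and the formula would hold after all.
        λ J J⊆M trivial {x} x∈J → lift (decidable-stable (x ≟ 0#) λ x≉0 → ¬goal (moment λ u su →
          let r , eq = socle⊆multiples x≉0 su
          in trivial u (Unit.val u - 1#) (Ideal.resp J (trans (*-comm r x) (sym eq)) (Ideal.*∈ J r x∈J))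
               (RS.solve 1 (λ u → u RS.:= RS.con (+ 1) RS.:+ (u RS.:- RS.con (+ 1))) refl (Unit.val u))))
    }
  where
  open CommutativeRing R hiding (_*_)
  open FiniteSetoid finite using (_≟_)
  open LocalRing R finite local using (isOddLocal)
  open Morphism.GroupMorphisms using (module IsGroupHomomorphism)
  module M  = Ideal (IsLocal.maximalIdeal local)
  module C  = CommutativeRing ℂ
  module G  = AbelianGroup (unitGroup R)
  module RS = IntegerSolver R
  oddLocal : FiniteRing.IsOddLocal R finite
  oddLocal = isOddLocal ¬field odd
  open Orthogonality R finite oddLocal ℂ (Complexification.isDomain ℝ RealNumbers.isRealLike)
    (primitiveCharacter R finite oddLocal ψ ψ-primitive τ) using (socle⊆multiples)
  LHS RHS : Real
  LHS = ∑ (CommutativeRing.+-commutativeMonoid ℝ) (unitsFinite R finite)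
    (λ a → modulus (Kloosterman R finite ψ τ (Unit.val a)) ^ᵣ 4)
  RHS = fromℕ (3 * card (unitsFinite R finite) * card finite ^ 2)
  moment : (∀ u → FiniteRing.Socle R finite (Unit.val u - 1#) → Character.IsOne τ u) → LHS ≃ RHS
  moment = fourthMoment-socle R finite oddLocal ψ ψ-primitive τ
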